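{- Let $a$ be a positive integer and let $G$ be an $a$-locally bipartite graph. (1) If $\delta(G) > (1 - 1/(a+4/3))|G|$, then $G$ is $(a+2)$-colourable. This is tight: for every $t \geqslant 1$, the balanced blow-up of $K_{a-1}(3) + \overline{C}_7$ in which every vertex is replaced by $t$ vertices is $a$-locally bipartite, has minimum degree $(1 - 1/(a+4/3))$ times its number of vertices, and is not $(a+2)$-colourable. (2) If $\delta(G) > (1 - 1/(a+5/4))|G|$, then $G$ is either $(a+2)$-colourable or contains $K_{a-1} + \overline{C}_7$. (3) If $\delta(G) > (1 - 1/(a+6/5))|G|$, then $G$ is either $(a+2)$-colourable or contains $K_{a-1}+\overline{C}_7$ or $K_{a-1} + H_2^{+}$. (4) If $\delta(G) > (1 - 1/(a+7/6))|G|$, then $G$ is either $(a+2)$-colourable or contains $K_{a-1} + H_2$. (5) If $\delta(G) > (1 - 1/(a+8/7))|G|$, then $G$ is either $(a+2)$-colourable or contains $K_{a-1}+H_2$ or $K_{a-1}+T_0$. (6) For any $\varepsilon > 0$ there is a constant $C$ such that if $\delta(G) > (1 - 1/(a+1) + \varepsilon)|G|$, then $G$ is $C$-colourable. (7) There are $a$-locally bipartite graphs $G$ with minimum degree $(1 - 1/(a+1) - o(1))|G|$ and arbitrarily large chromatic number. (Here "contains" means as a subgraph.)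
   Context: Graphs are finite and simple; $|G|$ is the number of vertices, $\delta(G)$ the minimum degree. A graph is $a$-locally bipartite if for every clique on $a$ vertices, the subgraph induced on the common neighbourhood of its vertices is $2$-colourable. For graphs $A,B$, the join $A+B$ is the disjoint union of $A$ and $B$ with every vertex of $A$ joined to every vertex of $B$; $K_m$ is the complete graph on $m$ vertices (with $K_0$ empty) and $K_{a-1}(3)$ is the complete $(a-1)$-partite graph with all parts of size $3$. A blow-up of a graph replaces each vertex $v$ by an independent set $I_v$ and each edge $uv$ by the complete bipartite graph between $I_u$ and $I_v$. $\overline{C}_7$ has vertices $a_0,\dots,a_6$ with $a_i$ adjacent to $a_{i\pm1}$ and $a_{i\pm 2}$ (indices mod 7). $H_2$ is $\overline{C}_7$ minus the edge $a_6a_1$. $H_2^{+}$ is $H_2$ together with one new vertex adjacent exactly to $a_0$, $a_2$, $a_5$. $T_0$ has vertices $v_0,\dots,v_6,u_1,u_6,t$ with edges $v_iv_{i+1}$ ($i$ mod 7), $u_1v_i$ for all $i\neq1$, $u_6v_i$ for all $i\neq 6$, and $tv_0,tu_1,tu_6$ (no other edges). -}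

module Defs where

open import Data.Nat as ℕ using (ℕ; zero; suc; _∸_) renaming (_≡ᵇ_ to _==_)
open import Data.Bool using (Bool; true; false; not; _∧_; _∨_; if_then_else_)
open import Data.Bool.Properties using (∨-comm)
open import Data.Fin using (Fin; toℕ; splitAt; quotient)
import Data.Fin as F
open import Data.Sum using (_⊎_; inj₁; inj₂)
open import Data.Product using (Σ; _×_; _,_; proj₁; proj₂)
open import Data.List using (List; []; _∷_)
open import Data.Bool.ListAction using (any)
open import Data.Integer using (+_)
open import Data.Rational using (ℚ; _/_; 1ℚ; 0ℚ; _-_; _+_; _*_; _<_; _≤_)
open import Function.Definitions using (Injective)
open import Relation.Binary.PropositionalEquality using (_≡_; _≢_; refl; cong; cong₂)

record Graph : Set where
  field
    size  : ℕ
    E     : Fin size → Fin size → Bool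
    E-sym : ∀ u v → E u v ≡ E v u
    E-irr : ∀ u → E u u ≡ false
open Graph public

∣_∣ : Graph → ℕ
∣ G ∣ = size G

Adj : (G : Graph) → Fin (size G) → Fin (size G) → Set
Adj G u v = E G u v ≡ true

countF : ∀ {n} → (Fin n → Bool) → ℕ
countF {zero}  f = 0
countF {suc n} f = (if f F.zero then 1 else 0) ℕ.+ countF (λ i → f (F.suc i))

deg : (G : Graph) → Fin (size G) → ℕ
deg G v = countF (E G v)

ℕ→ℚ : ℕ → ℚ
ℕ→ℚ n = (+ n) / 1

MinDeg> : Graph → ℚ → Set
MinDeg> G r = ∀ v → r * ℕ→ℚ ∣ G ∣ < ℕ→ℚ (deg G v)

MinDeg≥ : Graph → ℚ → Set
MinDeg≥ G r = ∀ v → r * ℕ→ℚ ∣ G ∣ ≤ ℕ→ℚ (deg G v)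

MinDeg≡ : Graph → ℚ → Set
MinDeg≡ G r = MinDeg≥ G r × Σ (Fin (size G)) (λ v → ℕ→ℚ (deg G v) ≡ r * ℕ→ℚ ∣ G ∣)

Colourable : Graph → ℕ → Set
Colourable G k = Σ (Fin (size G) → Fin k) λ c → ∀ u v → Adj G u v → c u ≢ c v

IsClique : (G : Graph) {a : ℕ} → (Fin a → Fin (size G)) → Set
IsClique G S = Injective _≡_ _≡_ S × (∀ i j → i ≢ j → Adj G (S i) (S j))

CommonNbr : (G : Graph) {a : ℕ} → (Fin a → Fin (size G)) → Fin (size G) → Set
CommonNbr G S u = ∀ i → Adj G (S i) u

LocallyBipartite : ℕ → Graph → Set
LocallyBipartite a G =
  (S : Fin a → Fin (size G)) → IsClique G S →
  Σ (Fin (size G) → Fin 2) λ c →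
    ∀ u v → CommonNbr G S u → CommonNbr G S v → Adj G u v → c u ≢ c v

Contains : Graph → Graph → Set
Contains G H = Σ (Fin (size H) → Fin (size G)) λ f →
  Injective _≡_ _≡_ f × (∀ x y → Adj H x y → Adj G (f x) (f y))

==-sym : ∀ m n → (m == n) ≡ (n == m)
==-sym zero zero = refl
==-sym zero (suc n) = refl
==-sym (suc m) zero = refl
==-sym (suc m) (suc n) = ==-sym m n

==-refl : ∀ n → (n == n) ≡ true
==-refl zero = refl
==-refl (suc n) = ==-refl n

K : ℕ → Graph
K m = record
  { size = m
  ; E = λ i j → not (toℕ i == toℕ j)
  ; E-sym = λ i j → cong not (==-sym (toℕ i) (toℕ j))
  ; E-irr = λ i → cong not (==-refl (toℕ i))
  }

private
  hit : ℕ → ℕ → ℕ × ℕ → Bool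
  hit i j (x , y) = ((x == i) ∧ (y == j)) ∨ ((x == j) ∧ (y == i))

  hit-sym : ∀ i j e → hit i j e ≡ hit j i e
  hit-sym i j (x , y) = ∨-comm ((x == i) ∧ (y == j)) ((x == j) ∧ (y == i))

  any-hit-sym : ∀ i j es → any (hit i j) es ≡ any (hit j i) es
  any-hit-sym i j [] = refl
  any-hit-sym i j (e ∷ es) = cong₂ _∨_ (hit-sym i j e) (any-hit-sym i j es)

  fe : ∀ n → List (ℕ × ℕ) → Fin n → Fin n → Bool
  fe n es u v = not (toℕ u == toℕ v) ∧ any (hit (toℕ u) (toℕ v)) es

  fe-irr : ∀ n es u → fe n es u u ≡ false
  fe-irr n es u rewrite ==-refl (toℕ u) = refl

fromEdges : (n : ℕ) → List (ℕ × ℕ) → Graph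
fromEdges n es = record
  { size = n
  ; E = fe n es
  ; E-sym = λ u v → cong₂ (λ x y → not x ∧ y) (==-sym (toℕ u) (toℕ v))
                          (any-hit-sym (toℕ u) (toℕ v) es)
  ; E-irr = fe-irr n es
  }

private
  joinE : ∀ {m n} → (Fin m → Fin m → Bool) → (Fin n → Fin n → Bool) →
          Fin m ⊎ Fin n → Fin m ⊎ Fin n → Bool
  joinE EA EB (inj₁ i) (inj₁ j) = EA i j
  joinE EA EB (inj₁ i) (inj₂ j) = true
  joinE EA EB (inj₂ i) (inj₁ j) = true
  joinE EA EB (inj₂ i) (inj₂ j) = EB i j

  joinE-sym : ∀ {m n} (EA : Fin m → Fin m → Bool) (EB : Fin n → Fin n → Bool) →
              (∀ u v → EA u v ≡ EA v u) → (∀ u v → EB u v ≡ EB v u) →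
              ∀ x y → joinE EA EB x y ≡ joinE EA EB y x
  joinE-sym EA EB sa sb (inj₁ i) (inj₁ j) = sa i j
  joinE-sym EA EB sa sb (inj₁ i) (inj₂ j) = refl
  joinE-sym EA EB sa sb (inj₂ i) (inj₁ j) = refl
  joinE-sym EA EB sa sb (inj₂ i) (inj₂ j) = sb i j

  joinE-irr : ∀ {m n} (EA : Fin m → Fin m → Bool) (EB : Fin n → Fin n → Bool) →
              (∀ u → EA u u ≡ false) → (∀ u → EB u u ≡ false) →
              ∀ x → joinE EA EB x x ≡ false
  joinE-irr EA EB ia ib (inj₁ i) = ia i
  joinE-irr EA EB ia ib (inj₂ i) = ib i

_⊕_ : Graph → Graph → Graph
A ⊕ B = record
  { size = size A ℕ.+ size B
  ; E = λ x y → joinE (E A) (E B) (splitAt (size A) x) (splitAt (size A) y)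
  ; E-sym = λ x y → joinE-sym (E A) (E B) (E-sym A) (E-sym B)
                      (splitAt (size A) x) (splitAt (size A) y)
  ; E-irr = λ x → joinE-irr (E A) (E B) (E-irr A) (E-irr B) (splitAt (size A) x)
  }

blowUp : Graph → ℕ → Graph
blowUp G t = record
  { size = size G ℕ.* t
  ; E = λ x y → E G (quotient t x) (quotient t y)
  ; E-sym = λ x y → E-sym G (quotient t x) (quotient t y)
  ; E-irr = λ x → E-irr G (quotient t x)
  }

K3 : ℕ → Graph
K3 m = blowUp (K m) 3

-- complement of C_7: a_i ~ a_{i±1}, a_{i±2}
C7bar : Graph
C7bar = fromEdges 7
  ( (0 , 1) ∷ (1 , 2) ∷ (2 , 3) ∷ (3 , 4) ∷ (4 , 5) ∷ (5 , 6) ∷ (6 , 0)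
  ∷ (0 , 2) ∷ (1 , 3) ∷ (2 , 4) ∷ (3 , 5) ∷ (4 , 6) ∷ (5 , 0) ∷ (6 , 1) ∷ [])

-- H_2 = C7bar minus the edge a_6 a_1
H2 : Graph
H2 = fromEdges 7
  ( (0 , 1) ∷ (1 , 2) ∷ (2 , 3) ∷ (3 , 4) ∷ (4 , 5) ∷ (5 , 6) ∷ (6 , 0)
  ∷ (0 , 2) ∷ (1 , 3) ∷ (2 , 4) ∷ (3 , 5) ∷ (4 , 6) ∷ (5 , 0) ∷ [])

-- H_2^+ = H_2 plus a vertex (index 7) adjacent exactly to a_0, a_2, a_5
H2⁺ : Graph
H2⁺ = fromEdges 8
  ( (0 , 1) ∷ (1 , 2) ∷ (2 , 3) ∷ (3 , 4) ∷ (4 , 5) ∷ (5 , 6) ∷ (6 , 0)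
  ∷ (0 , 2) ∷ (1 , 3) ∷ (2 , 4) ∷ (3 , 5) ∷ (4 , 6) ∷ (5 , 0)
  ∷ (7 , 0) ∷ (7 , 2) ∷ (7 , 5) ∷ [])

-- T_0: v_0..v_6 = 0..6, u_1 = 7, u_6 = 8, t = 9
T0 : Graph
T0 = fromEdges 10
  ( (0 , 1) ∷ (1 , 2) ∷ (2 , 3) ∷ (3 , 4) ∷ (4 , 5) ∷ (5 , 6) ∷ (6 , 0)
  ∷ (7 , 0) ∷ (7 , 2) ∷ (7 , 3) ∷ (7 , 4) ∷ (7 , 5) ∷ (7 , 6)
  ∷ (8 , 0) ∷ (8 , 1) ∷ (8 , 2) ∷ (8 , 3) ∷ (8 , 4) ∷ (8 , 5)
  ∷ (9 , 0) ∷ (9 , 7) ∷ (9 , 8) ∷ [])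

-- thr a k = 1 - 1/(a + (k+1)/k) = 1 - k/(k·a + k + 1)   (for k ≥ 1)
thr : ℕ → ℕ → ℚ
thr a k = 1ℚ - (+ k) / (suc k ℕ.+ k ℕ.* a)

thr∞ : ℕ → ℚ
thr∞ a = 1ℚ - (+ 1) / suc a

Pos : ℚ → Set
Pos ε = 0ℚ < ε

{-# OPTIONS --safe #-}
-- Parts (1)-(5). If every vertex has at most m non-neighbours, then the numbers of non-neighbours
-- of a few chosen vertices can be added up with weights: when every vertex misses a large weight
-- this contradicts the degree condition, so some vertex is adjacent to much of the chosen set.
-- Iterating this, T₀ forces H₂ above 7/13, H₂ forces C̄₇ or H₂⁺ above 6/11, H₂⁺ is impossible
-- above 5/9 and C̄₇ above 4/7, always inside the common neighbourhood of an (a-1)-clique; also the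
-- Moser spindle forces H₂ above 8/15. It remains to (a+2)-colour a graph without H₂ and T₀. Remove
-- a maximum independent set I. If the rest is (a-1)-locally bipartite, induct on a. Otherwise some
-- (a-1)-clique outside I has an odd cycle outside I in its common neighbourhood; take the shortest.
-- A triangle gives a spindle by maximality of I; cycles of length 5 and 7 are excluded by the
-- weighting argument applied to the cycle together with vertices of I, the latter using T₀; on
-- a longer one every vertex outside I sees at most two vertices and every vertex of I misses one.
--
-- Part (6). Given a partition of the vertices, colour u by the set of parts in which u has a
-- positive proportion of neighbours. If adjacent u and v get the same colour, refine the partition
-- by N(u) and N(v). Each side of the bipartite common neighbourhood of an a-clique in N(u) ∩ N(v)
-- misses N(u) or N(v), so the total size of the parts met by it drops: this happens boundedly often.
--
-- Part (7). Increasing r-tuples with the shift adjacency have large chromatic number. For a random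
-- sequence of points, the tuples whose first hit is at an even position are independent (r odd) and
-- contain each tuple with probability about (r-1)/2r. Joining each tuple accordingly to both sides
-- of a complete bipartite graph gives a locally bipartite graph of relative degree about 1/2.

module Submission where

open import Defs
open import Data.Nat as ℕ using (ℕ; zero; suc; _+_; _*_; _∸_; _^_; _≤_; _<_; z≤n; s≤s; s≤s⁻¹; z<s; _≤ᵇ_; _<ᵇ_; _≡ᵇ_; _≤?_)
open import Data.Nat.Properties
open import Data.Nat.ListAction using (sum)
open import Data.Nat.Tactic.RingSolver using (solve-∀)
open import Data.Integer as ℤ using (ℤ; -[1+_])
import Data.Integer.Properties as ℤ
import Data.Integer.Tactic.RingSolver as ℤRing
open import Data.Rational as ℚ using (ℚ; 1ℚ; mkℚ; toℚᵘ) renaming (_+_ to _+ℚ_; _-_ to _-ℚ_)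
import Data.Rational.Properties as ℚ
open import Data.Rational.Unnormalised as ℚᵘ using (ℚᵘ; mkℚᵘ; *≡*; *<*; *≤*)
import Data.Rational.Unnormalised.Properties as ℚᵘ
open import Data.Bool using (Bool; true; false; not; _∧_; _∨_; _xor_; if_then_else_; T)
import Data.Bool.Properties as Bool
open import Data.Bool.ListAction using (all; any)
open import Data.Fin using (Fin; toℕ; zero; suc; _↑ˡ_; _↑ʳ_; combine; remQuot; quotient; splitAt; punchIn; punchOut; finToFun; funToFin)
import Data.Fin.Properties as Fin
open import Data.Fin.Subset.Properties using (anySubset?)
open import Data.Product using (Σ; _×_; _,_; proj₁; proj₂)
open import Data.Sum using (_⊎_; inj₁; inj₂)
open import Data.Unit using (⊤; tt)
open import Data.Empty using (⊥; ⊥-elim)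
open import Data.Maybe using (Maybe; just; nothing) renaming (map to mapMaybe)
open import Data.List using (List; []; _∷_; map; _++_; length; replicate; foldr; lookup; upTo; allFin; cartesianProduct)
open import Data.List.Properties using (length-++; length-replicate; ++-identityʳ)
open import Data.List.Membership.Propositional.Properties using (∈-allFin; ∈-cartesianProduct⁺; ∈-upTo⁺; ∈-lookup)
open import Data.List.Relation.Unary.All as All using (All; []; _∷_)
import Data.List.Relation.Unary.All.Properties as All
open import Data.List.Relation.Unary.Any using (Any; here; there)
open import Data.List.Relation.Binary.Permutation.Propositional as Perm using (_↭_; prep; ↭-sym)
open import Data.List.Relation.Binary.Permutation.Propositional.Properties using (All-resp-↭; ↭-length; shift)
import Data.Vec as Vec
import Data.Vec.Properties as Vec
open import Function using (_∘_; id; case_of_)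
open import Function.Definitions using (Injective)
open import Relation.Nullary using (¬_; Dec; yes; no)
open import Relation.Nullary.Decidable using (_×-dec_; _→-dec_; ¬?; toWitness) renaming (map′ to mapDec)
open import Relation.Binary.Definitions using (tri<; tri≈; tri>)
open import Relation.Binary.PropositionalEquality using (_≡_; _≢_; refl; sym; trans; cong; cong₂; subst; subst₂; module ≡-Reasoning)

-- Sums over Fin n

-- Write m for the largest number of non-neighbours of a vertex, the vertex itself included. In
-- (1)-(5) the bound with (k+1)/k becomes (ka + k + 1)m < kn. Passing to the common neighbourhood M
-- of a clique on c vertices costs at most cm vertices, so for an (a-1)-clique (2k+1)m < k|M|
-- remains, whatever a is. Each exclusion is then one finite statement: weights w on a configuration
-- such that every vertex of M misses weight t, with k·Σw ≤ (2k+1)t. It is checked by evaluation. An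
-- independent set lies inside the non-neighbourhood of each of its members, so it has at most m
-- vertices. Hence it can serve as one more weighted vertex, and deleting it costs exactly what
-- lowering a by one allows. Two obstacles shape the induction. The complement of I must again be
-- free of H₂ and T₀, now over cliques with one vertex fewer, which takes two certificates of its
-- own. And a forbidden configuration may be met with some of its vertices identified, so everything
-- is done up to homomorphism and genuine subgraphs are recovered only at the end. In (6) and (7)
-- all constants come from a number q with 1/((a+1)q) ≤ ε.

ι : Bool → ℕ
ι b = if b then 1 else 0

sumF : ∀ {n} → (Fin n → ℕ) → ℕ
sumF {zero}  f = 0
sumF {suc n} f = f zero + sumF (f ∘ suc)

countF≡sumF : ∀ {n} (f : Fin n → Bool) → countF f ≡ sumF (ι ∘ f)
countF≡sumF {zero}  f = refl
countF≡sumF {suc n} f = cong (ι (f zero) +_) (countF≡sumF (f ∘ suc))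

sumF-mono : ∀ {n} {f g : Fin n → ℕ} → (∀ i → f i ≤ g i) → sumF f ≤ sumF g
sumF-mono {zero}  h = z≤n
sumF-mono {suc n} h = +-mono-≤ (h zero) (sumF-mono (h ∘ suc))

sumF-cong : ∀ {n} {f g : Fin n → ℕ} → (∀ i → f i ≡ g i) → sumF f ≡ sumF g
sumF-cong {zero}  h = refl
sumF-cong {suc n} h = cong₂ _+_ (h zero) (sumF-cong (h ∘ suc))

interchange : ∀ a b c d → (a + b) + (c + d) ≡ (a + c) + (b + d)
interchange = solve-∀

sumF-+ : ∀ {n} (f g : Fin n → ℕ) → sumF (λ i → f i + g i) ≡ sumF f + sumF g
sumF-+ {zero}  f g = refl
sumF-+ {suc n} f g = trans (cong ((f zero + g zero) +_) (sumF-+ (f ∘ suc) (g ∘ suc)))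
                           (interchange (f zero) (g zero) _ _)

sumF-*ˡ : ∀ {n} c (f : Fin n → ℕ) → sumF (λ i → c * f i) ≡ c * sumF f
sumF-*ˡ {zero}  c f = sym (*-zeroʳ c)
sumF-*ˡ {suc n} c f = trans (cong (c * f zero +_) (sumF-*ˡ c (f ∘ suc)))
                            (sym (*-distribˡ-+ c (f zero) _))

sumF-const : ∀ n c → sumF {n} (λ _ → c) ≡ n * c
sumF-const zero    c = refl
sumF-const (suc n) c = cong (c +_) (sumF-const n c)

sumF-zero : ∀ {n} (f : Fin n → ℕ) → (∀ i → f i ≡ 0) → sumF f ≡ 0
sumF-zero {n} f h = trans (sumF-cong h) (trans (sumF-const n 0) (*-zeroʳ n))

sumF-swap : ∀ {m n} (f : Fin m → Fin n → ℕ) →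
            sumF (λ i → sumF (f i)) ≡ sumF (λ j → sumF (λ i → f i j))
sumF-swap {zero} {n} f = sym (sumF-zero {n} (λ _ → 0) (λ _ → refl))
sumF-swap {suc m} f = trans (cong (sumF (f zero) +_) (sumF-swap (f ∘ suc)))
                            (sym (sumF-+ (f zero) _))

term≤sumF : ∀ {n} (f : Fin n → ℕ) i → f i ≤ sumF f
term≤sumF f zero    = m≤m+n _ _
term≤sumF f (suc i) = ≤-trans (term≤sumF (f ∘ suc) i) (m≤n+m _ _)

sumF-↑ : ∀ m {n} (f : Fin (m + n) → ℕ) →
         sumF f ≡ sumF (λ i → f (i ↑ˡ n)) + sumF (λ j → f (m ↑ʳ j))
sumF-↑ zero    f = refl
sumF-↑ (suc m) f = trans (cong (f zero +_) (sumF-↑ m (f ∘ suc))) (sym (+-assoc (f zero) _ _))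

sumF-combine : ∀ m n (f : Fin (m * n) → ℕ) → sumF f ≡ sumF (λ i → sumF (λ j → f (combine {m} {n} i j)))
sumF-combine zero    n f = refl
sumF-combine (suc m) n f = trans (sumF-↑ n f)
  (cong (sumF (λ j → f (j ↑ˡ (m * n))) +_) (sumF-combine m n (λ k → f (n ↑ʳ k))))

count : ∀ {n} → (Fin n → Bool) → ℕ
count f = sumF (ι ∘ f)

ι-mono : ∀ {b c} → (b ≡ true → c ≡ true) → ι b ≤ ι c
ι-mono {false} h = z≤n
ι-mono {true}  h rewrite h refl = ≤-refl

ι≤1 : ∀ b → ι b ≤ 1
ι≤1 false = z≤n
ι≤1 true  = ≤-refl

count-mono : ∀ {n} {f g : Fin n → Bool} → (∀ i → f i ≡ true → g i ≡ true) → count f ≤ count g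
count-mono h = sumF-mono (λ i → ι-mono (h i))

count-cong : ∀ {n} {f g : Fin n → Bool} → (∀ i → f i ≡ g i) → count f ≡ count g
count-cong h = sumF-cong (λ i → cong ι (h i))

count≤n : ∀ {n} (f : Fin n → Bool) → count f ≤ n
count≤n {n} f = ≤-trans (sumF-mono (λ i → ι≤1 (f i))) (≤-reflexive (trans (sumF-const n 1) (*-identityʳ n)))

count-true : ∀ n → count {n} (λ _ → true) ≡ n
count-true n = trans (sumF-const n 1) (*-identityʳ n)

ι-not : ∀ b → ι b + ι (not b) ≡ 1
ι-not false = refl
ι-not true  = refl

count-not : ∀ {n} (f : Fin n → Bool) → count f + count (not ∘ f) ≡ n
count-not {n} f = trans (sym (sumF-+ (ι ∘ f) (ι ∘ not ∘ f)))
  (trans (sumF-cong (λ i → ι-not (f i))) (trans (sumF-const n 1) (*-identityʳ n)))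

count≥1 : ∀ {n} (f : Fin n → Bool) i → f i ≡ true → 1 ≤ count f
count≥1 f i h = ≤-trans (≤-reflexive (sym (cong ι h))) (term≤sumF (ι ∘ f) i)

∧-fst : ∀ {b c} → b ∧ c ≡ true → b ≡ true
∧-fst {true} h = refl

∧-snd : ∀ {b c} → b ∧ c ≡ true → c ≡ true
∧-snd {true} h = h

∧-pair : ∀ {b c} → b ≡ true → c ≡ true → b ∧ c ≡ true
∧-pair refl refl = refl

not-true : ∀ {b} → not b ≡ true → b ≡ false
not-true {false} h = refl

not-false : ∀ {b} → b ≡ false → not b ≡ true
not-false refl = refl

true≢false : ∀ {b} → b ≡ true → b ≡ false → ⊥
true≢false refl ()

≢true : ∀ {b} → (b ≡ true → ⊥) → b ≡ false
≢true {false} h = refl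
≢true {true}  h = ⊥-elim (h refl)

∨-case : ∀ {b c} → b ∨ c ≡ true → (b ≡ true) ⊎ (c ≡ true)
∨-case {true}  h = inj₁ refl
∨-case {false} h = inj₂ h

bool-case : ∀ b → (b ≡ true) ⊎ (b ≡ false)
bool-case true  = inj₁ refl
bool-case false = inj₂ refl

≤ᵇ-true : ∀ m n → (m ≤ᵇ n) ≡ true → m ≤ n
≤ᵇ-true m n h = ≤ᵇ⇒≤ m n (subst T (sym h) tt)

-- Weighted counting of non-neighbours

module Weights {n : ℕ} (E : Fin n → Fin n → Bool) (U : Fin n → Bool) where

  sumU : (Fin n → ℕ) → ℕ
  sumU f = sumF (λ z → ι (U z) * f z)

  countU : (Fin n → Bool) → ℕ
  countU f = count (λ z → U z ∧ f z)

  miss : Fin n → ℕ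
  miss v = countU (λ z → not (E v z))

  ι-∧ : ∀ b c → ι (b ∧ c) ≡ ι b * ι c
  ι-∧ false c = refl
  ι-∧ true  c = sym (+-identityʳ _)

  countU≡sumU : ∀ f → countU f ≡ sumU (ι ∘ f)
  countU≡sumU f = sumF-cong (λ z → ι-∧ (U z) (f z))

  missL : List (ℕ × Fin n) → Fin n → ℕ
  missL [] z = 0
  missL ((w , v) ∷ vs) z = w * ι (not (E v z)) + missL vs z

  weight : List (ℕ × Fin n) → ℕ
  weight [] = 0
  weight ((w , v) ∷ vs) = w + weight vs

  Bounded : ℕ → Set
  Bounded m = ∀ v → U v ≡ true → miss v ≤ m

  sumU-+ : ∀ f g → sumU (λ z → f z + g z) ≡ sumU f + sumU g
  sumU-+ f g = trans (sumF-cong (λ z → *-distribˡ-+ (ι (U z)) (f z) (g z)))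
                     (sumF-+ (λ z → ι (U z) * f z) (λ z → ι (U z) * g z))

  sumU-* : ∀ c f → sumU (λ z → c * f z) ≡ c * sumU f
  sumU-* c f = trans (sumF-cong (λ z → lemma (ι (U z)) c (f z)))
                     (sumF-*ˡ c (λ z → ι (U z) * f z))
    where lemma : ∀ a b d → a * (b * d) ≡ b * (a * d)
          lemma = solve-∀

  sumU-mono : ∀ {f g} → (∀ z → U z ≡ true → f z ≤ g z) → sumU f ≤ sumU g
  sumU-mono {f} {g} h = sumF-mono pt
    where pt : ∀ z → ι (U z) * f z ≤ ι (U z) * g z
          pt z with U z in eq
          ... | false = z≤n
          ... | true  = +-monoˡ-≤ 0 (h z eq)

  sumU-missL : ∀ {m} → Bounded m → ∀ vs → All (λ p → U (proj₂ p) ≡ true) vs →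
               sumU (missL vs) ≤ weight vs * m
  sumU-missL bd [] [] = ≤-reflexive (sumF-zero _ (λ z → *-zeroʳ (ι (U z))))
  sumU-missL {m} bd ((w , v) ∷ vs) (u ∷ us) = begin
    sumU (missL ((w , v) ∷ vs))
      ≡⟨ sumU-+ (λ z → w * ι (not (E v z))) (missL vs) ⟩
    sumU (λ z → w * ι (not (E v z))) + sumU (missL vs)
      ≡⟨ cong (_+ _) (trans (sumU-* w (λ z → ι (not (E v z)))) (cong (w *_) (sym (countU≡sumU _)))) ⟩
    w * miss v + sumU (missL vs)
      ≤⟨ +-mono-≤ (*-monoʳ-≤ w (bd v u)) (sumU-missL bd vs us) ⟩
    w * m + weight vs * m ≡⟨ sym (*-distribʳ-+ m w (weight vs)) ⟩
    (w + weight vs) * m ∎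
    where open ≤-Reasoning

  -- Double counting of the pairs of a weighted vertex and a non-neighbour of it. The function `r`
  -- holds what the listed vertices do not pay for, typically a charge on the vertices of I.
  weigh : ∀ {m} → Bounded m → ∀ vs → All (λ p → U (proj₂ p) ≡ true) vs →
          ∀ (l r : Fin n → ℕ) → (∀ z → U z ≡ true → l z ≤ missL vs z + r z) →
          sumU l ≤ weight vs * m + sumU r
  weigh {m} bd vs us l r h = begin
    sumU l ≤⟨ sumU-mono h ⟩
    sumU (λ z → missL vs z + r z) ≡⟨ sumU-+ (missL vs) r ⟩
    sumU (missL vs) + sumU r ≤⟨ +-monoˡ-≤ _ (sumU-missL bd vs us) ⟩
    weight vs * m + sumU r ∎
    where open ≤-Reasoning

-- Configurations are finite graphs whose vertices may be required to lie inside or outside I.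

data Flag : Set where
  inI outI free : Flag

record Config : Set where
  constructor config
  field
    flags : List Flag
    edges : List (ℕ × ℕ)
open Config

_⊑_ : Flag → Maybe Flag → Bool
free ⊑ just _    = true
inI  ⊑ just inI  = true
outI ⊑ just outI = true
_    ⊑ _         = false

_‼_ : ∀ {A : Set} → List A → ℕ → Maybe A
[]       ‼ _     = nothing
(x ∷ xs) ‼ zero  = just x
(x ∷ xs) ‼ suc i = xs ‼ i

-- The default value 0 past the end is harmless: `checkHom` tests every edge at the values actually
-- returned.
at : List ℕ → ℕ → ℕ
at []       _       = 0
at (x ∷ xs) zero    = x
at (x ∷ xs) (suc i) = at xs i

joins : ℕ → ℕ → ℕ × ℕ → Bool
joins p q (i , j) = ((i ≡ᵇ p) ∧ (j ≡ᵇ q)) ∨ ((i ≡ᵇ q) ∧ (j ≡ᵇ p))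

checkFlags : List Flag → List ℕ → List Flag → Bool
checkFlags []       ps       gs = true
checkFlags (f ∷ fs) []       gs = false
checkFlags (f ∷ fs) (p ∷ ps) gs = (f ⊑ (gs ‼ p)) ∧ checkFlags fs ps gs

-- Injectivity is not demanded. Absence of a configuration therefore means absence of all its
-- homomorphic images, and an embedding may repeat an index.
checkHom : Config → List ℕ → Config → Bool
checkHom A φ B = checkFlags (flags A) φ (flags B)
               ∧ all (λ e → any (joins (at φ (proj₁ e)) (at φ (proj₂ e))) (edges B)) (edges A)

patternEdges : ℕ → List Bool → List (ℕ × ℕ)
patternEdges i []          = []
patternEdges i (true ∷ p)  = (0 , suc i) ∷ patternEdges (suc i) p
patternEdges i (false ∷ p) = patternEdges (suc i) p

-- The new vertex gets index 0.
extend : Config → Flag → List Bool → Config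
extend A f p = config (f ∷ flags A)
                      (map (λ e → suc (proj₁ e) , suc (proj₂ e)) (edges A) ++ patternEdges 0 p)

-- A vertex adjacent to the marked vertices would create the forbidden configuration with the
-- given index, via the given map.
record Clause : Set where
  constructor clause
  field
    pattern-of : List Bool
    forbidden  : ℕ
    embedding  : List ℕ
open Clause

-- A weighting in the sense of linear programming duality. The set I acts as one more
-- non-neighbourhood of size at most m: it has the weight `weightI`, which exactly the vertices of I
-- collect.
record Certificate : Set where
  constructor certificate
  field
    weights    : List ℕ
    weightI    : ℕ
    target     : ℕ
    clausesOut : List Clause
    clausesIn  : List Clause
open Certificate

nulls : List (List Bool) → Bool
nulls []             = false
nulls ([] ∷ cs)      = true
nulls ((_ ∷ _) ∷ cs) = nulls cs

-- What remains of the patterns once the first vertex is known to be adjacent; `dropMiss` is the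
-- other case. An exhausted pattern stays, being contained already.
dropHit : List (List Bool) → List (List Bool)
dropHit []             = []
dropHit ([] ∷ cs)      = [] ∷ dropHit cs
dropHit ((_ ∷ c) ∷ cs) = c ∷ dropHit cs

dropMiss : List (List Bool) → List (List Bool)
dropMiss []                 = []
dropMiss ([] ∷ cs)          = [] ∷ dropMiss cs
dropMiss ((true ∷ c) ∷ cs)  = dropMiss cs
dropMiss ((false ∷ c) ∷ cs) = c ∷ dropMiss cs

-- Every adjacency pattern misses weight at least t or contains one of the given patterns.
cover : ℕ → ℕ → List ℕ → List (List Bool) → Bool
cover t acc []       cs = (t ≤ᵇ acc) ∨ nulls cs
cover t acc (w ∷ ws) cs = ((t ≤ᵇ acc) ∨ nulls cs)
  ∨ (cover t acc ws (dropHit cs) ∧ cover t (w + acc) ws (dropMiss cs))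

checkClause : List Config → Config → Flag → Clause → Bool
checkClause Φ A f c with Φ ‼ forbidden c
... | nothing = false
... | just B  = checkHom B (embedding c) (extend A f (pattern-of c))

check : ℕ → ℕ → List Config → Config → Certificate → Bool
check k c Φ A χ =
    (length (weights χ) ≡ᵇ length (flags A))
  ∧ (1 ≤ᵇ target χ)
  -- Against c·m < k|M| this rules out target·|M| ≤ (total weight)·m.
  ∧ (k * (sum (weights χ) + weightI χ) ≤ᵇ c * target χ)
  ∧ all (checkClause Φ A outI) (clausesOut χ)
  ∧ all (checkClause Φ A inI) (clausesIn χ)
  ∧ cover (target χ) 0 (weights χ) (map pattern-of (clausesOut χ))
  -- A vertex of I starts with `weightI` before any adjacency is looked at.
  ∧ cover (target χ) (weightI χ) (weights χ) (map pattern-of (clausesIn χ))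

Sat : List Bool → (ℕ → Bool) → Set
Sat []          β = ⊤
Sat (true ∷ p)  β = β 0 ≡ true × Sat p (β ∘ suc)
Sat (false ∷ p) β = Sat p (β ∘ suc)

Sat-cong : ∀ p {β γ : ℕ → Bool} → (∀ j → β j ≡ γ j) → Sat p β → Sat p γ
Sat-cong []          e s       = tt
Sat-cong (true ∷ p)  e (h , s) = trans (sym (e 0)) h , Sat-cong p (e ∘ suc) s
Sat-cong (false ∷ p) e s       = Sat-cong p (e ∘ suc) s

missed : List ℕ → (ℕ → Bool) → ℕ
missed []       β = 0
missed (w ∷ ws) β = w * ι (not (β 0)) + missed ws (β ∘ suc)

nulls-sat : ∀ cs β → nulls cs ≡ true → Any (λ c → Sat c β) cs
nulls-sat ([] ∷ cs)      β h = here tt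
nulls-sat ((_ ∷ _) ∷ cs) β h = there (nulls-sat cs β h)

dropHit-sat : ∀ cs β → β 0 ≡ true → Any (λ c → Sat c (β ∘ suc)) (dropHit cs) → Any (λ c → Sat c β) cs
dropHit-sat ([] ∷ cs)          β h a         = here tt
dropHit-sat ((true ∷ c) ∷ cs)  β h (here s)  = here (h , s)
dropHit-sat ((false ∷ c) ∷ cs) β h (here s)  = here s
dropHit-sat ((_ ∷ c) ∷ cs)     β h (there a) = there (dropHit-sat cs β h a)

dropMiss-sat : ∀ cs β → Any (λ c → Sat c (β ∘ suc)) (dropMiss cs) → Any (λ c → Sat c β) cs
dropMiss-sat ([] ∷ cs)          β a         = here tt
dropMiss-sat ((true ∷ c) ∷ cs)  β a         = there (dropMiss-sat cs β a)
dropMiss-sat ((false ∷ c) ∷ cs) β (here s)  = here s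
dropMiss-sat ((false ∷ c) ∷ cs) β (there a) = there (dropMiss-sat cs β a)

cover-sound : ∀ t acc ws cs β → cover t acc ws cs ≡ true →
              (t ≤ acc + missed ws β) ⊎ Any (λ c → Sat c β) cs
cover-stop : ∀ t acc x cs β → (t ≤ᵇ acc) ∨ nulls cs ≡ true →
             (t ≤ acc + x) ⊎ Any (λ c → Sat c β) cs
cover-stop t acc x cs β h with ∨-case {t ≤ᵇ acc} h
... | inj₁ h₁ = inj₁ (≤-trans (≤ᵇ-true t acc h₁) (m≤m+n acc x))
... | inj₂ h₂ = inj₂ (nulls-sat cs β h₂)
cover-sound t acc []       cs β h = cover-stop t acc 0 cs β h
cover-sound t acc (w ∷ ws) cs β h with ∨-case {(t ≤ᵇ acc) ∨ nulls cs} h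
... | inj₁ h₁ = cover-stop t acc _ cs β h₁
... | inj₂ h₂ with β 0 in eq
...   | true with cover-sound t acc ws (dropHit cs) (β ∘ suc) (∧-fst h₂)
...     | inj₁ le = inj₁ (subst (λ x → t ≤ acc + (x + missed ws (β ∘ suc))) (sym (*-zeroʳ w)) le)
...     | inj₂ a  = inj₂ (dropHit-sat cs β eq a)
cover-sound t acc (w ∷ ws) cs β h | inj₂ h₂ | false with cover-sound t (w + acc) ws (dropMiss cs) (β ∘ suc) (∧-snd {cover t acc ws (dropHit cs)} h₂)
...     | inj₁ le = inj₁ (subst (t ≤_) (lemma w acc (missed ws (β ∘ suc))) le)
  where lemma : ∀ w a x → (w + a) + x ≡ a + (w * 1 + x)
        lemma = solve-∀
...     | inj₂ a  = inj₂ (dropMiss-sat cs β a)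

all-true : ∀ {A : Set} (p : A → Bool) xs → all p xs ≡ true → All (λ x → p x ≡ true) xs
all-true p []       h = []
all-true p (x ∷ xs) h = ∧-fst h ∷ all-true p xs (∧-snd {p x} h)

any-true : ∀ {A : Set} (p : A → Bool) xs → any p xs ≡ true → Any (λ x → p x ≡ true) xs
any-true p (x ∷ xs) h with ∨-case {p x} h
... | inj₁ q = here q
... | inj₂ q = there (any-true p xs q)

≡ᵇ-true : ∀ m n → (m ≡ᵇ n) ≡ true → m ≡ n
≡ᵇ-true m n h = ≡ᵇ⇒≡ m n (subst T (sym h) tt)

-- Soundness of certificates.

module Realisation {n : ℕ} (E : Fin n → Fin n → Bool) (E-symm : ∀ u v → E u v ≡ E v u)
                   (M I : Fin n → Bool) where

  -- Total on ℕ, so that moving a realisation along a map of configurations is composition with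
  -- `at`; only the indices of the configuration are constrained.
  Env : Set
  Env = ℕ → Fin n

  Respects : Flag → Fin n → Set
  Respects inI  v = I v ≡ true
  Respects outI v = I v ≡ false
  Respects free v = ⊤

  RealV : List Flag → Env → Set
  RealV []       ρ = ⊤
  RealV (f ∷ fs) ρ = (M (ρ 0) ≡ true × Respects f (ρ 0)) × RealV fs (ρ ∘ suc)

  RealE : List (ℕ × ℕ) → Env → Set
  RealE es ρ = All (λ e → E (ρ (proj₁ e)) (ρ (proj₂ e)) ≡ true) es

  Realises : Config → Env → Set
  Realises A ρ = RealV (flags A) ρ × RealE (edges A) ρ

  Absent : Config → Set
  Absent A = ∀ ρ → Realises A ρ → ⊥

  _◂_ : Fin n → Env → Env
  (z ◂ ρ) zero    = z
  (z ◂ ρ) (suc i) = ρ i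

  RealV-‼ : ∀ gs ρ → RealV gs ρ → ∀ f p → f ⊑ (gs ‼ p) ≡ true → M (ρ p) ≡ true × Respects f (ρ p)
  RealV-‼ (g ∷ gs)   ρ ((m , r) , _) inI  zero h with g
  ... | inI = m , r
  RealV-‼ (g ∷ gs)   ρ ((m , r) , _) outI zero h with g
  ... | outI = m , r
  RealV-‼ (g ∷ gs)   ρ ((m , r) , _) free zero h = m , tt
  RealV-‼ (g ∷ gs) ρ (_ , rv) f (suc p) h = RealV-‼ gs (ρ ∘ suc) rv f p h
  RealV-‼ [] ρ rv inI p ()
  RealV-‼ [] ρ rv outI p ()
  RealV-‼ [] ρ rv free p ()

  RealV-pull : ∀ fs φ gs ρ → checkFlags fs φ gs ≡ true → RealV gs ρ → RealV fs (ρ ∘ at φ)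
  RealV-pull []       φ       gs ρ h rv = tt
  RealV-pull (f ∷ fs) (p ∷ φ) gs ρ h rv =
    RealV-‼ gs ρ rv f p (∧-fst h) , RealV-pull fs φ gs ρ (∧-snd {f ⊑ (gs ‼ p)} h) rv

  RealE-edge : ∀ es ρ p q → any (joins p q) es ≡ true → RealE es ρ → E (ρ p) (ρ q) ≡ true
  RealE-edge ((i , j) ∷ es) ρ p q h (r ∷ rs) with ∨-case {joins p q (i , j)} h
  ... | inj₂ h₂ = RealE-edge es ρ p q h₂ rs
  ... | inj₁ h₁ with ∨-case {(i ≡ᵇ p) ∧ (j ≡ᵇ q)} h₁
  ...   | inj₁ e rewrite ≡ᵇ-true i p (∧-fst e) | ≡ᵇ-true j q (∧-snd {i ≡ᵇ p} e) = r
  ...   | inj₂ e rewrite ≡ᵇ-true i q (∧-fst e) | ≡ᵇ-true j p (∧-snd {i ≡ᵇ q} e) = trans (E-symm (ρ p) (ρ q)) r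

  hom-sound : ∀ A φ B ρ → checkHom A φ B ≡ true → Realises B ρ → Realises A (ρ ∘ at φ)
  hom-sound A φ B ρ h (rv , re) =
    RealV-pull (flags A) φ (flags B) ρ (∧-fst h) rv ,
    All.map (λ {e} q → RealE-edge (edges B) ρ (at φ (proj₁ e)) (at φ (proj₂ e)) q re)
            (all-true _ (edges A) (∧-snd {checkFlags (flags A) φ (flags B)} h))

  patternEdges-real : ∀ i p (ρ : Env) z → Sat p (λ j → E (ρ (i + j)) z) →
                      RealE (patternEdges i p) (z ◂ ρ)
  patternEdges-real i []          ρ z s = []
  patternEdges-real i (true ∷ p)  ρ z (h , s) =
    trans (E-symm z (ρ i)) (subst (λ k → E (ρ k) z ≡ true) (+-identityʳ i) h)
    ∷ patternEdges-real (suc i) p ρ z (Sat-cong p (λ j → cong (λ k → E (ρ k) z) (+-suc i j)) s)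
  patternEdges-real i (false ∷ p) ρ z s =
    patternEdges-real (suc i) p ρ z (Sat-cong p (λ j → cong (λ k → E (ρ k) z) (+-suc i j)) s)

  extend-real : ∀ A f p ρ z → Realises A ρ → M z ≡ true → Respects f z →
                Sat p (λ j → E (ρ j) z) → Realises (extend A f p) (z ◂ ρ)
  extend-real A f p ρ z (rv , re) mz rz s =
    ((mz , rz) , rv) , All.++⁺ (All.map⁺ re) (patternEdges-real 0 p ρ z s)

  ‼-absent : ∀ Φ i {B} → All Absent Φ → Φ ‼ i ≡ just B → Absent B
  ‼-absent (x ∷ Φ) zero    (a ∷ as) refl = a
  ‼-absent (x ∷ Φ) (suc i) (a ∷ as) e    = ‼-absent Φ i as e

  clause-sound : ∀ Φ A f c → All Absent Φ → checkClause Φ A f c ≡ true → ∀ ρ z → Realises A ρ →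
                 M z ≡ true → Respects f z → Sat (pattern-of c) (λ j → E (ρ j) z) → ⊥
  clause-sound Φ A f c abs h ρ z r mz rz s with Φ ‼ forbidden c in eq
  ... | just B = ‼-absent Φ (forbidden c) abs eq _
        (hom-sound B (embedding c) _ _ h (extend-real A f (pattern-of c) ρ z r mz rz s))

  clauses-sound : ∀ Φ A f cs → All Absent Φ → all (checkClause Φ A f) cs ≡ true → ∀ ρ z → Realises A ρ →
                  M z ≡ true → Respects f z → Any (λ p → Sat p (λ j → E (ρ j) z)) (map pattern-of cs) → ⊥
  clauses-sound Φ A f (c ∷ cs) abs h ρ z r mz rz (here s)  = clause-sound Φ A f c abs (∧-fst h) ρ z r mz rz s
  clauses-sound Φ A f (c ∷ cs) abs h ρ z r mz rz (there a) =
    clauses-sound Φ A f cs abs (∧-snd {checkClause Φ A f c} h) ρ z r mz rz a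

  module Counting (U : Fin n → Bool) (m : ℕ) (bd : Weights.Bounded E U m)
                  (M⊆U : ∀ v → M v ≡ true → U v ≡ true)
                  (I≤m : Weights.countU E U I ≤ m)
                  (k c : ℕ) (dense : c * m < k * count M) where

    open Weights E U

    assign : List ℕ → Env → List (ℕ × Fin n)
    assign []       ρ = []
    assign (w ∷ ws) ρ = (w , ρ 0) ∷ assign ws (ρ ∘ suc)

    weight-assign : ∀ ws ρ → weight (assign ws ρ) ≡ sum ws
    weight-assign []       ρ = refl
    weight-assign (w ∷ ws) ρ = cong (w +_) (weight-assign ws (ρ ∘ suc))

    missL-assign : ∀ ws ρ z → missL (assign ws ρ) z ≡ missed ws (λ j → E (ρ j) z)
    missL-assign []       ρ z = refl
    missL-assign (w ∷ ws) ρ z = cong (w * ι (not (E (ρ 0) z)) +_) (missL-assign ws (ρ ∘ suc) z)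

    assign-U : ∀ ws fs ρ → length ws ≡ length fs → RealV fs ρ → All (λ p → U (proj₂ p) ≡ true) (assign ws ρ)
    assign-U []       fs       ρ h rv = []
    assign-U (w ∷ ws) (f ∷ fs) ρ h ((mz , _) , rv) = M⊆U _ mz ∷ assign-U ws fs (ρ ∘ suc) (suc-injective h) rv

    countM≤ : count M ≤ sumU (ι ∘ M)
    countM≤ = sumF-mono pt
      where pt : ∀ z → ι (M z) ≤ ι (U z) * ι (M z)
            pt z with M z in eq
            ... | false = z≤n
            ... | true rewrite M⊆U z eq = ≤-refl

    -- In a realisation of A every vertex of M misses weight t, vertices of I being credited with γ,
    -- since otherwise a clause would produce a configuration of Φ. Summing gives t|M| ≤ (Σw + γ)m,
    -- against the density. The bound m concerns non-neighbours in all of U, so vertices of U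
    -- outside M may miss anything.
    refute : ∀ Φ A χ → check k c Φ A χ ≡ true → All Absent Φ → Absent A
    refute Φ A (certificate ws γ t csO csI) h abs ρ r@(rv , re) = <-irrefl refl (begin-strict
        t * (c * m)             <⟨ *-monoʳ-< t ⦃ ℕ.>-nonZero t≥1 ⦄ dense ⟩
        t * (k * count M)       ≡⟨ lemma₁ t k (count M) ⟩
        k * (t * count M)       ≤⟨ *-monoʳ-≤ k total ⟩
        k * ((sum ws + γ) * m)  ≡⟨ sym (*-assoc k (sum ws + γ) m) ⟩
        k * (sum ws + γ) * m    ≤⟨ *-monoˡ-≤ m num ⟩
        c * t * m               ≡⟨ lemma₂ c t m ⟩
        t * (c * m)             ∎)
      where
      open ≤-Reasoning
      lemma₁ : ∀ a b d → a * (b * d) ≡ b * (a * d)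
      lemma₁ = solve-∀
      lemma₂ : ∀ a b d → a * b * d ≡ b * (a * d)
      lemma₂ = solve-∀
      h₁ = ∧-snd {length ws ≡ᵇ length (flags A)} h
      h₂ = ∧-snd {1 ≤ᵇ t} h₁
      h₃ = ∧-snd {k * (sum ws + γ) ≤ᵇ c * t} h₂
      h₄ = ∧-snd {all (checkClause Φ A outI) csO} h₃
      h₅ = ∧-snd {all (checkClause Φ A inI) csI} h₄
      h₆ = ∧-snd {cover t 0 ws (map pattern-of csO)} h₅
      len : length ws ≡ length (flags A)
      len = ≡ᵇ-true _ _ (∧-fst h)
      t≥1 : 1 ≤ t
      t≥1 = ≤ᵇ-true 1 t (∧-fst h₁)
      num : k * (sum ws + γ) ≤ c * t
      num = ≤ᵇ-true _ _ (∧-fst h₂)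
      vs = assign ws ρ
      pointwise : ∀ z → U z ≡ true → t * ι (M z) ≤ missL vs z + γ * ι (I z)
      pointwise z uz with M z in mz
      ... | false = ≤-trans (≤-reflexive (*-zeroʳ t)) z≤n
      ... | true with I z in iz
      ...   | false with cover-sound t 0 ws _ (λ j → E (ρ j) z) (∧-fst h₅)
      ...     | inj₁ le rewrite missL-assign ws ρ z | *-identityʳ t = ≤-trans le (m≤m+n _ _)
      ...     | inj₂ a  = ⊥-elim (clauses-sound Φ A outI csO abs (∧-fst h₃) ρ z r mz iz a)
      pointwise z uz | true | true with cover-sound t γ ws _ (λ j → E (ρ j) z) h₆
      ...     | inj₁ le rewrite missL-assign ws ρ z | *-identityʳ t | *-identityʳ γ = ≤-trans le (≤-reflexive (+-comm γ _))
      ...     | inj₂ a  = ⊥-elim (clauses-sound Φ A inI csI abs (∧-fst h₄) ρ z r mz iz a)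
      total : t * count M ≤ (sum ws + γ) * m
      total = begin
        t * count M                        ≤⟨ *-monoʳ-≤ t countM≤ ⟩
        t * sumU (ι ∘ M)                   ≡⟨ sym (sumU-* t (ι ∘ M)) ⟩
        sumU (λ z → t * ι (M z))           ≤⟨ weigh bd vs (assign-U ws (flags A) ρ len rv) _ _ pointwise ⟩
        weight vs * m + sumU (λ z → γ * ι (I z))
          ≡⟨ cong₂ _+_ (cong (_* m) (weight-assign ws ρ)) (sumU-* γ (ι ∘ I)) ⟩
        sum ws * m + γ * sumU (ι ∘ I)      ≤⟨ +-monoʳ-≤ (sum ws * m) (*-monoʳ-≤ γ (≤-trans (≤-reflexive (sym (countU≡sumU I))) I≤m)) ⟩
        sum ws * m + γ * m                 ≡⟨ sym (*-distribʳ-+ m (sum ws) γ) ⟩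
        (sum ws + γ) * m                   ∎

-- The configurations and their certificates.

mark : ℕ → List Bool → List Bool
mark zero    []       = true ∷ []
mark zero    (_ ∷ bs) = true ∷ bs
mark (suc i) []       = false ∷ mark i []
mark (suc i) (b ∷ bs) = b ∷ mark i bs

-- As in `extend`, the value 0 in φ is the new vertex and j + 1 is the old vertex j.
on : List ℕ → ℕ → List ℕ → Clause
on is i φ = clause (foldr mark [] is) i φ

-- Realised by every vertex of I, hence absent when I is empty. A clause with empty pattern leading
-- to it disposes of the vertices of I in certificates that do not involve I.
anyI : Config
anyI = config (replicate 1 inI)
  ([])

II : Config
II = config (replicate 2 inI)
  ((0 , 1) ∷ [])

-- The odd wheels, hub last; this one is K₄. They are absent over an (a-1)-clique, because the hub
-- completes it to an a-clique whose common neighbourhood is bipartite.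
W₃ : Config
W₃ = config (replicate 4 free)
  ((0 , 1) ∷ (0 , 2) ∷ (0 , 3) ∷ (1 , 2) ∷ (1 , 3) ∷ (2 , 3) ∷ [])

W₅ : Config
W₅ = config (replicate 6 free)
  ((0 , 1) ∷ (0 , 4) ∷ (0 , 5) ∷ (1 , 2) ∷ (1 , 5) ∷ (2 , 3) ∷ (2 , 5) ∷ (3 , 4) ∷ (3 , 5) ∷ (4 , 5) ∷
   [])

W₇ : Config
W₇ = config (replicate 8 free)
  ((0 , 1) ∷ (0 , 6) ∷ (0 , 7) ∷ (1 , 2) ∷ (1 , 7) ∷ (2 , 3) ∷ (2 , 7) ∷ (3 , 4) ∷ (3 , 7) ∷ (4 , 5) ∷
   (4 , 7) ∷ (5 , 6) ∷ (5 , 7) ∷ (6 , 7) ∷ [])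

CoC₇ : Config
CoC₇ = config (replicate 7 free)
  ((0 , 1) ∷ (0 , 2) ∷ (0 , 5) ∷ (0 , 6) ∷ (1 , 2) ∷ (1 , 3) ∷ (1 , 6) ∷ (2 , 3) ∷ (2 , 4) ∷ (3 , 4) ∷
   (3 , 5) ∷ (4 , 5) ∷ (4 , 6) ∷ (5 , 6) ∷ [])

H₂ : Config
H₂ = config (replicate 7 free)
  ((0 , 1) ∷ (0 , 2) ∷ (0 , 5) ∷ (0 , 6) ∷ (1 , 2) ∷ (1 , 3) ∷ (2 , 3) ∷ (2 , 4) ∷ (3 , 4) ∷ (3 , 5) ∷
   (4 , 5) ∷ (4 , 6) ∷ (5 , 6) ∷ [])

H₂⁺ : Config
H₂⁺ = config (replicate 8 free)
  ((0 , 1) ∷ (0 , 2) ∷ (0 , 5) ∷ (0 , 6) ∷ (0 , 7) ∷ (1 , 2) ∷ (1 , 3) ∷ (2 , 3) ∷ (2 , 4) ∷ (2 , 7) ∷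
   (3 , 4) ∷ (3 , 5) ∷ (4 , 5) ∷ (4 , 6) ∷ (5 , 6) ∷ (5 , 7) ∷ [])

T₀ : Config
T₀ = config (replicate 10 free)
  ((0 , 1) ∷ (0 , 6) ∷ (0 , 7) ∷ (0 , 8) ∷ (0 , 9) ∷ (1 , 2) ∷ (1 , 8) ∷ (2 , 3) ∷ (2 , 7) ∷ (2 , 8) ∷
   (3 , 4) ∷ (3 , 7) ∷ (3 , 8) ∷ (4 , 5) ∷ (4 , 7) ∷ (4 , 8) ∷ (5 , 6) ∷ (5 , 7) ∷ (5 , 8) ∷ (6 , 7) ∷
   (7 , 9) ∷ (8 , 9) ∷ [])

-- The Moser spindle: rhombi 0,1,2,3 and 0,4,5,6 with common tip 0, and an edge between the other
-- tips 3 and 6.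
Spindle : Config
Spindle = config (replicate 7 free)
  ((0 , 1) ∷ (0 , 2) ∷ (0 , 4) ∷ (0 , 5) ∷ (1 , 2) ∷ (1 , 3) ∷ (2 , 3) ∷ (3 , 6) ∷ (4 , 5) ∷ (4 , 6) ∷
   (5 , 6) ∷ [])

CoC₇-Φ : List Config
CoC₇-Φ = anyI ∷ W₃ ∷ W₅ ∷ []

-- Every vertex sees at most four of the seven, so 3|M| ≤ 7m: this is the origin of 4/3 in (1), and
-- in the blow-ups of (1) equality holds.
CoC₇-certificate : Certificate
CoC₇-certificate = certificate (1 ∷ 1 ∷ 1 ∷ 1 ∷ 1 ∷ 1 ∷ 1 ∷ []) 0 3
    ( on (2 ∷ 3 ∷ 4 ∷ []) 1 (0 ∷ 3 ∷ 4 ∷ 5 ∷ [])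
    ∷ on (4 ∷ 5 ∷ 6 ∷ []) 1 (0 ∷ 5 ∷ 6 ∷ 7 ∷ [])
    ∷ on (1 ∷ 3 ∷ 5 ∷ []) 2 (0 ∷ 2 ∷ 3 ∷ 5 ∷ 6 ∷ 4 ∷ [])
    ∷ on (0 ∷ 2 ∷ 5 ∷ []) 2 (0 ∷ 3 ∷ 2 ∷ 7 ∷ 6 ∷ 1 ∷ [])
    ∷ on (1 ∷ 3 ∷ 6 ∷ []) 2 (0 ∷ 4 ∷ 3 ∷ 1 ∷ 7 ∷ 2 ∷ [])
    ∷ on (2 ∷ 4 ∷ 6 ∷ []) 2 (0 ∷ 3 ∷ 4 ∷ 6 ∷ 7 ∷ 5 ∷ [])
    ∷ [] )
    ( on ([]) 0 (0 ∷ [])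
    ∷ [] )

CoC₇-check : check 3 7 CoC₇-Φ CoC₇ CoC₇-certificate ≡ true
CoC₇-check = refl

H₂⁺-Φ : List Config
H₂⁺-Φ = anyI ∷ W₃ ∷ W₅ ∷ []

-- Total weight 9 against target 4 matches the density 9m < 4|M| exactly. The certificates of `H₂`
-- (11 against 5) and `T₀` (13 against 6) are tight in the same way, which gives the thresholds of
-- (2), (3) and (4).
H₂⁺-certificate : Certificate
H₂⁺-certificate = certificate (2 ∷ 1 ∷ 2 ∷ 1 ∷ 1 ∷ 1 ∷ 1 ∷ 0 ∷ []) 0 4
    ( on (1 ∷ 2 ∷ 3 ∷ []) 1 (0 ∷ 2 ∷ 3 ∷ 4 ∷ [])
    ∷ on (4 ∷ 5 ∷ 6 ∷ []) 1 (0 ∷ 5 ∷ 6 ∷ 7 ∷ [])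
    ∷ on (0 ∷ 2 ∷ 4 ∷ []) 2 (0 ∷ 1 ∷ 2 ∷ 4 ∷ 5 ∷ 3 ∷ [])
    ∷ on (0 ∷ 1 ∷ 5 ∷ []) 2 (0 ∷ 2 ∷ 3 ∷ 8 ∷ 6 ∷ 1 ∷ [])
    ∷ on (0 ∷ 2 ∷ 6 ∷ []) 2 (0 ∷ 3 ∷ 8 ∷ 6 ∷ 7 ∷ 1 ∷ [])
    ∷ on (0 ∷ 3 ∷ 5 ∷ []) 2 (0 ∷ 1 ∷ 7 ∷ 5 ∷ 4 ∷ 6 ∷ [])
    ∷ on (0 ∷ 1 ∷ 3 ∷ 4 ∷ 6 ∷ []) 2 (1 ∷ 2 ∷ 4 ∷ 5 ∷ 7 ∷ 0 ∷ [])
    ∷ [] )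
    ( on ([]) 0 (0 ∷ [])
    ∷ [] )

H₂⁺-check : check 4 9 H₂⁺-Φ H₂⁺ H₂⁺-certificate ≡ true
H₂⁺-check = refl

H₂-Φ : List Config
H₂-Φ = anyI ∷ W₃ ∷ W₅ ∷ CoC₇ ∷ H₂⁺ ∷ []

H₂-certificate : Certificate
H₂-certificate = certificate (3 ∷ 1 ∷ 2 ∷ 1 ∷ 1 ∷ 2 ∷ 1 ∷ []) 0 5
    ( on (1 ∷ 2 ∷ 3 ∷ []) 1 (0 ∷ 2 ∷ 3 ∷ 4 ∷ [])
    ∷ on (0 ∷ 5 ∷ 6 ∷ []) 1 (0 ∷ 1 ∷ 6 ∷ 7 ∷ [])
    ∷ on (3 ∷ 4 ∷ 5 ∷ []) 1 (0 ∷ 4 ∷ 5 ∷ 6 ∷ [])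
    ∷ on (0 ∷ 1 ∷ 2 ∷ []) 1 (0 ∷ 1 ∷ 2 ∷ 3 ∷ [])
    ∷ on (4 ∷ 5 ∷ 6 ∷ []) 1 (0 ∷ 5 ∷ 6 ∷ 7 ∷ [])
    ∷ on (0 ∷ 2 ∷ 4 ∷ []) 2 (0 ∷ 1 ∷ 2 ∷ 4 ∷ 5 ∷ 3 ∷ [])
    ∷ on (1 ∷ 3 ∷ 5 ∷ []) 2 (0 ∷ 2 ∷ 3 ∷ 5 ∷ 6 ∷ 4 ∷ [])
    ∷ on (0 ∷ 1 ∷ 3 ∷ 4 ∷ 6 ∷ []) 2 (1 ∷ 2 ∷ 4 ∷ 5 ∷ 7 ∷ 0 ∷ [])
    ∷ on (0 ∷ 1 ∷ 4 ∷ 5 ∷ []) 3 (0 ∷ 1 ∷ 2 ∷ 3 ∷ 4 ∷ 5 ∷ 6 ∷ [])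
    ∷ on (0 ∷ 2 ∷ 3 ∷ 6 ∷ []) 3 (0 ∷ 1 ∷ 7 ∷ 6 ∷ 5 ∷ 4 ∷ 3 ∷ [])
    ∷ on (0 ∷ 2 ∷ 5 ∷ []) 4 (1 ∷ 2 ∷ 3 ∷ 4 ∷ 5 ∷ 6 ∷ 7 ∷ 0 ∷ [])
    ∷ [] )
    ( on ([]) 0 (0 ∷ [])
    ∷ [] )

H₂-check : check 5 11 H₂-Φ H₂ H₂-certificate ≡ true
H₂-check = refl

T₀-Φ : List Config
T₀-Φ = anyI ∷ W₃ ∷ W₅ ∷ W₇ ∷ H₂ ∷ []

T₀-certificate : Certificate
T₀-certificate = certificate (2 ∷ 1 ∷ 1 ∷ 1 ∷ 1 ∷ 1 ∷ 1 ∷ 4 ∷ 1 ∷ 0 ∷ []) 0 6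
    ( on (4 ∷ 5 ∷ 7 ∷ []) 1 (0 ∷ 5 ∷ 6 ∷ 8 ∷ [])
    ∷ on (0 ∷ 6 ∷ 7 ∷ []) 1 (0 ∷ 1 ∷ 7 ∷ 8 ∷ [])
    ∷ on (3 ∷ 4 ∷ 8 ∷ []) 1 (0 ∷ 4 ∷ 5 ∷ 9 ∷ [])
    ∷ on (1 ∷ 2 ∷ 7 ∷ []) 2 (0 ∷ 2 ∷ 9 ∷ 4 ∷ 8 ∷ 3 ∷ [])
    ∷ on (3 ∷ 6 ∷ 7 ∷ []) 2 (0 ∷ 4 ∷ 5 ∷ 6 ∷ 7 ∷ 8 ∷ [])
    ∷ on (0 ∷ 4 ∷ 7 ∷ []) 2 (0 ∷ 1 ∷ 7 ∷ 6 ∷ 5 ∷ 8 ∷ [])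
    ∷ on (2 ∷ 5 ∷ 7 ∷ []) 2 (0 ∷ 3 ∷ 4 ∷ 5 ∷ 6 ∷ 8 ∷ [])
    ∷ on (0 ∷ 1 ∷ 7 ∷ []) 2 (0 ∷ 2 ∷ 9 ∷ 10 ∷ 8 ∷ 1 ∷ [])
    ∷ on (1 ∷ 4 ∷ 8 ∷ []) 2 (0 ∷ 2 ∷ 3 ∷ 4 ∷ 5 ∷ 9 ∷ [])
    ∷ on (0 ∷ 5 ∷ 8 ∷ []) 3 (0 ∷ 1 ∷ 2 ∷ 3 ∷ 4 ∷ 5 ∷ 6 ∷ 9 ∷ [])
    ∷ on (0 ∷ 2 ∷ 7 ∷ []) 3 (0 ∷ 1 ∷ 7 ∷ 6 ∷ 5 ∷ 4 ∷ 3 ∷ 8 ∷ [])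
    ∷ on (0 ∷ 1 ∷ 2 ∷ 3 ∷ 4 ∷ 5 ∷ 6 ∷ []) 3 (1 ∷ 2 ∷ 3 ∷ 4 ∷ 5 ∷ 6 ∷ 7 ∷ 0 ∷ [])
    ∷ on (0 ∷ 3 ∷ 7 ∷ []) 4 (1 ∷ 0 ∷ 8 ∷ 4 ∷ 3 ∷ 9 ∷ 2 ∷ [])
    ∷ on (1 ∷ 5 ∷ 7 ∷ 8 ∷ []) 4 (1 ∷ 2 ∷ 9 ∷ 0 ∷ 6 ∷ 8 ∷ 7 ∷ [])
    ∷ on (2 ∷ 6 ∷ 7 ∷ 8 ∷ []) 4 (1 ∷ 7 ∷ 8 ∷ 0 ∷ 3 ∷ 9 ∷ 2 ∷ [])
    ∷ [] )
    ( on ([]) 0 (0 ∷ [])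
    ∷ [] )

T₀-check : check 6 13 T₀-Φ T₀ T₀-certificate ≡ true
T₀-check = refl

-- The spindle with a vertex 7 adjacent to 1, 3, 4, 5; in `Spindle₂` that vertex is adjacent to 0,
-- 1, 3, 4. These are what the certificate of the spindle itself runs into.
Spindle₁ : Config
Spindle₁ = config (replicate 8 free)
  ((0 , 1) ∷ (0 , 2) ∷ (0 , 4) ∷ (0 , 5) ∷ (1 , 2) ∷ (1 , 3) ∷ (1 , 7) ∷ (2 , 3) ∷ (3 , 6) ∷ (3 , 7) ∷
   (4 , 5) ∷ (4 , 6) ∷ (4 , 7) ∷ (5 , 6) ∷ (5 , 7) ∷ [])

Spindle₁-Φ : List Config
Spindle₁-Φ = anyI ∷ W₃ ∷ W₅ ∷ H₂ ∷ []

Spindle₁-certificate : Certificate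
Spindle₁-certificate = certificate (3 ∷ 3 ∷ 1 ∷ 1 ∷ 2 ∷ 2 ∷ 0 ∷ 3 ∷ []) 0 7
    ( on (0 ∷ 4 ∷ 5 ∷ []) 1 (0 ∷ 1 ∷ 5 ∷ 6 ∷ [])
    ∷ on (0 ∷ 1 ∷ 2 ∷ []) 1 (0 ∷ 1 ∷ 2 ∷ 3 ∷ [])
    ∷ on (1 ∷ 3 ∷ 7 ∷ []) 1 (0 ∷ 2 ∷ 4 ∷ 8 ∷ [])
    ∷ on (4 ∷ 5 ∷ 7 ∷ []) 1 (0 ∷ 5 ∷ 6 ∷ 8 ∷ [])
    ∷ on (1 ∷ 2 ∷ 3 ∷ []) 1 (0 ∷ 2 ∷ 3 ∷ 4 ∷ [])
    ∷ on (0 ∷ 1 ∷ 7 ∷ []) 2 (0 ∷ 1 ∷ 3 ∷ 4 ∷ 8 ∷ 2 ∷ [])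
    ∷ on (0 ∷ 1 ∷ 3 ∷ 4 ∷ []) 3 (8 ∷ 4 ∷ 2 ∷ 0 ∷ 1 ∷ 5 ∷ 6 ∷ [])
    ∷ on (0 ∷ 1 ∷ 3 ∷ 5 ∷ []) 3 (8 ∷ 4 ∷ 2 ∷ 0 ∷ 1 ∷ 6 ∷ 5 ∷ [])
    ∷ on (0 ∷ 2 ∷ 4 ∷ 7 ∷ []) 3 (8 ∷ 5 ∷ 0 ∷ 1 ∷ 3 ∷ 2 ∷ 4 ∷ [])
    ∷ on (1 ∷ 2 ∷ 4 ∷ 7 ∷ []) 3 (1 ∷ 3 ∷ 2 ∷ 0 ∷ 8 ∷ 5 ∷ 6 ∷ [])
    ∷ on (0 ∷ 3 ∷ 4 ∷ 7 ∷ []) 3 (1 ∷ 5 ∷ 0 ∷ 8 ∷ 4 ∷ 2 ∷ 3 ∷ [])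
    ∷ on (0 ∷ 2 ∷ 5 ∷ 7 ∷ []) 3 (8 ∷ 6 ∷ 0 ∷ 1 ∷ 3 ∷ 2 ∷ 4 ∷ [])
    ∷ on (1 ∷ 2 ∷ 5 ∷ 7 ∷ []) 3 (1 ∷ 3 ∷ 2 ∷ 0 ∷ 8 ∷ 6 ∷ 5 ∷ [])
    ∷ on (0 ∷ 3 ∷ 5 ∷ 7 ∷ []) 3 (1 ∷ 6 ∷ 0 ∷ 8 ∷ 4 ∷ 2 ∷ 3 ∷ [])
    ∷ [] )
    ( on ([]) 0 (0 ∷ [])
    ∷ [] )

Spindle₁-check : check 7 15 Spindle₁-Φ Spindle₁ Spindle₁-certificate ≡ true
Spindle₁-check = refl

Spindle₂ : Config
Spindle₂ = config (replicate 8 free)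
  ((0 , 1) ∷ (0 , 2) ∷ (0 , 4) ∷ (0 , 5) ∷ (0 , 7) ∷ (1 , 2) ∷ (1 , 3) ∷ (1 , 7) ∷ (2 , 3) ∷ (3 , 6) ∷
   (3 , 7) ∷ (4 , 5) ∷ (4 , 6) ∷ (4 , 7) ∷ (5 , 6) ∷ [])

Spindle₂-Φ : List Config
Spindle₂-Φ = anyI ∷ W₅ ∷ Spindle₁ ∷ []

Spindle₂-certificate : Certificate
Spindle₂-certificate = certificate (0 ∷ 0 ∷ 0 ∷ 1 ∷ 1 ∷ 0 ∷ 1 ∷ 1 ∷ []) 0 2
    ( on (3 ∷ 4 ∷ 7 ∷ []) 1 (0 ∷ 4 ∷ 2 ∷ 1 ∷ 5 ∷ 8 ∷ [])
    ∷ on (4 ∷ 6 ∷ 7 ∷ []) 1 (0 ∷ 7 ∷ 6 ∷ 1 ∷ 8 ∷ 5 ∷ [])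
    ∷ on (3 ∷ 4 ∷ 6 ∷ []) 2 (4 ∷ 8 ∷ 2 ∷ 1 ∷ 0 ∷ 7 ∷ 5 ∷ 5 ∷ [])
    ∷ on (3 ∷ 6 ∷ 7 ∷ []) 2 (7 ∷ 5 ∷ 6 ∷ 1 ∷ 0 ∷ 4 ∷ 8 ∷ 8 ∷ [])
    ∷ [] )
    ( on ([]) 0 (0 ∷ [])
    ∷ [] )

Spindle₂-check : check 7 15 Spindle₂-Φ Spindle₂ Spindle₂-certificate ≡ true
Spindle₂-check = refl

Spindle-Φ : List Config
Spindle-Φ = anyI ∷ W₃ ∷ Spindle₁ ∷ Spindle₂ ∷ []

-- Vertex 5 has weight 0, so a vertex seeing four of the other six has to be excluded. Ten
-- four-element sets contain neither of the triangles 0,1,2 and 1,2,3; each yields a homomorphic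
-- image of one of the two extended spindles.
Spindle-certificate : Certificate
Spindle-certificate = certificate (1 ∷ 1 ∷ 1 ∷ 1 ∷ 1 ∷ 0 ∷ 1 ∷ []) 0 3
    ( on (1 ∷ 2 ∷ 3 ∷ []) 1 (0 ∷ 2 ∷ 3 ∷ 4 ∷ [])
    ∷ on (0 ∷ 1 ∷ 2 ∷ []) 1 (0 ∷ 1 ∷ 2 ∷ 3 ∷ [])
    ∷ on (0 ∷ 1 ∷ 3 ∷ 6 ∷ []) 2 (1 ∷ 0 ∷ 2 ∷ 4 ∷ 5 ∷ 6 ∷ 7 ∷ 7 ∷ [])
    ∷ on (0 ∷ 2 ∷ 3 ∷ 6 ∷ []) 2 (1 ∷ 0 ∷ 3 ∷ 4 ∷ 5 ∷ 6 ∷ 7 ∷ 7 ∷ [])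
    ∷ on (1 ∷ 2 ∷ 4 ∷ 6 ∷ []) 2 (0 ∷ 5 ∷ 7 ∷ 6 ∷ 2 ∷ 3 ∷ 1 ∷ 1 ∷ [])
    ∷ on (0 ∷ 3 ∷ 4 ∷ 6 ∷ []) 2 (1 ∷ 0 ∷ 5 ∷ 7 ∷ 2 ∷ 3 ∷ 4 ∷ 4 ∷ [])
    ∷ on (0 ∷ 1 ∷ 3 ∷ 4 ∷ []) 3 (1 ∷ 2 ∷ 0 ∷ 4 ∷ 5 ∷ 6 ∷ 7 ∷ 0 ∷ [])
    ∷ on (0 ∷ 2 ∷ 3 ∷ 4 ∷ []) 3 (1 ∷ 3 ∷ 0 ∷ 4 ∷ 5 ∷ 6 ∷ 7 ∷ 0 ∷ [])
    ∷ on (0 ∷ 1 ∷ 4 ∷ 6 ∷ []) 3 (1 ∷ 5 ∷ 0 ∷ 7 ∷ 2 ∷ 3 ∷ 4 ∷ 0 ∷ [])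
    ∷ on (0 ∷ 2 ∷ 4 ∷ 6 ∷ []) 3 (1 ∷ 5 ∷ 0 ∷ 7 ∷ 3 ∷ 2 ∷ 4 ∷ 0 ∷ [])
    ∷ on (1 ∷ 3 ∷ 4 ∷ 6 ∷ []) 3 (4 ∷ 7 ∷ 0 ∷ 5 ∷ 2 ∷ 3 ∷ 1 ∷ 0 ∷ [])
    ∷ on (2 ∷ 3 ∷ 4 ∷ 6 ∷ []) 3 (4 ∷ 7 ∷ 0 ∷ 5 ∷ 3 ∷ 2 ∷ 1 ∷ 0 ∷ [])
    ∷ [] )
    ( on ([]) 0 (0 ∷ [])
    ∷ [] )

Spindle-check : check 7 15 Spindle-Φ Spindle Spindle-certificate ≡ true
Spindle-check = refl

OC₃ : Config
OC₃ = config (replicate 3 outI)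
  ((0 , 1) ∷ (0 , 2) ∷ (1 , 2) ∷ [])

OC₅ : Config
OC₅ = config (replicate 5 outI)
  ((0 , 1) ∷ (0 , 4) ∷ (1 , 2) ∷ (2 , 3) ∷ (3 , 4) ∷ [])

OC₇ : Config
OC₇ = config (replicate 7 outI)
  ((0 , 1) ∷ (0 , 6) ∷ (1 , 2) ∷ (2 , 3) ∷ (3 , 4) ∷ (4 , 5) ∷ (5 , 6) ∷ [])

-- The digits after the hyphen say which cycle vertex is missed by each successive vertex of I.
OC₅-0 : Config
OC₅-0 = config (replicate 5 outI ++ (inI ∷ []))
  ((0 , 1) ∷ (0 , 4) ∷ (1 , 2) ∷ (1 , 5) ∷ (2 , 3) ∷ (2 , 5) ∷ (3 , 4) ∷ (3 , 5) ∷ (4 , 5) ∷ [])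

OC₅-0-Φ : List Config
OC₅-0-Φ = II ∷ W₅ ∷ OC₃ ∷ Spindle ∷ []

OC₅-0-certificate : Certificate
OC₅-0-certificate = certificate (1 ∷ 1 ∷ 0 ∷ 0 ∷ 1 ∷ 1 ∷ []) 0 2
    ( on (1 ∷ 4 ∷ 5 ∷ []) 1 (0 ∷ 2 ∷ 3 ∷ 4 ∷ 5 ∷ 6 ∷ [])
    ∷ on (0 ∷ 4 ∷ []) 2 (0 ∷ 1 ∷ 5 ∷ [])
    ∷ on (0 ∷ 1 ∷ []) 2 (0 ∷ 1 ∷ 2 ∷ [])
    ∷ [] )
    ( on (5 ∷ []) 0 (0 ∷ 6 ∷ [])
    ∷ on (0 ∷ 1 ∷ 4 ∷ []) 3 (2 ∷ 0 ∷ 1 ∷ 5 ∷ 3 ∷ 6 ∷ 4 ∷ [])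
    ∷ [] )

OC₅-0-check : check 7 15 OC₅-0-Φ OC₅-0 OC₅-0-certificate ≡ true
OC₅-0-check = refl

OC₅-Φ : List Config
OC₅-Φ = OC₃ ∷ OC₅-0 ∷ []

OC₅-certificate : Certificate
OC₅-certificate = certificate (1 ∷ 1 ∷ 1 ∷ 1 ∷ 1 ∷ []) 1 3
    ( on (1 ∷ 2 ∷ []) 0 (0 ∷ 2 ∷ 3 ∷ [])
    ∷ on (0 ∷ 4 ∷ []) 0 (0 ∷ 1 ∷ 5 ∷ [])
    ∷ on (2 ∷ 3 ∷ []) 0 (0 ∷ 3 ∷ 4 ∷ [])
    ∷ on (0 ∷ 1 ∷ []) 0 (0 ∷ 1 ∷ 2 ∷ [])
    ∷ on (3 ∷ 4 ∷ []) 0 (0 ∷ 4 ∷ 5 ∷ [])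
    ∷ [] )
    ( on (0 ∷ 1 ∷ 2 ∷ 3 ∷ []) 1 (5 ∷ 1 ∷ 2 ∷ 3 ∷ 4 ∷ 0 ∷ [])
    ∷ on (0 ∷ 1 ∷ 2 ∷ 4 ∷ []) 1 (4 ∷ 3 ∷ 2 ∷ 1 ∷ 5 ∷ 0 ∷ [])
    ∷ on (0 ∷ 1 ∷ 3 ∷ 4 ∷ []) 1 (3 ∷ 2 ∷ 1 ∷ 5 ∷ 4 ∷ 0 ∷ [])
    ∷ on (0 ∷ 2 ∷ 3 ∷ 4 ∷ []) 1 (2 ∷ 1 ∷ 5 ∷ 4 ∷ 3 ∷ 0 ∷ [])
    ∷ on (1 ∷ 2 ∷ 3 ∷ 4 ∷ []) 1 (1 ∷ 2 ∷ 3 ∷ 4 ∷ 5 ∷ 0 ∷ [])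
    ∷ [] )

OC₅-check : check 7 15 OC₅-Φ OC₅ OC₅-certificate ≡ true
OC₅-check = refl

-- Misses at distance two on the cycle. A vertex outside I adjacent to cycle vertex 1 and to both
-- vertices of I completes this to T₀, in which v₀ is the cycle vertex 1 and t is the new vertex.
OC₇-02 : Config
OC₇-02 = config (replicate 7 outI ++ replicate 2 inI)
  ((0 , 1) ∷ (0 , 6) ∷ (0 , 8) ∷ (1 , 2) ∷ (1 , 7) ∷ (1 , 8) ∷ (2 , 3) ∷ (2 , 7) ∷ (3 , 4) ∷ (3 , 7) ∷
   (3 , 8) ∷ (4 , 5) ∷ (4 , 7) ∷ (4 , 8) ∷ (5 , 6) ∷ (5 , 7) ∷ (5 , 8) ∷ (6 , 7) ∷ (6 , 8) ∷ [])

OC₇-02-Φ : List Config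
OC₇-02-Φ = II ∷ W₇ ∷ OC₃ ∷ OC₅ ∷ T₀ ∷ []

OC₇-02-certificate : Certificate
OC₇-02-certificate = certificate (1 ∷ 5 ∷ 1 ∷ 1 ∷ 1 ∷ 1 ∷ 1 ∷ 4 ∷ 4 ∷ []) 0 9
    ( on (1 ∷ 2 ∷ []) 2 (0 ∷ 2 ∷ 3 ∷ [])
    ∷ on (0 ∷ 6 ∷ []) 2 (0 ∷ 1 ∷ 7 ∷ [])
    ∷ on (3 ∷ 4 ∷ []) 2 (0 ∷ 4 ∷ 5 ∷ [])
    ∷ on (5 ∷ 6 ∷ []) 2 (0 ∷ 6 ∷ 7 ∷ [])
    ∷ on (1 ∷ 4 ∷ []) 3 (0 ∷ 2 ∷ 3 ∷ 4 ∷ 5 ∷ [])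
    ∷ on (0 ∷ 3 ∷ []) 3 (0 ∷ 1 ∷ 2 ∷ 3 ∷ 4 ∷ [])
    ∷ on (1 ∷ 5 ∷ []) 3 (0 ∷ 2 ∷ 1 ∷ 7 ∷ 6 ∷ [])
    ∷ on (3 ∷ 6 ∷ []) 3 (0 ∷ 4 ∷ 5 ∷ 6 ∷ 7 ∷ [])
    ∷ on (2 ∷ 5 ∷ []) 3 (0 ∷ 3 ∷ 4 ∷ 5 ∷ 6 ∷ [])
    ∷ on (0 ∷ 4 ∷ []) 3 (0 ∷ 1 ∷ 7 ∷ 6 ∷ 5 ∷ [])
    ∷ on (2 ∷ 6 ∷ []) 3 (0 ∷ 3 ∷ 2 ∷ 1 ∷ 7 ∷ [])
    ∷ on (1 ∷ 7 ∷ 8 ∷ []) 4 (2 ∷ 1 ∷ 7 ∷ 6 ∷ 5 ∷ 4 ∷ 3 ∷ 8 ∷ 9 ∷ 0 ∷ [])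
    ∷ [] )
    ( on (8 ∷ []) 0 (0 ∷ 9 ∷ [])
    ∷ on (7 ∷ []) 0 (0 ∷ 8 ∷ [])
    ∷ on (0 ∷ 1 ∷ 2 ∷ 3 ∷ 4 ∷ 5 ∷ 6 ∷ []) 1 (1 ∷ 2 ∷ 3 ∷ 4 ∷ 5 ∷ 6 ∷ 7 ∷ 0 ∷ [])
    ∷ [] )

OC₇-02-check : check 7 15 OC₇-02-Φ OC₇-02 OC₇-02-certificate ≡ true
OC₇-02-check = refl

-- Up to symmetry the only three cycle vertices no two of which are at distance two: 4 is at
-- distance three from both 0 and 1. Once misses at distance two are excluded, this is the only way
-- for three vertices of I to miss different cycle vertices.
OC₇-014 : Config
OC₇-014 = config (replicate 7 outI ++ replicate 3 inI)
  ((0 , 1) ∷ (0 , 6) ∷ (0 , 8) ∷ (0 , 9) ∷ (1 , 2) ∷ (1 , 7) ∷ (1 , 9) ∷ (2 , 3) ∷ (2 , 7) ∷ (2 , 8) ∷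
   (2 , 9) ∷ (3 , 4) ∷ (3 , 7) ∷ (3 , 8) ∷ (3 , 9) ∷ (4 , 5) ∷ (4 , 7) ∷ (4 , 8) ∷ (5 , 6) ∷ (5 , 7) ∷
   (5 , 8) ∷ (5 , 9) ∷ (6 , 7) ∷ (6 , 8) ∷ (6 , 9) ∷ [])

OC₇-014-Φ : List Config
OC₇-014-Φ = OC₃ ∷ OC₅ ∷ OC₇-02 ∷ []

OC₇-014-certificate : Certificate
OC₇-014-certificate = certificate (2 ∷ 2 ∷ 1 ∷ 1 ∷ 2 ∷ 1 ∷ 1 ∷ 0 ∷ 0 ∷ 0 ∷ []) 5 7
    ( on (2 ∷ 3 ∷ []) 0 (0 ∷ 3 ∷ 4 ∷ [])
    ∷ on (5 ∷ 6 ∷ []) 0 (0 ∷ 6 ∷ 7 ∷ [])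
    ∷ on (0 ∷ 1 ∷ []) 0 (0 ∷ 1 ∷ 2 ∷ [])
    ∷ on (4 ∷ 5 ∷ []) 0 (0 ∷ 5 ∷ 6 ∷ [])
    ∷ on (2 ∷ 5 ∷ []) 1 (0 ∷ 3 ∷ 4 ∷ 5 ∷ 6 ∷ [])
    ∷ on (2 ∷ 6 ∷ []) 1 (0 ∷ 3 ∷ 2 ∷ 1 ∷ 7 ∷ [])
    ∷ on (3 ∷ 6 ∷ []) 1 (0 ∷ 4 ∷ 5 ∷ 6 ∷ 7 ∷ [])
    ∷ on (0 ∷ 4 ∷ []) 1 (0 ∷ 1 ∷ 7 ∷ 6 ∷ 5 ∷ [])
    ∷ on (1 ∷ 4 ∷ []) 1 (0 ∷ 2 ∷ 3 ∷ 4 ∷ 5 ∷ [])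
    ∷ on (0 ∷ 3 ∷ []) 1 (0 ∷ 1 ∷ 2 ∷ 3 ∷ 4 ∷ [])
    ∷ on (1 ∷ 5 ∷ []) 1 (0 ∷ 2 ∷ 1 ∷ 7 ∷ 6 ∷ [])
    ∷ [] )
    ( on (0 ∷ 1 ∷ 2 ∷ 3 ∷ 4 ∷ 5 ∷ []) 2 (7 ∷ 1 ∷ 2 ∷ 3 ∷ 4 ∷ 5 ∷ 6 ∷ 0 ∷ 9 ∷ [])
    ∷ on (0 ∷ 1 ∷ 2 ∷ 3 ∷ 4 ∷ 6 ∷ []) 2 (6 ∷ 7 ∷ 1 ∷ 2 ∷ 3 ∷ 4 ∷ 5 ∷ 0 ∷ 8 ∷ [])
    ∷ on (0 ∷ 1 ∷ 2 ∷ 4 ∷ 5 ∷ 6 ∷ []) 2 (4 ∷ 3 ∷ 2 ∷ 1 ∷ 7 ∷ 6 ∷ 5 ∷ 0 ∷ 9 ∷ [])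
    ∷ on (0 ∷ 1 ∷ 3 ∷ 4 ∷ 5 ∷ 6 ∷ []) 2 (3 ∷ 2 ∷ 1 ∷ 7 ∷ 6 ∷ 5 ∷ 4 ∷ 0 ∷ 8 ∷ [])
    ∷ [] )

OC₇-014-check : check 7 15 OC₇-014-Φ OC₇-014 OC₇-014-certificate ≡ true
OC₇-014-check = refl

OC₇-01 : Config
OC₇-01 = config (replicate 7 outI ++ replicate 2 inI)
  ((0 , 1) ∷ (0 , 6) ∷ (0 , 8) ∷ (1 , 2) ∷ (1 , 7) ∷ (2 , 3) ∷ (2 , 7) ∷ (2 , 8) ∷ (3 , 4) ∷ (3 , 7) ∷
   (3 , 8) ∷ (4 , 5) ∷ (4 , 7) ∷ (4 , 8) ∷ (5 , 6) ∷ (5 , 7) ∷ (5 , 8) ∷ (6 , 7) ∷ (6 , 8) ∷ [])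

OC₇-01-Φ : List Config
OC₇-01-Φ = II ∷ W₇ ∷ OC₃ ∷ OC₅ ∷ OC₇-02 ∷ OC₇-014 ∷ []

OC₇-01-certificate : Certificate
OC₇-01-certificate = certificate (2 ∷ 2 ∷ 2 ∷ 1 ∷ 1 ∷ 1 ∷ 2 ∷ 5 ∷ 1 ∷ []) 0 8
    ( on (1 ∷ 6 ∷ 7 ∷ []) 1 (0 ∷ 2 ∷ 3 ∷ 4 ∷ 5 ∷ 6 ∷ 7 ∷ 8 ∷ [])
    ∷ on (0 ∷ 2 ∷ 8 ∷ []) 1 (0 ∷ 1 ∷ 7 ∷ 6 ∷ 5 ∷ 4 ∷ 3 ∷ 9 ∷ [])
    ∷ on (1 ∷ 2 ∷ []) 2 (0 ∷ 2 ∷ 3 ∷ [])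
    ∷ on (3 ∷ 4 ∷ []) 2 (0 ∷ 4 ∷ 5 ∷ [])
    ∷ on (0 ∷ 6 ∷ []) 2 (0 ∷ 1 ∷ 7 ∷ [])
    ∷ on (5 ∷ 6 ∷ []) 2 (0 ∷ 6 ∷ 7 ∷ [])
    ∷ on (0 ∷ 1 ∷ []) 2 (0 ∷ 1 ∷ 2 ∷ [])
    ∷ on (1 ∷ 5 ∷ []) 3 (0 ∷ 2 ∷ 1 ∷ 7 ∷ 6 ∷ [])
    ∷ on (2 ∷ 5 ∷ []) 3 (0 ∷ 3 ∷ 4 ∷ 5 ∷ 6 ∷ [])
    ∷ on (0 ∷ 3 ∷ []) 3 (0 ∷ 1 ∷ 2 ∷ 3 ∷ 4 ∷ [])
    ∷ on (0 ∷ 4 ∷ []) 3 (0 ∷ 1 ∷ 7 ∷ 6 ∷ 5 ∷ [])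
    ∷ on (2 ∷ 6 ∷ []) 3 (0 ∷ 3 ∷ 2 ∷ 1 ∷ 7 ∷ [])
    ∷ [] )
    ( on (7 ∷ []) 0 (0 ∷ 8 ∷ [])
    ∷ on (8 ∷ []) 0 (0 ∷ 9 ∷ [])
    ∷ on (0 ∷ 1 ∷ 2 ∷ 3 ∷ 4 ∷ 6 ∷ []) 4 (6 ∷ 7 ∷ 1 ∷ 2 ∷ 3 ∷ 4 ∷ 5 ∷ 0 ∷ 8 ∷ [])
    ∷ on (0 ∷ 1 ∷ 2 ∷ 4 ∷ 5 ∷ 6 ∷ []) 4 (4 ∷ 3 ∷ 2 ∷ 1 ∷ 7 ∷ 6 ∷ 5 ∷ 0 ∷ 9 ∷ [])
    ∷ on (0 ∷ 1 ∷ 2 ∷ 3 ∷ 5 ∷ 6 ∷ []) 5 (1 ∷ 2 ∷ 3 ∷ 4 ∷ 5 ∷ 6 ∷ 7 ∷ 8 ∷ 9 ∷ 0 ∷ [])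
    ∷ [] )

OC₇-01-check : check 7 15 OC₇-01-Φ OC₇-01 OC₇-01-certificate ≡ true
OC₇-01-check = refl

OC₇-03 : Config
OC₇-03 = config (replicate 7 outI ++ replicate 2 inI)
  ((0 , 1) ∷ (0 , 6) ∷ (0 , 8) ∷ (1 , 2) ∷ (1 , 7) ∷ (1 , 8) ∷ (2 , 3) ∷ (2 , 7) ∷ (2 , 8) ∷ (3 , 4) ∷
   (3 , 7) ∷ (4 , 5) ∷ (4 , 7) ∷ (4 , 8) ∷ (5 , 6) ∷ (5 , 7) ∷ (5 , 8) ∷ (6 , 7) ∷ (6 , 8) ∷ [])

OC₇-03-Φ : List Config
OC₇-03-Φ = II ∷ W₇ ∷ OC₃ ∷ OC₅ ∷ OC₇-02 ∷ OC₇-014 ∷ []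

OC₇-03-certificate : Certificate
OC₇-03-certificate = certificate (2 ∷ 1 ∷ 1 ∷ 2 ∷ 2 ∷ 1 ∷ 1 ∷ 5 ∷ 0 ∷ []) 0 7
    ( on (1 ∷ 6 ∷ 7 ∷ []) 1 (0 ∷ 2 ∷ 3 ∷ 4 ∷ 5 ∷ 6 ∷ 7 ∷ 8 ∷ [])
    ∷ on (1 ∷ 2 ∷ []) 2 (0 ∷ 2 ∷ 3 ∷ [])
    ∷ on (5 ∷ 6 ∷ []) 2 (0 ∷ 6 ∷ 7 ∷ [])
    ∷ on (3 ∷ 4 ∷ []) 2 (0 ∷ 4 ∷ 5 ∷ [])
    ∷ on (1 ∷ 5 ∷ []) 3 (0 ∷ 2 ∷ 1 ∷ 7 ∷ 6 ∷ [])
    ∷ on (2 ∷ 5 ∷ []) 3 (0 ∷ 3 ∷ 4 ∷ 5 ∷ 6 ∷ [])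
    ∷ on (2 ∷ 6 ∷ []) 3 (0 ∷ 3 ∷ 2 ∷ 1 ∷ 7 ∷ [])
    ∷ on (0 ∷ 3 ∷ []) 3 (0 ∷ 1 ∷ 2 ∷ 3 ∷ 4 ∷ [])
    ∷ on (0 ∷ 4 ∷ []) 3 (0 ∷ 1 ∷ 7 ∷ 6 ∷ 5 ∷ [])
    ∷ [] )
    ( on (7 ∷ []) 0 (0 ∷ 8 ∷ [])
    ∷ on (0 ∷ 1 ∷ 2 ∷ 3 ∷ 4 ∷ 6 ∷ []) 4 (6 ∷ 5 ∷ 4 ∷ 3 ∷ 2 ∷ 1 ∷ 7 ∷ 0 ∷ 9 ∷ [])
    ∷ on (0 ∷ 1 ∷ 3 ∷ 4 ∷ 5 ∷ 6 ∷ []) 4 (3 ∷ 2 ∷ 1 ∷ 7 ∷ 6 ∷ 5 ∷ 4 ∷ 0 ∷ 8 ∷ [])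
    ∷ on (0 ∷ 2 ∷ 3 ∷ 4 ∷ 5 ∷ 6 ∷ []) 4 (2 ∷ 3 ∷ 4 ∷ 5 ∷ 6 ∷ 7 ∷ 1 ∷ 0 ∷ 9 ∷ [])
    ∷ on (0 ∷ 1 ∷ 2 ∷ 3 ∷ 4 ∷ 5 ∷ []) 5 (7 ∷ 1 ∷ 2 ∷ 3 ∷ 4 ∷ 5 ∷ 6 ∷ 0 ∷ 8 ∷ 9 ∷ [])
    ∷ [] )

OC₇-03-check : check 7 15 OC₇-03-Φ OC₇-03 OC₇-03-certificate ≡ true
OC₇-03-check = refl

OC₇-0 : Config
OC₇-0 = config (replicate 7 outI ++ (inI ∷ []))
  ((0 , 1) ∷ (0 , 6) ∷ (1 , 2) ∷ (1 , 7) ∷ (2 , 3) ∷ (2 , 7) ∷ (3 , 4) ∷ (3 , 7) ∷ (4 , 5) ∷ (4 , 7) ∷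
   (5 , 6) ∷ (5 , 7) ∷ (6 , 7) ∷ [])

OC₇-0-Φ : List Config
OC₇-0-Φ = II ∷ OC₃ ∷ OC₅ ∷ OC₇-02 ∷ OC₇-01 ∷ OC₇-03 ∷ []

OC₇-0-certificate : Certificate
OC₇-0-certificate = certificate (2 ∷ 2 ∷ 1 ∷ 1 ∷ 2 ∷ 1 ∷ 1 ∷ 5 ∷ []) 0 7
    ( on (2 ∷ 3 ∷ []) 1 (0 ∷ 3 ∷ 4 ∷ [])
    ∷ on (4 ∷ 5 ∷ []) 1 (0 ∷ 5 ∷ 6 ∷ [])
    ∷ on (0 ∷ 1 ∷ []) 1 (0 ∷ 1 ∷ 2 ∷ [])
    ∷ on (5 ∷ 6 ∷ []) 1 (0 ∷ 6 ∷ 7 ∷ [])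
    ∷ on (1 ∷ 5 ∷ []) 2 (0 ∷ 2 ∷ 1 ∷ 7 ∷ 6 ∷ [])
    ∷ on (2 ∷ 6 ∷ []) 2 (0 ∷ 3 ∷ 2 ∷ 1 ∷ 7 ∷ [])
    ∷ on (3 ∷ 6 ∷ []) 2 (0 ∷ 4 ∷ 5 ∷ 6 ∷ 7 ∷ [])
    ∷ on (0 ∷ 4 ∷ []) 2 (0 ∷ 1 ∷ 7 ∷ 6 ∷ 5 ∷ [])
    ∷ on (1 ∷ 4 ∷ []) 2 (0 ∷ 2 ∷ 3 ∷ 4 ∷ 5 ∷ [])
    ∷ on (2 ∷ 5 ∷ []) 2 (0 ∷ 3 ∷ 4 ∷ 5 ∷ 6 ∷ [])
    ∷ on (0 ∷ 3 ∷ []) 2 (0 ∷ 1 ∷ 2 ∷ 3 ∷ 4 ∷ [])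
    ∷ [] )
    ( on (7 ∷ []) 0 (0 ∷ 8 ∷ [])
    ∷ on (0 ∷ 1 ∷ 2 ∷ 3 ∷ 4 ∷ 6 ∷ []) 3 (6 ∷ 7 ∷ 1 ∷ 2 ∷ 3 ∷ 4 ∷ 5 ∷ 0 ∷ 8 ∷ [])
    ∷ on (0 ∷ 1 ∷ 3 ∷ 4 ∷ 5 ∷ 6 ∷ []) 3 (3 ∷ 2 ∷ 1 ∷ 7 ∷ 6 ∷ 5 ∷ 4 ∷ 0 ∷ 8 ∷ [])
    ∷ on (0 ∷ 1 ∷ 2 ∷ 3 ∷ 4 ∷ 5 ∷ []) 4 (7 ∷ 1 ∷ 2 ∷ 3 ∷ 4 ∷ 5 ∷ 6 ∷ 0 ∷ 8 ∷ [])
    ∷ on (0 ∷ 1 ∷ 2 ∷ 4 ∷ 5 ∷ 6 ∷ []) 5 (4 ∷ 3 ∷ 2 ∷ 1 ∷ 7 ∷ 6 ∷ 5 ∷ 0 ∷ 8 ∷ [])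
    ∷ [] )

OC₇-0-check : check 7 15 OC₇-0-Φ OC₇-0 OC₇-0-certificate ≡ true
OC₇-0-check = refl

OC₇-Φ : List Config
OC₇-Φ = OC₃ ∷ OC₅ ∷ OC₇-0 ∷ []

-- Outside I at most two cycle vertices are seen, so five are missed. A vertex of I is credited with
-- 3 and has to miss only two; missing at most one gives `OC₇-0`.
OC₇-certificate : Certificate
OC₇-certificate = certificate (1 ∷ 1 ∷ 1 ∷ 1 ∷ 1 ∷ 1 ∷ 1 ∷ []) 3 5
    ( on (1 ∷ 2 ∷ []) 0 (0 ∷ 2 ∷ 3 ∷ [])
    ∷ on (5 ∷ 6 ∷ []) 0 (0 ∷ 6 ∷ 7 ∷ [])
    ∷ on (3 ∷ 4 ∷ []) 0 (0 ∷ 4 ∷ 5 ∷ [])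
    ∷ on (0 ∷ 6 ∷ []) 0 (0 ∷ 1 ∷ 7 ∷ [])
    ∷ on (0 ∷ 3 ∷ []) 1 (0 ∷ 1 ∷ 2 ∷ 3 ∷ 4 ∷ [])
    ∷ on (1 ∷ 4 ∷ []) 1 (0 ∷ 2 ∷ 3 ∷ 4 ∷ 5 ∷ [])
    ∷ on (0 ∷ 4 ∷ []) 1 (0 ∷ 1 ∷ 7 ∷ 6 ∷ 5 ∷ [])
    ∷ on (2 ∷ 5 ∷ []) 1 (0 ∷ 3 ∷ 4 ∷ 5 ∷ 6 ∷ [])
    ∷ on (2 ∷ 6 ∷ []) 1 (0 ∷ 3 ∷ 2 ∷ 1 ∷ 7 ∷ [])
    ∷ on (1 ∷ 5 ∷ []) 1 (0 ∷ 2 ∷ 1 ∷ 7 ∷ 6 ∷ [])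
    ∷ on (3 ∷ 6 ∷ []) 1 (0 ∷ 4 ∷ 5 ∷ 6 ∷ 7 ∷ [])
    ∷ [] )
    ( on (0 ∷ 1 ∷ 2 ∷ 3 ∷ 4 ∷ 5 ∷ []) 2 (7 ∷ 1 ∷ 2 ∷ 3 ∷ 4 ∷ 5 ∷ 6 ∷ 0 ∷ [])
    ∷ on (0 ∷ 1 ∷ 2 ∷ 3 ∷ 4 ∷ 6 ∷ []) 2 (6 ∷ 5 ∷ 4 ∷ 3 ∷ 2 ∷ 1 ∷ 7 ∷ 0 ∷ [])
    ∷ on (0 ∷ 1 ∷ 2 ∷ 3 ∷ 5 ∷ 6 ∷ []) 2 (5 ∷ 4 ∷ 3 ∷ 2 ∷ 1 ∷ 7 ∷ 6 ∷ 0 ∷ [])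
    ∷ on (0 ∷ 1 ∷ 2 ∷ 4 ∷ 5 ∷ 6 ∷ []) 2 (4 ∷ 3 ∷ 2 ∷ 1 ∷ 7 ∷ 6 ∷ 5 ∷ 0 ∷ [])
    ∷ on (0 ∷ 1 ∷ 3 ∷ 4 ∷ 5 ∷ 6 ∷ []) 2 (3 ∷ 2 ∷ 1 ∷ 7 ∷ 6 ∷ 5 ∷ 4 ∷ 0 ∷ [])
    ∷ on (0 ∷ 2 ∷ 3 ∷ 4 ∷ 5 ∷ 6 ∷ []) 2 (2 ∷ 1 ∷ 7 ∷ 6 ∷ 5 ∷ 4 ∷ 3 ∷ 0 ∷ [])
    ∷ on (1 ∷ 2 ∷ 3 ∷ 4 ∷ 5 ∷ 6 ∷ []) 2 (1 ∷ 2 ∷ 3 ∷ 4 ∷ 5 ∷ 6 ∷ 7 ∷ 0 ∷ [])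
    ∷ [] )

OC₇-check : check 7 15 OC₇-Φ OC₇ OC₇-certificate ≡ true
OC₇-check = refl

-- Configurations for passing to the complement of I.

OW₃ : Config
OW₃ = config (replicate 4 outI)
  ((0 , 1) ∷ (0 , 2) ∷ (0 , 3) ∷ (1 , 2) ∷ (1 , 3) ∷ (2 , 3) ∷ [])

OW₅ : Config
OW₅ = config (replicate 6 outI)
  ((0 , 1) ∷ (0 , 4) ∷ (0 , 5) ∷ (1 , 2) ∷ (1 , 5) ∷ (2 , 3) ∷ (2 , 5) ∷ (3 , 4) ∷ (3 , 5) ∷ (4 , 5) ∷
   [])

OW₇ : Config
OW₇ = config (replicate 8 outI)
  ((0 , 1) ∷ (0 , 6) ∷ (0 , 7) ∷ (1 , 2) ∷ (1 , 7) ∷ (2 , 3) ∷ (2 , 7) ∷ (3 , 4) ∷ (3 , 7) ∷ (4 , 5) ∷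
   (4 , 7) ∷ (5 , 6) ∷ (5 , 7) ∷ (6 , 7) ∷ [])

OH₂ : Config
OH₂ = config (replicate 7 outI)
  ((0 , 1) ∷ (0 , 2) ∷ (0 , 5) ∷ (0 , 6) ∷ (1 , 2) ∷ (1 , 3) ∷ (2 , 3) ∷ (2 , 4) ∷ (3 , 4) ∷ (3 , 5) ∷
   (4 , 5) ∷ (4 , 6) ∷ (5 , 6) ∷ [])

OT₀ : Config
OT₀ = config (replicate 10 outI)
  ((0 , 1) ∷ (0 , 6) ∷ (0 , 7) ∷ (0 , 8) ∷ (0 , 9) ∷ (1 , 2) ∷ (1 , 8) ∷ (2 , 3) ∷ (2 , 7) ∷ (2 , 8) ∷
   (3 , 4) ∷ (3 , 7) ∷ (3 , 8) ∷ (4 , 5) ∷ (4 , 7) ∷ (4 , 8) ∷ (5 , 6) ∷ (5 , 7) ∷ (5 , 8) ∷ (6 , 7) ∷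
   (7 , 9) ∷ (8 , 9) ∷ [])

-- H₂ with an apex, placed last. Moving the apex into the clique turns this into H₂ over a clique
-- with one vertex more, where it is excluded by assumption.
H₂-cone : Config
H₂-cone = config (replicate 8 free)
  ((0 , 1) ∷ (0 , 2) ∷ (0 , 5) ∷ (0 , 6) ∷ (0 , 7) ∷ (1 , 2) ∷ (1 , 3) ∷ (1 , 7) ∷ (2 , 3) ∷ (2 , 4) ∷
   (2 , 7) ∷ (3 , 4) ∷ (3 , 5) ∷ (3 , 7) ∷ (4 , 5) ∷ (4 , 6) ∷ (4 , 7) ∷ (5 , 6) ∷ (5 , 7) ∷ (6 , 7) ∷
   [])

T₀-cone : Config
T₀-cone = config (replicate 11 free)
  ((0 , 1) ∷ (0 , 6) ∷ (0 , 7) ∷ (0 , 8) ∷ (0 , 9) ∷ (0 , 10) ∷ (1 , 2) ∷ (1 , 8) ∷ (1 , 10) ∷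
   (2 , 3) ∷ (2 , 7) ∷ (2 , 8) ∷ (2 , 10) ∷ (3 , 4) ∷ (3 , 7) ∷ (3 , 8) ∷ (3 , 10) ∷ (4 , 5) ∷
   (4 , 7) ∷ (4 , 8) ∷ (4 , 10) ∷ (5 , 6) ∷ (5 , 7) ∷ (5 , 8) ∷ (5 , 10) ∷ (6 , 7) ∷ (6 , 10) ∷
   (7 , 9) ∷ (7 , 10) ∷ (8 , 9) ∷ (8 , 10) ∷ (9 , 10) ∷ [])

OH₂-Φ : List Config
OH₂-Φ = OW₃ ∷ OW₅ ∷ H₂-cone ∷ []

-- The clique has one vertex fewer here, so the density is 22m < 7|M| in place of 15m < 7|M|. A
-- vertex of I is credited with all but 1 of the target, so only one adjacent to the whole
-- configuration, an apex, has to be excluded; the same holds for `OT₀-certificate`.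
OH₂-certificate : Certificate
OH₂-certificate = certificate (1 ∷ 1 ∷ 1 ∷ 1 ∷ 1 ∷ 1 ∷ 1 ∷ []) 2 3
    ( on (2 ∷ 3 ∷ 4 ∷ []) 0 (0 ∷ 3 ∷ 4 ∷ 5 ∷ [])
    ∷ on (0 ∷ 5 ∷ 6 ∷ []) 0 (0 ∷ 1 ∷ 6 ∷ 7 ∷ [])
    ∷ on (1 ∷ 2 ∷ 3 ∷ []) 0 (0 ∷ 2 ∷ 3 ∷ 4 ∷ [])
    ∷ on (4 ∷ 5 ∷ 6 ∷ []) 0 (0 ∷ 5 ∷ 6 ∷ 7 ∷ [])
    ∷ on (1 ∷ 3 ∷ 5 ∷ []) 1 (0 ∷ 2 ∷ 3 ∷ 5 ∷ 6 ∷ 4 ∷ [])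
    ∷ on (0 ∷ 2 ∷ 4 ∷ []) 1 (0 ∷ 1 ∷ 2 ∷ 4 ∷ 5 ∷ 3 ∷ [])
    ∷ on (0 ∷ 1 ∷ 3 ∷ 4 ∷ 6 ∷ []) 1 (1 ∷ 2 ∷ 4 ∷ 5 ∷ 7 ∷ 0 ∷ [])
    ∷ [] )
    ( on (0 ∷ 1 ∷ 2 ∷ 3 ∷ 4 ∷ 5 ∷ 6 ∷ []) 2 (1 ∷ 2 ∷ 3 ∷ 4 ∷ 5 ∷ 6 ∷ 7 ∷ 0 ∷ [])
    ∷ [] )

OH₂-check : check 7 22 OH₂-Φ OH₂ OH₂-certificate ≡ true
OH₂-check = refl

OT₀-Φ : List Config
OT₀-Φ = OW₃ ∷ OW₅ ∷ OW₇ ∷ T₀-cone ∷ []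

OT₀-certificate : Certificate
OT₀-certificate = certificate (3 ∷ 1 ∷ 1 ∷ 1 ∷ 1 ∷ 1 ∷ 1 ∷ 4 ∷ 2 ∷ 1 ∷ []) 6 7
    ( on (5 ∷ 6 ∷ 7 ∷ []) 0 (0 ∷ 6 ∷ 7 ∷ 8 ∷ [])
    ∷ on (3 ∷ 4 ∷ 8 ∷ []) 0 (0 ∷ 4 ∷ 5 ∷ 9 ∷ [])
    ∷ on (0 ∷ 8 ∷ 9 ∷ []) 0 (0 ∷ 1 ∷ 9 ∷ 10 ∷ [])
    ∷ on (2 ∷ 8 ∷ 9 ∷ []) 1 (0 ∷ 3 ∷ 2 ∷ 1 ∷ 10 ∷ 9 ∷ [])
    ∷ on (0 ∷ 4 ∷ 7 ∷ []) 1 (0 ∷ 1 ∷ 7 ∷ 6 ∷ 5 ∷ 8 ∷ [])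
    ∷ on (1 ∷ 4 ∷ 8 ∷ []) 1 (0 ∷ 2 ∷ 3 ∷ 4 ∷ 5 ∷ 9 ∷ [])
    ∷ on (0 ∷ 1 ∷ 7 ∷ []) 1 (0 ∷ 2 ∷ 9 ∷ 10 ∷ 8 ∷ 1 ∷ [])
    ∷ on (0 ∷ 3 ∷ 8 ∷ []) 1 (0 ∷ 1 ∷ 2 ∷ 3 ∷ 4 ∷ 9 ∷ [])
    ∷ on (0 ∷ 6 ∷ 8 ∷ []) 1 (0 ∷ 7 ∷ 8 ∷ 10 ∷ 9 ∷ 1 ∷ [])
    ∷ on (2 ∷ 5 ∷ 8 ∷ []) 1 (0 ∷ 3 ∷ 4 ∷ 5 ∷ 6 ∷ 9 ∷ [])
    ∷ on (3 ∷ 6 ∷ 7 ∷ []) 1 (0 ∷ 4 ∷ 5 ∷ 6 ∷ 7 ∷ 8 ∷ [])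
    ∷ on (0 ∷ 2 ∷ 7 ∷ []) 2 (0 ∷ 1 ∷ 7 ∷ 6 ∷ 5 ∷ 4 ∷ 3 ∷ 8 ∷ [])
    ∷ on (3 ∷ 7 ∷ 9 ∷ []) 2 (0 ∷ 4 ∷ 5 ∷ 6 ∷ 7 ∷ 1 ∷ 10 ∷ 8 ∷ [])
    ∷ on (0 ∷ 5 ∷ 8 ∷ []) 2 (0 ∷ 1 ∷ 2 ∷ 3 ∷ 4 ∷ 5 ∷ 6 ∷ 9 ∷ [])
    ∷ on (0 ∷ 1 ∷ 2 ∷ 3 ∷ 4 ∷ 5 ∷ 6 ∷ []) 2 (1 ∷ 2 ∷ 3 ∷ 4 ∷ 5 ∷ 6 ∷ 7 ∷ 0 ∷ [])
    ∷ [] )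
    ( on (0 ∷ 1 ∷ 2 ∷ 3 ∷ 4 ∷ 5 ∷ 6 ∷ 7 ∷ 8 ∷ 9 ∷ []) 3 (1 ∷ 2 ∷ 3 ∷ 4 ∷ 5 ∷ 6 ∷ 7 ∷ 8 ∷ 9 ∷ 10 ∷ 0 ∷ [])
    ∷ [] )

OT₀-check : check 7 22 OT₀-Φ OT₀ OT₀-certificate ≡ true
OT₀-check = refl

-- Cliques and common neighbourhoods

module Cliques {n : ℕ} (E : Fin n → Fin n → Bool) (E-symm : ∀ u v → E u v ≡ E v u)
               (E-irrefl : ∀ u → E u u ≡ false) where

  adj-sym : ∀ {u v} → E u v ≡ true → E v u ≡ true
  adj-sym {u} {v} h = trans (E-symm v u) h

  Joined : Fin n → List (Fin n) → Set
  Joined v = All (λ w → E v w ≡ true)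

  Clique : List (Fin n) → Set
  Clique []       = ⊤
  Clique (v ∷ vs) = Joined v vs × Clique vs

  Inside : (Fin n → Bool) → List (Fin n) → Set
  Inside U = All (λ v → U v ≡ true)

  clique-↭ : ∀ {vs ws} → vs ↭ ws → Clique vs → Clique ws
  clique-↭ Perm.refl         c                         = c
  clique-↭ (Perm.prep x p)   (j , c)                   = All-resp-↭ p j , clique-↭ p c
  clique-↭ (Perm.swap x y p) ((xy ∷ jx) , jy , c)      = (adj-sym xy ∷ All-resp-↭ p jy) , All-resp-↭ p jx , clique-↭ p c
  clique-↭ (Perm.trans p q)  c                         = clique-↭ q (clique-↭ p c)

  common : List (Fin n) → Fin n → Bool
  common []       z = true
  common (v ∷ vs) z = E v z ∧ common vs z

  common-joined : ∀ vs z → common vs z ≡ true → Joined z vs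
  common-joined []       z h = []
  common-joined (v ∷ vs) z h = adj-sym (∧-fst h) ∷ common-joined vs z (∧-snd {E v z} h)

  joined-common : ∀ vs z → Joined z vs → common vs z ≡ true
  joined-common []       z []       = refl
  joined-common (v ∷ vs) z (h ∷ hs) = ∧-pair (adj-sym h) (joined-common vs z hs)

  nbhd : (Fin n → Bool) → List (Fin n) → Fin n → Bool
  nbhd U K z = U z ∧ common K z

  Independent : (Fin n → Bool) → Set
  Independent I = ∀ u v → I u ≡ true → I v ≡ true → E u v ≡ true → ⊥

  search : ∀ {k} (f : Fin k → Bool) → (Σ (Fin k) λ i → f i ≡ true) ⊎ (∀ i → f i ≡ false)
  search {zero}  f = inj₂ λ ()
  search {suc k} f with bool-case (f zero)
  ... | inj₁ h = inj₁ (zero , h)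
  ... | inj₂ h with search (f ∘ suc)
  ...   | inj₁ (i , q) = inj₁ (suc i , q)
  ...   | inj₂ g = inj₂ λ { zero → h ; (suc i) → g i }

  module Dense (U : Fin n → Bool) (m : ℕ) (bd : Weights.Bounded E U m) where
    open Weights E U

    withWeight : ℕ → List (Fin n) → List (ℕ × Fin n)
    withWeight w = map (w ,_)

    weight-withWeight : ∀ w vs → weight (withWeight w vs) ≡ w * length vs
    weight-withWeight w []       = sym (*-zeroʳ w)
    weight-withWeight w (v ∷ vs) = trans (cong (w +_) (weight-withWeight w vs)) (sym (*-suc w (length vs)))

    withWeight-U : ∀ w vs → Inside U vs → All (λ p → U (proj₂ p) ≡ true) (withWeight w vs)
    withWeight-U w vs us = All.map⁺ us

    missL-common : ∀ w vs z → w ≤ missL (withWeight w vs) z ⊎ common vs z ≡ true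
    missL-common w []       z = inj₂ refl
    missL-common w (v ∷ vs) z with E v z
    ... | false = inj₁ (≤-trans (≤-reflexive (sym (*-identityʳ w))) (m≤m+n _ _))
    ... | true with missL-common w vs z
    ...   | inj₁ le = inj₁ (≤-trans le (m≤n+m _ _))
    ...   | inj₂ c  = inj₂ c

    sumU-one : sumU (λ _ → 1) ≡ count U
    sumU-one = sumF-cong (λ z → *-identityʳ (ι (U z)))

    sumU-const : ∀ c → sumU (λ _ → c) ≡ c * count U
    sumU-const c = trans (sumF-cong (λ z → *-comm (ι (U z)) c)) (sumF-*ˡ c (ι ∘ U))

    sumU-ι : ∀ f → (∀ z → f z ≡ true → U z ≡ true) → sumU (ι ∘ f) ≡ count f
    sumU-ι f h = sumF-cong pt
      where pt : ∀ z → ι (U z) * ι (f z) ≡ ι (f z)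
            pt z with f z in eq
            ... | false = *-zeroʳ (ι (U z))
            ... | true rewrite h z eq = refl

    nbhd⊆ : ∀ K z → nbhd U K z ≡ true → U z ≡ true
    nbhd⊆ K z = ∧-fst

    nbhd-size : ∀ K → Inside U K → count U ≤ length K * m + count (nbhd U K)
    nbhd-size K inU = begin
      count U ≡⟨ sym sumU-one ⟩
      sumU (λ _ → 1) ≤⟨ weigh bd (withWeight 1 K) (withWeight-U 1 K inU) (λ _ → 1) (ι ∘ nbhd U K) pt ⟩
      weight (withWeight 1 K) * m + sumU (ι ∘ nbhd U K)
        ≡⟨ cong₂ _+_ (cong (_* m) (trans (weight-withWeight 1 K) (*-identityˡ _))) (sumU-ι (nbhd U K) (nbhd⊆ K)) ⟩
      length K * m + count (nbhd U K) ∎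
      where
      open ≤-Reasoning
      pt : ∀ z → U z ≡ true → 1 ≤ missL (withWeight 1 K) z + ι (nbhd U K z)
      pt z uz with missL-common 1 K z
      ... | inj₁ le = ≤-trans le (m≤m+n _ _)
      ... | inj₂ c rewrite uz | c = m≤n+m 1 _

    -- If J is an independent set and I a maximum one, a pointwise bound which charges
    -- every vertex of I and credits every vertex of J still bounds |U|.
    balance : ∀ (I J : Fin n → Bool) → (∀ z → I z ≡ true → U z ≡ true) → (∀ z → J z ≡ true → U z ≡ true) →
              count J ≤ count I → ∀ vs → All (λ p → U (proj₂ p) ≡ true) vs → ∀ c →
              (∀ z → U z ≡ true → c + ι (I z) ≤ missL vs z + ι (J z)) → c * count U ≤ weight vs * m
    balance I J I⊆U J⊆U J≤I vs us c pt = +-cancelʳ-≤ (count I) _ _ (begin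
      c * count U + count I ≡⟨ sym (cong₂ _+_ (sumU-const c) (sumU-ι I I⊆U)) ⟩
      sumU (λ _ → c) + sumU (ι ∘ I) ≡⟨ sym (sumU-+ (λ _ → c) (ι ∘ I)) ⟩
      sumU (λ z → c + ι (I z)) ≤⟨ weigh bd vs us _ _ pt ⟩
      weight vs * m + sumU (ι ∘ J) ≡⟨ cong (weight vs * m +_) (sumU-ι J J⊆U) ⟩
      weight vs * m + count J ≤⟨ +-monoʳ-≤ (weight vs * m) J≤I ⟩
      weight vs * m + count I ∎)
      where open ≤-Reasoning

    -- The set lies in the non-neighbourhood of any of its vertices, which contains that vertex
    -- itself.
    independent≤m : ∀ I → (∀ z → I z ≡ true → U z ≡ true) → Independent I → countU I ≤ m
    independent≤m I I⊆U ind with search I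
    ... | inj₂ none = ≤-trans (≤-reflexive (sumF-zero _ (λ z → cong ι (trans (cong (U z ∧_) (none z)) (∧-f (U z)))))) z≤n
      where ∧-f : ∀ b → b ∧ false ≡ false
            ∧-f false = refl
            ∧-f true  = refl
    ... | inj₁ (y , iy) = ≤-trans (count-mono (λ z h → ∧-pair (∧-fst h) (not-false (≢true (λ e → ind y z iy (∧-snd {U z} h) e)))))
                                  (bd y (I⊆U y iy))

  -- Cliques avoiding a maximum independent set

  module MaxIndependent (U : Fin n → Bool) (m b : ℕ) (b≥1 : 1 ≤ b) (bd : Weights.Bounded E U m)
    (dense : (7 * b + 8) * m < 7 * count U)
    (noBig : ∀ L → length L ≡ 3 + b → Inside U L → Clique L → ⊥)
    (I : Fin n → Bool) (I⊆U : ∀ z → I z ≡ true → U z ≡ true) (I-ind : Independent I)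
    (I-max : ∀ J → (∀ z → J z ≡ true → U z ≡ true) → Independent J → count J ≤ count I)
    (noSpindle : ∀ K → suc (length K) ≡ b → Inside U K → Clique K →
                 Realisation.Absent E E-symm (nbhd U K) (λ _ → false) Spindle) where

    open Weights E U
    open Dense U m bd

    Outside : List (Fin n) → Set
    Outside = All (λ v → U v ≡ true × I v ≡ false)

    outside-inside : ∀ {L} → Outside L → Inside U L
    outside-inside = All.map proj₁

    too-light : ∀ c w → c * count U ≤ w * m → 7 * w ≤ c * (7 * b + 8) → 1 ≤ c → ⊥
    too-light c w h h′ c≥1 = <-irrefl refl (begin-strict
      c * ((7 * b + 8) * m) <⟨ *-monoʳ-< c ⦃ ℕ.>-nonZero c≥1 ⦄ dense ⟩
      c * (7 * count U)     ≡⟨ lem₁ c (count U) ⟩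
      7 * (c * count U)     ≤⟨ *-monoʳ-≤ 7 h ⟩
      7 * (w * m)           ≡⟨ sym (*-assoc 7 w m) ⟩
      7 * w * m             ≤⟨ *-monoˡ-≤ m h′ ⟩
      c * (7 * b + 8) * m   ≡⟨ *-assoc c (7 * b + 8) m ⟩
      c * ((7 * b + 8) * m) ∎)
      where
      open ≤-Reasoning
      lem₁ : ∀ c x → c * (7 * x) ≡ 7 * (c * x)
      lem₁ = solve-∀

    -- An edge would complete the clique to one on b + 3 vertices. By maximality of I such common
    -- neighbourhoods can play the role of J in `balance`.
    common-independent : ∀ L → length L ≡ suc b → Inside U L → Clique L → Independent (nbhd U L)
    common-independent L len inU cl u v hu hv uv =
      noBig (u ∷ v ∷ L) (cong (2 +_) len) (∧-fst hu ∷ ∧-fst hv ∷ inU)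
            ((uv ∷ common-joined L u (∧-snd {U u} hu)) , common-joined L v (∧-snd {U v} hv) , cl)

    -- l₀ has the colour of y but is adjacent to x, while x and y, both in I, have so many common
    -- neighbours that two of them are adjacent: this is a Moser spindle.
    spindle : ∀ {l₀ l₁ l₂ K x y} → length (l₀ ∷ l₁ ∷ l₂ ∷ K) ≡ 2 + b →
              Inside U (l₀ ∷ l₁ ∷ l₂ ∷ K) → Clique (l₀ ∷ l₁ ∷ l₂ ∷ K) →
              I x ≡ true → I y ≡ true → E x l₀ ≡ true → Joined x K → Joined y (l₁ ∷ l₂ ∷ K) → ⊥
    spindle {l₀} {l₁} {l₂} {K} {x} {y} len (u₀ ∷ u₁ ∷ u₂ ∷ uK)
            ((l₀₁ ∷ l₀₂ ∷ j₀) , (l₁₂ ∷ j₁) , j₂ , cK) ix iy xl₀ xK (yl₁ ∷ yl₂ ∷ yK) =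
      -- Vertices of I miss both x and y, and any other vertex outside Z misses one of x, y, K.
      -- Hence |U| + |I| ≤ (b + 1)m + |Z|, while |Z| ≤ |I| because Z is independent.
      too-light 1 (weight vs)
        (balance I Z I⊆U (λ z h → ∧-fst h) (I-max Z (λ z h → ∧-fst h) Z-ind) vs
                 (I⊆U x ix ∷ I⊆U y iy ∷ withWeight-U 1 K uK) 1 pt)
        (≤-trans (*-monoʳ-≤ 7 (≤-reflexive wt)) (≤-trans (≤-reflexive (lem b)) (≤-trans (m≤m+n _ 1) (≤-reflexive (lem′ b)))))
        ≤-refl
      where
      vs = (1 , x) ∷ (1 , y) ∷ withWeight 1 K
      lem : ∀ b → 7 * suc b ≡ 7 * b + 7
      lem = solve-∀
      lem′ : ∀ b → 7 * b + 7 + 1 ≡ 1 * (7 * b + 8)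
      lem′ = solve-∀
      lenK : suc (length K) ≡ b
      lenK = suc-injective (suc-injective len)
      wt : weight vs ≡ suc b
      wt = cong suc (trans (cong suc (trans (weight-withWeight 1 K) (*-identityˡ _))) lenK)
      Z : Fin n → Bool
      Z z = U z ∧ (E x z ∧ (E y z ∧ common K z))
      pt : ∀ z → U z ≡ true → 1 + ι (I z) ≤ missL vs z + ι (Z z)
      pt z uz with I z in iz
      ... | true rewrite ≢true (λ e → I-ind x z ix iz e) | ≢true (λ e → I-ind y z iy iz e) = s≤s (s≤s z≤n)
      ... | false rewrite uz with E x z | E y z
      ...   | false | _     = s≤s z≤n
      ...   | true  | false = s≤s z≤n
      ...   | true  | true with missL-common 1 K z
      ...     | inj₁ le = ≤-trans le (m≤m+n _ _)
      ...     | inj₂ c rewrite c = m≤n+m 1 _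
      ρ : Fin n → Fin n → ℕ → Fin n
      ρ w w′ 0 = y
      ρ w w′ 1 = l₁
      ρ w w′ 2 = l₂
      ρ w w′ 3 = l₀
      ρ w w′ 4 = w
      ρ w w′ 5 = w′
      ρ w w′ _ = x
      inK : ∀ z → U z ≡ true → Joined z K → nbhd U K z ≡ true
      inK z uz j = ∧-pair uz (joined-common K z j)
      Z-ind : Independent Z
      Z-ind w w′ hw hw′ ww′ = noSpindle K lenK uK cK (ρ w w′)
        ( ((inK y (I⊆U y iy) yK , tt) , (inK l₁ u₁ j₁ , tt) , (inK l₂ u₂ j₂ , tt) , (inK l₀ u₀ j₀ , tt)
          , (inK w (∧-fst hw) (common-joined K w cw) , tt) , (inK w′ (∧-fst hw′) (common-joined K w′ cw′) , tt)
          , (inK x (I⊆U x ix) xK , tt) , tt)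
        , yl₁ ∷ yl₂ ∷ yw ∷ yw′ ∷ l₁₂ ∷ adj-sym l₀₁ ∷ adj-sym l₀₂ ∷ adj-sym xl₀ ∷ ww′ ∷ adj-sym xw ∷ adj-sym xw′ ∷ [])
        where
        xw = ∧-fst (∧-snd {U w} hw)
        xw′ = ∧-fst (∧-snd {U w′} hw′)
        yw = ∧-fst (∧-snd {E x w} (∧-snd {U w} hw))
        yw′ = ∧-fst (∧-snd {E x w′} (∧-snd {U w′} hw′))
        cw = ∧-snd {E y w} (∧-snd {E x w} (∧-snd {U w} hw))
        cw′ = ∧-snd {E y w′} (∧-snd {E x w′} (∧-snd {U w′} hw′))

    not-all : ∀ L → length L ≡ 2 + b → Inside U L → Clique L → ∀ z → U z ≡ true → Joined z L → ⊥
    not-all L len inU cl z uz j = noBig (z ∷ L) (cong suc len) (uz ∷ inU) (j , cl)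

    bits : List Bool → ℕ → Bool
    bits []       _       = true
    bits (b ∷ bs) zero    = b
    bits (b ∷ bs) (suc i) = bits bs i

    pattern-at : List ℕ → List Bool
    pattern-at = foldr mark []

    -- The list R has no fixed length, so for the pattern check it counts as a single vertex of
    -- weight w, adjacent to z when all of R is: missing any member of R already costs w.
    bits-missL : ∀ w R z vs → missed (map proj₁ vs ++ (w ∷ [])) (bits (map (λ p → E (proj₂ p) z) vs ++ (common R z ∷ [])))
                 ≤ missL (vs ++ withWeight w R) z
    bits-missL w R z ((w′ , v) ∷ vs) = +-monoʳ-≤ (w′ * ι (not (E v z))) (bits-missL w R z vs)
    bits-missL w R z [] with missL-common w R z
    ... | inj₂ c rewrite c | *-zeroʳ w = z≤n
    ... | inj₁ le = ≤-trans (≤-trans (≤-reflexive (+-identityʳ _)) (*ι≤ w (not (common R z)))) le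
      where *ι≤ : ∀ w b → w * ι b ≤ w
            *ι≤ w b = ≤-trans (*-monoʳ-≤ w (ι≤1 b)) (≤-reflexive (*-identityʳ w))

    -- Swapping a vertex of ms for one adjacent to both x and y makes hs, all of whose
    -- vertices are adjacent to x, grow.
    typed-step : ∀ {l₀ x y} r ms hs → length ms ≤ r → length (l₀ ∷ ms ++ hs) ≡ 2 + b →
                 Outside (l₀ ∷ ms ++ hs) → Clique (l₀ ∷ ms ++ hs) → I x ≡ true → I y ≡ true →
                 E x l₀ ≡ true → Joined x hs → Joined y (ms ++ hs) → ⊥
    typed-step r [] [] _ len = ⊥-elim (0≢1+n (suc-injective len))
    typed-step r [] (_ ∷ []) _ len = ⊥-elim (<-irrefl (suc-injective (suc-injective len)) b≥1)
    typed-step r (_ ∷ []) [] _ len = ⊥-elim (<-irrefl (suc-injective (suc-injective len)) b≥1)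
    typed-step r [] (l₁ ∷ l₂ ∷ hs) _ len out cl ix iy xl₀ (_ ∷ _ ∷ xh) yj =
      spindle len (outside-inside out) cl ix iy xl₀ xh yj
    typed-step r (l₁ ∷ []) (l₂ ∷ hs) _ len out cl ix iy xl₀ (_ ∷ xh) yj =
      spindle len (outside-inside out) cl ix iy xl₀ xh yj
    typed-step r (l₁ ∷ l₂ ∷ []) hs _ len out cl ix iy xl₀ xh yj =
      spindle len (outside-inside out) cl ix iy xl₀ xh yj
    typed-step {l₀} {x} {y} (suc r) (l₁ ∷ l₂ ∷ l₃ ∷ ms) hs (s≤s le) len
               out@(o₀ ∷ o₁ ∷ o₂ ∷ o₃ ∷ oR) cl@((l₀₁ ∷ l₀₂ ∷ l₀₃ ∷ j₀) , (l₁₂ ∷ l₁₃ ∷ j₁) , (l₂₃ ∷ j₂) , j₃ , cR)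
               ix iy xl₀ xh (y₁ ∷ y₂ ∷ y₃ ∷ yR) =
      -- If no swap were possible, a vertex outside I would miss weight 2, or 1 if it lies in J, and
      -- a vertex of I would miss x, y and a part of the clique, at least 3. The total weight is
      -- only 6 + 2(b - 2) = 2b + 2.
      too-light 2 (weight vs)
        (balance I J I⊆U (nbhd⊆ L₀) (I-max J (nbhd⊆ L₀) (common-independent L₀ (suc-injective len) (All.tail inU) (proj₂ cl)))
                 vs (proj₁ o₀ ∷ proj₁ o₁ ∷ proj₁ o₂ ∷ proj₁ o₃ ∷ I⊆U x ix ∷ I⊆U y iy ∷ withWeight-U 2 R (outside-inside oR)) 2 pt)
        (≤-trans (*-monoʳ-≤ 7 (≤-reflexive wt)) (≤-trans (m≤m+n _ 2) (≤-reflexive (lem b)))) (s≤s z≤n)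
      where
      R = ms ++ hs
      L₀ = l₁ ∷ l₂ ∷ l₃ ∷ R
      J = nbhd U L₀
      inU = outside-inside out
      us = (1 , l₀) ∷ (1 , l₁) ∷ (1 , l₂) ∷ (1 , l₃) ∷ (1 , x) ∷ (1 , y) ∷ []
      vs = us ++ withWeight 2 R
      lem : ∀ b → 7 * (2 * b + 2) + 2 ≡ 2 * (7 * b + 8)
      lem = solve-∀
      wt : weight vs ≡ 2 * b + 2
      wt = trans (cong (6 +_) (weight-withWeight 2 R))
             (trans (lem₂ (length R)) (cong (λ q → 2 * q + 2) (suc-injective (suc-injective len))))
        where lem₂ : ∀ q → 6 + 2 * q ≡ 2 * (2 + q) + 2
              lem₂ = solve-∀
      exchange : ∀ z l l′ → U z ≡ true → I z ≡ false → Outside (l ∷ l′ ∷ R) → Clique (l₀ ∷ l ∷ l′ ∷ R) →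
                 Joined y (l ∷ l′ ∷ R) → E l₀ z ≡ true → E l z ≡ true → E l′ z ≡ true →
                 E x z ≡ true → E y z ≡ true → common R z ≡ true → ⊥
      exchange z l l′ uz iz o (j , c) yj l₀z lz l′z xz yz cz =
        typed-step r (l ∷ l′ ∷ ms) (z ∷ hs) le (trans (↭-length (↭-sym q)) len)
          (All-resp-↭ q (o₀ ∷ (uz , iz) ∷ o))
          (clique-↭ q ((l₀z ∷ j) , (adj-sym lz ∷ adj-sym l′z ∷ common-joined R z cz) , c))
          ix iy xl₀ (xz ∷ xh) (All-resp-↭ q′ (yz ∷ yj))
        where
        q′ : z ∷ l ∷ l′ ∷ R ↭ l ∷ l′ ∷ ms ++ z ∷ hs
        q′ = ↭-sym (shift z (l ∷ l′ ∷ ms) hs)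
        q : l₀ ∷ z ∷ l ∷ l′ ∷ R ↭ l₀ ∷ l ∷ l′ ∷ ms ++ z ∷ hs
        q = prep l₀ q′
      β : Fin n → ℕ → Bool
      β z = bits (map (λ p → E (proj₂ p) z) us ++ (common R z ∷ []))
      full = pattern-at (0 ∷ 1 ∷ 2 ∷ 3 ∷ 6 ∷ [])
      not-full : ∀ z → U z ≡ true → Sat full (β z) → ⊥
      not-full z uz (a₀ , a₁ , a₂ , a₃ , c , _) =
        not-all (l₀ ∷ L₀) len inU cl z uz
          (adj-sym a₀ ∷ adj-sym a₁ ∷ adj-sym a₂ ∷ adj-sym a₃ ∷ common-joined R z c)
      toL : ∀ z → missed (map proj₁ us ++ (2 ∷ [])) (β z) ≤ missL vs z
      toL z = bits-missL 2 R z us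
      pt : ∀ z → U z ≡ true → 2 + ι (I z) ≤ missL vs z + ι (J z)
      pt z uz with I z in iz
      ... | true with cover-sound 3 0 (map proj₁ us ++ (2 ∷ [])) (full ∷ pattern-at (4 ∷ []) ∷ pattern-at (5 ∷ []) ∷ []) (β z) refl
      ...   | inj₁ h = ≤-trans h (≤-trans (toL z) (m≤m+n _ _))
      ...   | inj₂ (here s) = ⊥-elim (not-full z uz s)
      ...   | inj₂ (there (here (xz , _))) = ⊥-elim (I-ind x z ix iz xz)
      ...   | inj₂ (there (there (here (yz , _)))) = ⊥-elim (I-ind y z iy iz yz)
      pt z uz | false with cover-sound 2 0 (map proj₁ us ++ (2 ∷ []))
          (full ∷ pattern-at (1 ∷ 2 ∷ 3 ∷ 6 ∷ []) ∷ pattern-at (0 ∷ 2 ∷ 3 ∷ 4 ∷ 5 ∷ 6 ∷ [])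
           ∷ pattern-at (0 ∷ 1 ∷ 3 ∷ 4 ∷ 5 ∷ 6 ∷ []) ∷ pattern-at (0 ∷ 1 ∷ 2 ∷ 4 ∷ 5 ∷ 6 ∷ []) ∷ []) (β z) refl
      ...   | inj₁ h = ≤-trans h (≤-trans (toL z) (m≤m+n _ _))
      ...   | inj₂ (here s) = ⊥-elim (not-full z uz s)
      ...   | inj₂ (there (there (here (a₀ , a₂ , a₃ , ax , ay , c , _)))) =
              ⊥-elim (exchange z l₂ l₃ uz iz (o₂ ∷ o₃ ∷ oR) ((l₀₂ ∷ l₀₃ ∷ j₀) , (l₂₃ ∷ j₂) , j₃ , cR) (y₂ ∷ y₃ ∷ yR) a₀ a₂ a₃ ax ay c)
      ...   | inj₂ (there (there (there (here (a₀ , a₁ , a₃ , ax , ay , c , _))))) =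
              ⊥-elim (exchange z l₁ l₃ uz iz (o₁ ∷ o₃ ∷ oR) ((l₀₁ ∷ l₀₃ ∷ j₀) , (l₁₃ ∷ j₁) , j₃ , cR) (y₁ ∷ y₃ ∷ yR) a₀ a₁ a₃ ax ay c)
      ...   | inj₂ (there (there (there (there (here (a₀ , a₁ , a₂ , ax , ay , c , _)))))) =
              ⊥-elim (exchange z l₁ l₂ uz iz (o₁ ∷ o₂ ∷ oR) ((l₀₁ ∷ l₀₂ ∷ j₀) , (l₁₂ ∷ j₁) , j₂ , cR) (y₁ ∷ y₂ ∷ yR) a₀ a₁ a₂ ax ay c)
      ...   | inj₂ (there (here (a₁ , a₂ , a₃ , c , _)))
                with cover-sound 1 0 (map proj₁ us ++ (2 ∷ [])) (full ∷ []) (β z) refl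
      ...     | inj₂ (here s) = ⊥-elim (not-full z uz s)
      ...     | inj₁ h = subst (λ q → 2 ≤ missL vs z + ι q) (sym (∧-pair uz (∧-pair a₁ (∧-pair a₂ (∧-pair a₃ c)))))
                        (≤-trans (s≤s (≤-trans h (toL z))) (≤-reflexive (+-comm 1 _)))

    -- l₀ has a neighbour in I, since I is a maximum independent set.
    typed : ∀ {l₀ y} K → length (l₀ ∷ K) ≡ 2 + b → Outside (l₀ ∷ K) → Clique (l₀ ∷ K) →
            I y ≡ true → Joined y K → ⊥
    typed {l₀} {y} K len out cl iy yK with search (λ x → I x ∧ E x l₀)
    ... | inj₁ (x , h) =
      typed-step {l₀} {x} {y} (length K) K [] ≤-refl (trans (cong (suc ∘ length) (++-identityʳ K)) len)
        (subst (λ L → Outside (l₀ ∷ L)) (sym (++-identityʳ K)) out) (subst (λ L → Clique (l₀ ∷ L)) (sym (++-identityʳ K)) cl)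
        (∧-fst h) iy (∧-snd {I x} h) [] (subst (Joined y) (sym (++-identityʳ K)) yK)
    ... | inj₂ none = <-irrefl refl (≤-trans bigger (I-max J J⊆U J-ind))
      where
      single : Fin n → Bool
      single z = isYes (z Fin.≟ l₀)
        where isYes : ∀ {P : Set} → Dec P → Bool
              isYes (yes _) = true
              isYes (no _)  = false
      single-true : ∀ z → single z ≡ true → z ≡ l₀
      single-true z h with z Fin.≟ l₀
      ... | yes e = e
      single-l₀ : single l₀ ≡ true
      single-l₀ with l₀ Fin.≟ l₀
      ... | yes _ = refl
      ... | no ne = ⊥-elim (ne refl)
      J : Fin n → Bool
      J z = I z ∨ single z
      J⊆U : ∀ z → J z ≡ true → U z ≡ true
      J⊆U z h with ∨-case {I z} h
      ... | inj₁ iz = I⊆U z iz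
      ... | inj₂ e rewrite single-true z e = proj₁ (All.head out)
      ¬adj : ∀ x → I x ≡ true → E x l₀ ≡ true → ⊥
      ¬adj x ix e = true≢false (∧-pair ix e) (none x)
      J-ind : Independent J
      J-ind u v hu hv uv with ∨-case {I u} hu | ∨-case {I v} hv
      ... | inj₁ iu | inj₁ iv = I-ind u v iu iv uv
      ... | inj₁ iu | inj₂ ev rewrite single-true v ev = ¬adj u iu uv
      ... | inj₂ eu | inj₁ iv rewrite single-true u eu = ¬adj v iv (adj-sym uv)
      ... | inj₂ eu | inj₂ ev rewrite single-true u eu | single-true v ev = true≢false uv (E-irrefl l₀)
      bigger : suc (count I) ≤ count J
      bigger = ≤-trans (≤-trans (+-monoˡ-≤ (count I) (count≥1 single l₀ single-l₀)) (≤-reflexive (sym (sumF-+ (ι ∘ single) (ι ∘ I)))))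
                       (sumF-mono disj)
        where
        disj : ∀ z → ι (single z) + ι (I z) ≤ ι (J z)
        disj z with single z in e | I z in iz
        ... | true  | true  rewrite single-true z e = ⊥-elim (true≢false iz (proj₂ (All.head out)))
        ... | true  | false = ≤-refl
        ... | false | true  = ≤-refl
        ... | false | false = z≤n

    -- To apply `typed`, a vertex of I adjacent to all but one vertex of the clique is needed. Here
    -- y in I is fixed and `hs`, the part of the clique known to be adjacent to y, grows by swaps
    -- until at most one vertex is left over.
    untyped-step : ∀ {y} r ms hs → length ms ≤ r → length (ms ++ hs) ≡ 2 + b →
                   Outside (ms ++ hs) → Clique (ms ++ hs) → I y ≡ true → Joined y hs → ⊥
    -- The third vertex is the head of `ms ++ hs`, from whichever part it comes; passing that list
    -- as Q allows matching on it. Only l₁ and l₂ are ever swapped out.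
    untyped-swap : ∀ {y} r l₁ l₂ ms hs Q → ms ++ hs ≡ Q → suc (length ms) ≤ r → length (l₁ ∷ l₂ ∷ Q) ≡ 2 + b →
                   Outside (l₁ ∷ l₂ ∷ Q) → Clique (l₁ ∷ l₂ ∷ Q) → I y ≡ true → Joined y hs → ⊥
    untyped-step {y} r [] hs _ len out cl iy yj = not-all hs len (outside-inside out) cl y (I⊆U y iy) yj
    untyped-step r (l₀ ∷ []) hs _ len out cl iy yj = typed hs len out cl iy yj
    untyped-step {y} (suc r) (l₁ ∷ l₂ ∷ ms) hs (s≤s le) len out cl iy yj =
      untyped-swap {y} r l₁ l₂ ms hs (ms ++ hs) refl le len out cl iy yj
    untyped-swap r l₁ l₂ ms hs [] eq le len out cl iy yj = <-irrefl (suc-injective (suc-injective len)) b≥1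
    untyped-swap {y} r l₁ l₂ ms hs (l₃ ∷ R) eq le len
                 out@(o₁ ∷ o₂ ∷ o₃ ∷ oR) cl@((l₁₂ ∷ l₁₃ ∷ j₁) , (l₂₃ ∷ j₂) , j₃ , cR) iy yj =
      too-light 2 (weight vs)
        (balance I J I⊆U (nbhd⊆ L₃) (I-max J (nbhd⊆ L₃) (common-independent L₃ (suc-injective len) (proj₁ o₁ ∷ proj₁ o₂ ∷ outside-inside oR)
                   ((l₁₂ ∷ j₁) , j₂ , cR)))
                 vs (proj₁ o₁ ∷ proj₁ o₂ ∷ proj₁ o₃ ∷ I⊆U y iy ∷ withWeight-U 2 R (outside-inside oR)) 2 pt)
        (≤-trans (*-monoʳ-≤ 7 (≤-reflexive wt)) (≤-trans (m≤m+n _ 2) (≤-reflexive (lem b)))) (s≤s z≤n)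
      where
      L₃ = l₁ ∷ l₂ ∷ R
      J = nbhd U L₃
      us = (1 , l₁) ∷ (1 , l₂) ∷ (1 , l₃) ∷ (1 , y) ∷ []
      vs = us ++ withWeight 2 R
      lem : ∀ b → 7 * (2 * b + 2) + 2 ≡ 2 * (7 * b + 8)
      lem = solve-∀
      wt : weight vs ≡ 2 * b + 2
      wt = trans (cong (4 +_) (weight-withWeight 2 R))
             (trans (lem₂ (length R)) (cong (λ q → 2 * q + 2) (suc-injective (suc-injective len))))
        where lem₂ : ∀ q → 4 + 2 * q ≡ 2 * suc q + 2
              lem₂ = solve-∀
      exchange : ∀ z l → U z ≡ true → I z ≡ false → Outside (l ∷ l₃ ∷ R) → Clique (l ∷ l₃ ∷ R) →
                 E l z ≡ true → E l₃ z ≡ true → E y z ≡ true → common R z ≡ true → ⊥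
      exchange z l uz iz o c lz l₃z yz cz =
        untyped-step r (l ∷ ms) (z ∷ hs) le (trans (↭-length (↭-sym q)) len)
          (All-resp-↭ q ((uz , iz) ∷ o)) (clique-↭ q ((adj-sym lz ∷ adj-sym l₃z ∷ common-joined R z cz) , c)) iy (yz ∷ yj)
        where
        q : z ∷ l ∷ l₃ ∷ R ↭ l ∷ ms ++ z ∷ hs
        q = subst (λ Q → z ∷ l ∷ Q ↭ l ∷ ms ++ z ∷ hs) eq (↭-sym (shift z (l ∷ ms) hs))
      β : Fin n → ℕ → Bool
      β z = bits (map (λ p → E (proj₂ p) z) us ++ (common R z ∷ []))
      ws = map proj₁ us ++ (2 ∷ [])
      full = pattern-at (0 ∷ 1 ∷ 2 ∷ 4 ∷ [])
      not-full : ∀ z → U z ≡ true → Sat full (β z) → ⊥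
      not-full z uz (a₁ , a₂ , a₃ , c , _) =
        not-all (l₁ ∷ l₂ ∷ l₃ ∷ R) len (outside-inside out) cl z uz
          (adj-sym a₁ ∷ adj-sym a₂ ∷ adj-sym a₃ ∷ common-joined R z c)
      toL : ∀ z → missed ws (β z) ≤ missL vs z
      toL z = bits-missL 2 R z us
      pt : ∀ z → U z ≡ true → 2 + ι (I z) ≤ missL vs z + ι (J z)
      pt z uz with I z in iz
      ... | true with cover-sound 3 0 ws (pattern-at (3 ∷ []) ∷ pattern-at (1 ∷ 2 ∷ 4 ∷ []) ∷ pattern-at (0 ∷ 2 ∷ 4 ∷ []) ∷ pattern-at (0 ∷ 1 ∷ 4 ∷ []) ∷ []) (β z) refl
      ...   | inj₁ h = ≤-trans h (≤-trans (toL z) (m≤m+n _ _))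
      ...   | inj₂ (here (yz , _)) = ⊥-elim (I-ind y z iy iz yz)
      ...   | inj₂ (there (here (a₂ , a₃ , c , _))) =
                ⊥-elim (typed {l₁} {z} (l₂ ∷ l₃ ∷ R) len out cl iz (adj-sym a₂ ∷ adj-sym a₃ ∷ common-joined R z c))
      ...   | inj₂ (there (there (here (a₁ , a₃ , c , _)))) =
                ⊥-elim (typed {l₂} {z} (l₁ ∷ l₃ ∷ R) len (o₂ ∷ o₁ ∷ o₃ ∷ oR) ((adj-sym l₁₂ ∷ l₂₃ ∷ j₂) , (l₁₃ ∷ j₁) , j₃ , cR)
                  iz (adj-sym a₁ ∷ adj-sym a₃ ∷ common-joined R z c))
      ...   | inj₂ (there (there (there (here (a₁ , a₂ , c , _))))) =
                ⊥-elim (typed {l₃} {z} (l₁ ∷ l₂ ∷ R) len (o₃ ∷ o₁ ∷ o₂ ∷ oR)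
                  ((adj-sym l₁₃ ∷ adj-sym l₂₃ ∷ j₃) , (l₁₂ ∷ j₁) , j₂ , cR)
                  iz (adj-sym a₁ ∷ adj-sym a₂ ∷ common-joined R z c))
      pt z uz | false with cover-sound 2 0 ws
          (full ∷ pattern-at (0 ∷ 1 ∷ 4 ∷ []) ∷ pattern-at (1 ∷ 2 ∷ 3 ∷ 4 ∷ []) ∷ pattern-at (0 ∷ 2 ∷ 3 ∷ 4 ∷ []) ∷ []) (β z) refl
      ...   | inj₁ h = ≤-trans h (≤-trans (toL z) (m≤m+n _ _))
      ...   | inj₂ (here s) = ⊥-elim (not-full z uz s)
      ...   | inj₂ (there (there (here (a₂ , a₃ , ay , c , _)))) =
              ⊥-elim (exchange z l₂ uz iz (o₂ ∷ o₃ ∷ oR) ((l₂₃ ∷ j₂) , j₃ , cR) a₂ a₃ ay c)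
      ...   | inj₂ (there (there (there (here (a₁ , a₃ , ay , c , _))))) =
              ⊥-elim (exchange z l₁ uz iz (o₁ ∷ o₃ ∷ oR) ((l₁₃ ∷ j₁) , j₃ , cR) a₁ a₃ ay c)
      ...   | inj₂ (there (here (a₁ , a₂ , c , _)))
                with cover-sound 1 0 ws (full ∷ []) (β z) refl
      ...     | inj₂ (here s) = ⊥-elim (not-full z uz s)
      ...     | inj₁ h = subst (λ q → 2 ≤ missL vs z + ι q) (sym (∧-pair uz (∧-pair a₁ (∧-pair a₂ c))))
                        (≤-trans (s≤s (≤-trans h (toL z))) (≤-reflexive (+-comm 1 _)))

    no-clique-outside : ∀ L → length L ≡ 2 + b → Outside L → Clique L → ⊥
    no-clique-outside (l₀ ∷ L₀) len out cl with search I
    ... | inj₁ (y , iy) = untyped-step {y} (length L) L [] ≤-refl (trans (cong length (++-identityʳ L)) len)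
          (subst Outside (sym (++-identityʳ L)) out) (subst Clique (sym (++-identityʳ L)) cl) iy []
      where L = l₀ ∷ L₀
    -- If I were empty, J would be an independent set larger than it, for it contains l₀.
    ... | inj₂ none = <-irrefl refl (≤-trans (count≥1 J l₀ l₀∈J)
            (≤-trans (I-max J (nbhd⊆ L₀) (common-independent L₀ (suc-injective len) (outside-inside (All.tail out)) (proj₂ cl)))
                     (≤-reflexive (sumF-zero _ (λ z → cong ι (none z))))))
      where
      J = nbhd U L₀
      l₀∈J : J l₀ ≡ true
      l₀∈J = ∧-pair (proj₁ (All.head out)) (joined-common L₀ l₀ (proj₁ cl))

-- Walks and two-colourings

odd : ℕ → Bool
odd zero    = false
odd (suc n) = not (odd n)

xor-not : ∀ b c → not (b xor c) ≡ (not b) xor c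
xor-not false c = refl
xor-not true  c = not-not c
  where not-not : ∀ b → not (not b) ≡ b
        not-not false = refl
        not-not true  = refl

odd-+ : ∀ m n → odd (m + n) ≡ odd m xor odd n
odd-+ zero    n = refl
odd-+ (suc m) n = trans (cong not (odd-+ m n)) (xor-not (odd m) (odd n))

module Walks {n : ℕ} (E : Fin n → Fin n → Bool) (E-symm : ∀ u v → E u v ≡ E v u) where

  data Walk (M : Fin n → Bool) : Fin n → Fin n → ℕ → Set where
    stop : ∀ {v} → M v ≡ true → Walk M v v 0
    step : ∀ {u v w ℓ} → M u ≡ true → E u v ≡ true → Walk M v w ℓ → Walk M u w (suc ℓ)

  _⊕w_ : ∀ {M u v w k ℓ} → Walk M u v k → Walk M v w ℓ → Walk M u w (k + ℓ)
  stop _     ⊕w q = q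
  step m e p ⊕w q = step m e (p ⊕w q)

  first-in : ∀ {M u v ℓ} → Walk M u v ℓ → M u ≡ true
  first-in (stop m)     = m
  first-in (step m _ _) = m

  revOnto : ∀ {M u v w k ℓ} → Walk M u v k → Walk M u w ℓ → Σ ℕ λ j → Walk M v w j × odd j ≡ odd (k + ℓ)
  revOnto {ℓ = ℓ} (stop _) q = ℓ , q , refl
  revOnto {k = suc k} {ℓ = ℓ} (step {u} {v} m e p) q with revOnto p (step (first-in p) (trans (E-symm v u) e) q)
  ... | j , r , h = j , r , trans h (cong odd (+-suc k ℓ))

  NoOddWalk : (Fin n → Bool) → Set
  NoOddWalk M = ∀ v ℓ → Walk M v v ℓ → odd ℓ ≡ true → ⊥

  Proper : (Fin n → Bool) → (Fin n → Bool) → Set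
  Proper M c = ∀ u v → M u ≡ true → M v ≡ true → E u v ≡ true → c u ≡ c v → ⊥

  opposite : ∀ {b c} → (b ≡ c → ⊥) → c ≡ not b
  opposite {false} {false} h = ⊥-elim (h refl)
  opposite {false} {true}  h = refl
  opposite {true}  {false} h = refl
  opposite {true}  {true}  h = ⊥-elim (h refl)

  walk-parity : ∀ {M c u v ℓ} → Proper M c → Walk M u v ℓ → c v ≡ odd ℓ xor c u
  walk-parity pr (stop _) = refl
  walk-parity {c = c} {u = u} {ℓ = suc ℓ} pr (step {v = v} m e p) =
    trans (walk-parity pr p) (trans (cong (odd ℓ xor_) (opposite (pr u v m (first-in p) e))) (lemma (odd ℓ) (c u)))
    where lemma : ∀ a b → a xor not b ≡ not a xor b
          lemma false b = refl
          lemma true false = refl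
          lemma true true = refl

  proper-noOdd : ∀ {M c} → Proper M c → NoOddWalk M
  proper-noOdd {c = c} pr v ℓ p o with walk-parity pr p
  ... | h rewrite o = not-fixed (c v) h
    where not-fixed : ∀ b → b ≡ not b → ⊥
          not-fixed false ()
          not-fixed true ()

  -- The components met so far, with roots, and the parity of a walk from the root to each vertex.
  record Forest (M : Fin n → Bool) : Set where
    field
      root : Fin n → Fin n
      side : Fin n → Bool
      path : ∀ v → M v ≡ true → Σ ℕ λ ℓ → Walk M (root v) v ℓ × odd ℓ ≡ side v

  module _ (M : Fin n → Bool) (noOdd : NoOddWalk M) where
    open Forest

    Settled : Forest M → Fin n × Fin n → Set
    Settled F (u , v) = M u ≡ true → M v ≡ true → E u v ≡ true → root F u ≡ root F v × (side F u ≡ side F v → ⊥)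

    module Merge (F : Forest M) (u v : Fin n) (mu : M u ≡ true) (mv : M v ≡ true) (uv : E u v ≡ true)
                 (ne : root F u ≡ root F v → ⊥) where

      -- Added throughout the component of v, this parity puts u and v on different sides.
      flip : Bool
      flip = not (side F u xor side F v)

      root′ : Fin n → Fin n
      root′ x with root F x Fin.≟ root F v
      ... | yes _ = root F u
      ... | no _  = root F x

      side′ : Fin n → Bool
      side′ x with root F x Fin.≟ root F v
      ... | yes _ = flip xor side F x
      ... | no _  = side F x

      path′ : ∀ x → M x ≡ true → Σ ℕ λ ℓ → Walk M (root′ x) x ℓ × odd ℓ ≡ side′ x
      path′ x mx with root F x Fin.≟ root F v | path F x mx | path F u mu | path F v mv
      ... | no _  | px | _ | _ = px
      ... | yes e | ℓx , px , ox | ℓu , pu , ou | ℓv , pv , ov with revOnto pv (subst (λ r → Walk M r x ℓx) e px)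
      ...   | j , r , oj = ℓu + suc j , pu ⊕w step mu uv r ,
              trans (odd-+ ℓu (suc j)) (trans (cong₂ (λ a b → a xor not b) ou (trans oj (trans (odd-+ ℓv ℓx) (cong₂ _xor_ ov ox)))) (lemma (side F u) (side F v) (side F x)))
        where lemma : ∀ a b c → a xor not (b xor c) ≡ not (a xor b) xor c
              lemma false b c = xor-not b c
              lemma true false false = refl
              lemma true false true = refl
              lemma true true false = refl
              lemma true true true = refl

      merged : Forest M
      merged = record { root = root′ ; side = side′ ; path = path′ }

      keeps : ∀ e → Settled F e → Settled merged e
      keeps (p , q) s mp mq pq with s mp mq pq | root F p Fin.≟ root F v | root F q Fin.≟ root F v
      ... | e , d | yes _ | yes _ = refl , λ h → d (xor-cancel flip h)
        where xor-cancel : ∀ a {b c} → a xor b ≡ a xor c → b ≡ c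
              xor-cancel false h = h
              xor-cancel true {false} {false} h = refl
              xor-cancel true {true}  {true}  h = refl
      ... | e , d | no _  | no _  = e , d
      ... | e , d | yes a | no b  = ⊥-elim (b (trans (sym e) a))
      ... | e , d | no a  | yes b = ⊥-elim (a (trans e b))

      new : Settled merged (u , v)
      new _ _ _ with root F u Fin.≟ root F v | root F v Fin.≟ root F v
      ... | yes e | _     = ⊥-elim (ne e)
      ... | no _  | no b  = ⊥-elim (b refl)
      ... | no _  | yes _ = refl , λ h → lemma (side F u) (side F v) h
        where lemma : ∀ a b → a ≡ not (a xor b) xor b → ⊥
              lemma false false ()
              lemma false true ()
              lemma true false ()
              lemma true true ()

    -- Edges are inserted one at a time. An edge between two components merges them; inside one
    -- component, ends on equal sides would close an odd walk through the root.
    settle : ∀ es → Σ (Forest M) λ F → All (Settled F) es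
    settle [] = record { root = id ; side = λ _ → false ; path = λ v mv → 0 , stop mv , refl } , []
    settle ((u , v) ∷ es) with settle es
    ... | F , s with bool-case (M u) | bool-case (M v) | bool-case (E u v)
    ...   | inj₂ f | _ | _ = F , (λ t _ _ → ⊥-elim (true≢false t f)) ∷ s
    ...   | _ | inj₂ f | _ = F , (λ _ t _ → ⊥-elim (true≢false t f)) ∷ s
    ...   | _ | _ | inj₂ f = F , (λ _ _ t → ⊥-elim (true≢false t f)) ∷ s
    ...   | inj₁ mu | inj₁ mv | inj₁ uv with root F u Fin.≟ root F v
    ...     | no ne = Merge.merged F u v mu mv uv ne , Merge.new F u v mu mv uv ne ∷ All.map (λ {e} → Merge.keeps F u v mu mv uv ne e) s
    ...     | yes e = F , (λ _ _ _ → e , clash) ∷ s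
      where
      clash : side F u ≡ side F v → ⊥
      clash h with path F u mu | path F v mv
      ... | ℓu , pu , ou | ℓv , pv , ov with revOnto pv (subst (λ r → Walk M r u ℓu) e pu)
      ...   | j , r , oj = noOdd u (suc j) (step mu uv r) (trans (cong not (trans oj (trans (odd-+ ℓv ℓu) (cong₂ _xor_ ov (trans ou h))))) (lemma (side F v)))
        where lemma : ∀ a → not (a xor a) ≡ true
              lemma false = refl
              lemma true = refl

    two-colouring : Σ (Fin n → Bool) (Proper M)
    two-colouring with settle (cartesianProduct (allFin n) (allFin n))
    ... | F , s = side F , λ u v mu mv uv → proj₂ (All.lookup s (∈-cartesianProduct⁺ (∈-allFin u) (∈-allFin v)) mu mv uv)

  verts : ∀ {M u v ℓ} → Walk M u v ℓ → List (Fin n)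
  verts (stop _)             = []
  verts (step {u = u} _ _ p) = u ∷ verts p

  length-verts : ∀ {M u v ℓ} (p : Walk M u v ℓ) → length (verts p) ≡ ℓ
  length-verts (stop _)     = refl
  length-verts (step _ _ p) = cong suc (length-verts p)

  verts-in : ∀ {M u v ℓ} (p : Walk M u v ℓ) → All (λ x → M x ≡ true) (verts p)
  verts-in (stop _)     = []
  verts-in (step m _ p) = m ∷ verts-in p

  hits : Fin n → ∀ {M u v ℓ} → Walk M u v ℓ → ℕ
  hits z (stop _)             = 0
  hits z (step {u = u} _ _ p) = ι (E u z) + hits z p

  first-hit : ∀ z {M u v ℓ} (p : Walk M u v ℓ) {k} → suc k ≤ hits z p →
              Σ (Fin n) λ w → Σ (Fin n) λ w′ → Σ ℕ λ i → Σ ℕ λ j → Walk M u w i × E w z ≡ true × M w ≡ true × E w w′ ≡ true ×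
              (Σ (Walk M w′ v j) λ q → k ≤ hits z q) × i + suc j ≡ ℓ
  first-hit z (step {u} {v} {ℓ = ℓ} m e p) h with E u z in eq
  ... | true = u , v , 0 , ℓ , stop m , eq , m , e , (p , s≤s⁻¹ h) , refl
  ... | false with first-hit z p h
  ...   | w , w′ , i , j , a , wz , mw , ww′ , q , s = w , w′ , suc i , j , step m e a , wz , mw , ww′ , q , cong suc s

  restrict : ∀ {M M′ u v ℓ} (p : Walk M u v ℓ) → All (λ x → M′ x ≡ true) (verts p) → M′ v ≡ true → Walk M′ u v ℓ
  restrict (stop _)     _        mv = stop mv
  restrict (step _ e p) (m ∷ ms) mv = step m e (restrict p ms mv)

  -- Three neighbours of z cut an odd closed walk into three arcs, one of which has odd length;
  -- closing it up through z gives a shorter odd closed walk.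
  three-hits : ∀ z {M u k} (p : Walk M u u (4 + k)) → odd (4 + k) ≡ true → M z ≡ true → 3 ≤ hits z p →
               Σ ℕ λ j → j < 4 + k × odd j ≡ true × Walk M z z j
  three-hits z {M} {u} {k} p o mz h with first-hit z p h
  ... | w₁ , w₁′ , i , j , a , w₁z , m₁ , e₁ , (q , h₂) , s with first-hit z q h₂
  ...   | w₂ , w₂′ , i₂ , j₂ , b , w₂z , m₂ , e₂ , (q₂ , h₃) , s₂ with first-hit z q₂ h₃
  ...     | w₃ , w₃′ , i₃ , j₃ , c , w₃z , m₃ , e₃ , (q₃ , _) , s₃ =
    choose (odd x₁) (odd x₂) (odd x₃) refl refl refl
    where
    x₁ = suc i₂
    x₂ = suc i₃
    x₃ = suc j₃ + i
    arc₁ : Walk M w₁ w₂ x₁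
    arc₁ = step m₁ e₁ b
    arc₂ : Walk M w₂ w₃ x₂
    arc₂ = step m₂ e₂ c
    arc₃ : Walk M w₃ w₁ x₃
    arc₃ = step m₃ e₃ q₃ ⊕w a
    total : x₁ + x₂ + x₃ ≡ 4 + k
    total = trans (lemma i i₂ i₃ j₃) (trans (cong (λ y → i + suc (i₂ + suc y)) s₃) (trans (cong (λ y → i + suc y) s₂) s))
      where lemma : ∀ i i₂ i₃ j₃ → suc i₂ + suc i₃ + (suc j₃ + i) ≡ i + suc (i₂ + suc (i₃ + suc j₃))
            lemma = solve-∀
    close : ∀ {w w′ x} → Walk M w w′ x → E w z ≡ true → E w′ z ≡ true → Walk M z z (suc (x + 1))
    close {w} q wz w′z = step mz (trans (E-symm z w) wz) (q ⊕w step (last-in q) w′z (stop mz))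
      where last-in : ∀ {u v ℓ} → Walk M u v ℓ → M v ≡ true
            last-in (stop m)     = m
            last-in (step _ _ p) = last-in p
    odd-close : ∀ x → odd x ≡ true → odd (suc (x + 1)) ≡ true
    odd-close x ox = trans (cong (not ∘ odd) (+-comm x 1)) (trans (nn (odd x)) ox)
      where nn : ∀ b → not (not b) ≡ b
            nn false = refl
            nn true = refl
    -- Closing an arc through z adds 2 to its length. Either the result is still shorter than the
    -- whole walk, or the next arc has length 1 and closes to a triangle, which is shorter because
    -- the walk has length at least 4.
    short-or-one : ∀ x y y′ → suc x + (suc y + suc y′) ≡ 4 + k → (suc (suc x + 1) < 4 + k) ⊎ (y ≡ 0)
    short-or-one x zero    y′ e = inj₂ refl
    short-or-one x (suc y) y′ e = inj₁ (≤-trans (≤-trans (m≤m+n _ (y + y′)) (≤-reflexive (lemma x y y′))) (≤-reflexive e))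
      where lemma : ∀ x y y′ → suc (suc (suc x + 1)) + (y + y′) ≡ suc x + (suc (suc y) + suc y′)
            lemma = solve-∀
    use : ∀ x y y′ {w w′ v v′} → suc x + (suc y + suc y′) ≡ 4 + k → odd (suc x) ≡ true →
          Walk M w w′ (suc x) → E w z ≡ true → E w′ z ≡ true → Walk M v v′ (suc y) → E v z ≡ true → E v′ z ≡ true →
          Σ ℕ λ j → j < 4 + k × odd j ≡ true × Walk M z z j
    use x y y′ e ox q wz w′z r vz v′z with short-or-one x y y′ e
    ... | inj₁ lt = _ , lt , odd-close (suc x) ox , close q wz w′z
    ... | inj₂ refl = _ , s≤s (s≤s (s≤s (s≤s z≤n))) , refl , close r vz v′z
    choose : ∀ b₁ b₂ b₃ → odd x₁ ≡ b₁ → odd x₂ ≡ b₂ → odd x₃ ≡ b₃ → Σ ℕ λ j → j < 4 + k × odd j ≡ true × Walk M z z j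
    choose true  _     _     o₁ _ _ = use i₂ i₃ (j₃ + i) (trans (sym (+-assoc x₁ x₂ x₃)) total) o₁ arc₁ w₁z w₂z arc₂ w₂z w₃z
    choose false true  _     _ o₂ _ = use i₃ i₂ (j₃ + i) (trans (lemma i₂ i₃ (j₃ + i)) total) o₂ arc₂ w₂z w₃z arc₁ w₁z w₂z
      where lemma : ∀ a b c → suc b + (suc a + suc c) ≡ suc a + suc b + suc c
            lemma = solve-∀
    choose false false true  _ _ o₃ = use (j₃ + i) i₂ i₃ (trans (lemma i₂ i₃ (j₃ + i)) total) o₃ arc₃ w₃z w₁z arc₁ w₁z w₂z
      where lemma : ∀ a b c → suc c + (suc a + suc b) ≡ suc a + suc b + suc c
            lemma = solve-∀
    choose false false false o₁ o₂ o₃ = ⊥-elim (true≢false (trans (cong odd total) o)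
      (trans (odd-+ (x₁ + x₂) x₃) (trans (cong (_xor odd x₃) (odd-+ x₁ x₂)) (cong₂ _xor_ (cong₂ _xor_ o₁ o₂) o₃))))

-- Colouring graphs without H₂ and T₀

module Colouring {n : ℕ} (E : Fin n → Fin n → Bool) (E-symm : ∀ u v → E u v ≡ E v u)
                 (E-irrefl : ∀ u → E u u ≡ false) where
  open Cliques E E-symm E-irrefl
  open Walks E E-symm

  LocBip : ℕ → (Fin n → Bool) → Set
  LocBip a U = ∀ K → length K ≡ a → Inside U K → Clique K → Σ (Fin n → Bool) (Proper (nbhd U K))

  AbsentIn : (Fin n → Bool) → Config → Set
  AbsentIn M = Realisation.Absent E E-symm M (λ _ → false)

  -- No (a-1)-clique of U has the given configuration in its common neighbourhood.
  FreeOf : Config → ℕ → (Fin n → Bool) → Set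
  FreeOf A a U = ∀ K → suc (length K) ≡ a → Inside U K → Clique K → AbsentIn (nbhd U K) A

  no-anyI : ∀ M → AbsentIn M anyI
  no-anyI M ρ (((_ , ()) , _) , _)

  Max : (Fin n → Bool) → (Fin n → Bool) → Set
  Max U I = ∀ J → (∀ z → J z ≡ true → U z ≡ true) → Independent J → count J ≤ count I

  module _ (U : Fin n → Bool) where

    Indep-in : (Fin n → Bool) → Set
    Indep-in J = (∀ z → J z ≡ true → U z ≡ true) × Independent J

    indep-dec : ∀ J → Dec (Indep-in J)
    indep-dec J = (Fin.all? λ z → (J z Bool.≟ true) →-dec (U z Bool.≟ true)) ×-dec
      (Fin.all? λ u → Fin.all? λ v → (J u Bool.≟ true) →-dec ((J v Bool.≟ true) →-dec ((E u v Bool.≟ true) →-dec no id)))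

    -- The recursion is on r, a bound for the improvements still possible: each of them enlarges I,
    -- which has at most n elements.
    improve : ∀ r I → Indep-in I → n ≤ count I + r → Σ (Fin n → Bool) λ I → Indep-in I × Max U I
    improve r I ind le with anySubset? (λ S → indep-dec (Vec.lookup S) ×-dec (suc (count I) ≤? count (Vec.lookup S)))
    ... | no none = I , ind , λ J J⊆U J-ind → ≮⇒≥ λ lt → none (Vec.tabulate J ,
            ((λ z h → J⊆U z (trans (sym (Vec.lookup∘tabulate J z)) h)) ,
             (λ u v hu hv → J-ind u v (trans (sym (Vec.lookup∘tabulate J u)) hu) (trans (sym (Vec.lookup∘tabulate J v)) hv))) ,
            ≤-trans lt (≤-reflexive (count-cong (λ z → sym (Vec.lookup∘tabulate J z)))))
    improve zero I ind le | yes (S , _ , lt) =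
      ⊥-elim (<-irrefl refl (≤-trans lt (≤-trans (count≤n (Vec.lookup S)) (≤-trans le (≤-reflexive (+-identityʳ _))))))
    improve (suc r) I ind le | yes (S , ind′ , lt) =
      improve r (Vec.lookup S) ind′ (≤-trans le (≤-trans (≤-reflexive (+-suc (count I) r)) (+-monoˡ-≤ r lt)))

    maximum-independent : Σ (Fin n → Bool) λ I → Indep-in I × Max U I
    maximum-independent = improve n (λ _ → false) ((λ z ()) , λ u v ()) (m≤n+m n _)

  locBip-noBig : ∀ {a U} → LocBip a U → ∀ L → length L ≡ 3 + a → Inside U L → Clique L → ⊥
  locBip-noBig {U = U} lb (u ∷ v ∷ w ∷ K) len (uu ∷ uv ∷ uw ∷ uK) ((u~v ∷ u~w ∷ ju) , (v~w ∷ jv) , jw , cK)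
    with lb K (suc-injective (suc-injective (suc-injective len))) uK cK
  ... | c , pr = proper-noOdd pr u 3 (step (mem u uu ju) u~v (step (mem v uv jv) v~w (step (mem w uw jw) (adj-sym u~w) (stop (mem u uu ju))))) refl
    where mem : ∀ x → U x ≡ true → Joined x K → nbhd U K x ≡ true
          mem x ux jx = ∧-pair ux (joined-common K x jx)

  wheelFree : ∀ {a U} → LocBip a U → ∀ K → suc (length K) ≡ a → Inside U K → Clique K →
              ∀ h → nbhd U K h ≡ true → NoOddWalk (λ z → nbhd U K z ∧ E h z)
  wheelFree {U = U} lb K len inU cl h mh v ℓ p o with lb (h ∷ K) len (∧-fst mh ∷ inU) (common-joined K h (∧-snd {U h} mh) , cl)
  ... | c , pr = proper-noOdd pr v ℓ (restrict p (All.map (λ {x} → sub x) (verts-in p)) (sub v (first-in p))) o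
    where sub : ∀ x → nbhd U K x ∧ E h x ≡ true → nbhd U (h ∷ K) x ≡ true
          sub x q = ∧-pair {U x} (∧-fst {U x} (∧-fst {nbhd U K x} q))
                      (∧-pair {E h x} (∧-snd {nbhd U K x} q) (∧-snd {U x} (∧-fst {nbhd U K x} q)))

  module Wheels (N : Fin n → Bool)
                (wf : ∀ h → N h ≡ true → NoOddWalk (λ z → N z ∧ E h z)) where
    wheel₃ : ∀ (ρ : ℕ → Fin n) → (∀ i → i < 4 → N (ρ i) ≡ true) → All (λ e → E (ρ (proj₁ e)) (ρ (proj₂ e)) ≡ true) (Config.edges W₃) → ⊥
    wheel₃ ρ r (e₀₁ ∷ e₀₂ ∷ h₀ ∷ e₁₂ ∷ h₁ ∷ h₂ ∷ []) =
      wf (ρ 3) (r 3 (s≤s (s≤s (s≤s (s≤s z≤n))))) (ρ 0) 3 (go 0 h₀ e₀₁ (go 1 h₁ e₁₂ (go 2 h₂ (adj-sym e₀₂) (stop (mem 0 h₀))))) refl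
      where
      mem : ∀ i {le : T (i <ᵇ 4)} → E (ρ i) (ρ 3) ≡ true → N (ρ i) ∧ E (ρ 3) (ρ i) ≡ true
      mem i {le} h = ∧-pair (r i (<ᵇ⇒< i 4 le)) (adj-sym h)
      go : ∀ i {le : T (i <ᵇ 4)} {v w ℓ} → E (ρ i) (ρ 3) ≡ true → E (ρ i) v ≡ true →
           Walk (λ z → N z ∧ E (ρ 3) z) v w ℓ → Walk (λ z → N z ∧ E (ρ 3) z) (ρ i) w (suc ℓ)
      go i {le} h e p = step (mem i {le} h) e p

    wheel₅ : ∀ (ρ : ℕ → Fin n) → (∀ i → i < 6 → N (ρ i) ≡ true) → All (λ e → E (ρ (proj₁ e)) (ρ (proj₂ e)) ≡ true) (Config.edges W₅) → ⊥
    wheel₅ ρ r (e₀₁ ∷ e₀₄ ∷ h₀ ∷ e₁₂ ∷ h₁ ∷ e₂₃ ∷ h₂ ∷ e₃₄ ∷ h₃ ∷ h₄ ∷ []) =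
      wf (ρ 5) (r 5 ≤-refl) (ρ 0) 5
        (go 0 h₀ e₀₁ (go 1 h₁ e₁₂ (go 2 h₂ e₂₃ (go 3 h₃ e₃₄ (go 4 h₄ (adj-sym e₀₄) (stop (mem 0 h₀))))))) refl
      where
      mem : ∀ i {le : T (i <ᵇ 6)} → E (ρ i) (ρ 5) ≡ true → N (ρ i) ∧ E (ρ 5) (ρ i) ≡ true
      mem i {le} h = ∧-pair (r i (<ᵇ⇒< i 6 le)) (adj-sym h)
      go : ∀ i {le : T (i <ᵇ 6)} {v w ℓ} → E (ρ i) (ρ 5) ≡ true → E (ρ i) v ≡ true →
           Walk (λ z → N z ∧ E (ρ 5) z) v w ℓ → Walk (λ z → N z ∧ E (ρ 5) z) (ρ i) w (suc ℓ)
      go i {le} h e p = step (mem i {le} h) e p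

    wheel₇ : ∀ (ρ : ℕ → Fin n) → (∀ i → i < 8 → N (ρ i) ≡ true) → All (λ e → E (ρ (proj₁ e)) (ρ (proj₂ e)) ≡ true) (Config.edges W₇) → ⊥
    wheel₇ ρ r (e₀₁ ∷ e₀₆ ∷ h₀ ∷ e₁₂ ∷ h₁ ∷ e₂₃ ∷ h₂ ∷ e₃₄ ∷ h₃ ∷ e₄₅ ∷ h₄ ∷ e₅₆ ∷ h₅ ∷ h₆ ∷ []) =
      wf (ρ 7) (r 7 ≤-refl) (ρ 0) 7
        (go 0 h₀ e₀₁ (go 1 h₁ e₁₂ (go 2 h₂ e₂₃ (go 3 h₃ e₃₄ (go 4 h₄ e₄₅ (go 5 h₅ e₅₆ (go 6 h₆ (adj-sym e₀₆) (stop (mem 0 h₀))))))))) refl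
      where
      mem : ∀ i {le : T (i <ᵇ 8)} → E (ρ i) (ρ 7) ≡ true → N (ρ i) ∧ E (ρ 7) (ρ i) ≡ true
      mem i {le} h = ∧-pair (r i (<ᵇ⇒< i 8 le)) (adj-sym h)
      go : ∀ i {le : T (i <ᵇ 8)} {v w ℓ} → E (ρ i) (ρ 7) ≡ true → E (ρ i) v ≡ true →
           Walk (λ z → N z ∧ E (ρ 7) z) v w ℓ → Walk (λ z → N z ∧ E (ρ 7) z) (ρ i) w (suc ℓ)
      go i {le} h e p = step (mem i {le} h) e p

  realV-M : ∀ M I fs ρ → Realisation.RealV E E-symm M I fs ρ → ∀ i → i < length fs → M (ρ i) ≡ true
  realV-M M I (f ∷ fs) ρ ((m , _) , _)  zero    _        = m
  realV-M M I (f ∷ fs) ρ (_ , rv) (suc i) (s≤s le) = realV-M M I fs (ρ ∘ suc) rv i le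

  RealV-take : ∀ M I k l ρ → Realisation.RealV E E-symm M I (replicate l free) ρ → k ≤ l →
               Realisation.RealV E E-symm M I (replicate k free) ρ
  RealV-take M I zero    l       ρ rv le = tt
  RealV-take M I (suc k) (suc l) ρ (r , rv) (s≤s le) = r , RealV-take M I k l (ρ ∘ suc) rv le

  realV-out : ∀ M I k ρ → Realisation.RealV E E-symm M I (replicate k outI) ρ → ∀ i → i < k → M (ρ i) ∧ not (I (ρ i)) ≡ true
  realV-out M I (suc k) ρ ((m , o) , _)  zero    _        = ∧-pair m (not-false o)
  realV-out M I (suc k) ρ (_ , rv) (suc i) (s≤s le) = realV-out M I k (ρ ∘ suc) rv i le

  module _ {a U} (lb : LocBip a U) (K : List (Fin n)) (len : suc (length K) ≡ a) (inU : Inside U K) (cl : Clique K)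
           (I : Fin n → Bool) where
    open Realisation E E-symm (nbhd U K) I
    private wf = wheelFree lb K len inU cl

    absent-W₃ : Absent W₃
    absent-W₃ ρ (rv , re) = Wheels.wheel₃ (nbhd U K) wf ρ (realV-M (nbhd U K) I _ ρ rv) re

    absent-W₅ : Absent W₅
    absent-W₅ ρ (rv , re) = Wheels.wheel₅ (nbhd U K) wf ρ (realV-M (nbhd U K) I _ ρ rv) re

    absent-W₇ : Absent W₇
    absent-W₇ ρ (rv , re) = Wheels.wheel₇ (nbhd U K) wf ρ (realV-M (nbhd U K) I _ ρ rv) re

  -- Each vertex of K removes at most m vertices, which pays for one unit of a in the density
  -- condition.
  dense-nbhd : ∀ k c a U m → Weights.Bounded E U m → (k * a + c) * m < k * count U → ∀ K → length K ≡ a → Inside U K →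
               c * m < k * count (nbhd U K)
  dense-nbhd k c a U m bd dense K refl inU = +-cancelˡ-< (k * length K * m) _ _ (begin-strict
    k * length K * m + c * m ≡⟨ sym (*-distribʳ-+ m (k * length K) c) ⟩
    (k * length K + c) * m <⟨ dense ⟩
    k * count U ≤⟨ *-monoʳ-≤ k (Dense.nbhd-size U m bd K inU) ⟩
    k * (length K * m + count (nbhd U K)) ≡⟨ lemma k (length K) m (count (nbhd U K)) ⟩
    k * length K * m + k * count (nbhd U K) ∎)
    where
    open ≤-Reasoning
    lemma : ∀ k l m c → k * (l * m + c) ≡ k * l * m + k * c
    lemma = solve-∀

  -- The set I is taken to be empty here, for the certificates that speak of M alone.
  module Plain (k c : ℕ) {b U m} (bd : Weights.Bounded E U m) (dense : (k * b + c) * m < k * count U)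
               (lb : LocBip (suc b) U) (K : List (Fin n)) (len : length K ≡ b) (inU : Inside U K) (cl : Clique K) where
    open Realisation E E-symm (nbhd U K) (λ _ → false) public
    open Counting U m bd (λ v → ∧-fst) (≤-trans (≤-reflexive (sumF-zero _ (λ z → cong ι (Bool.∧-zeroʳ (U z))))) z≤n)
                  k c (dense-nbhd k c b U m bd dense K len inU) public
    no-W₃ = absent-W₃ lb K (cong suc len) inU cl (λ _ → false)
    no-W₅ = absent-W₅ lb K (cong suc len) inU cl (λ _ → false)

  module Step (b : ℕ) (U : Fin n → Bool) (m : ℕ) (bd : Weights.Bounded E U m)
              (dense : (7 * suc b + 8) * m < 7 * count U) (lb : LocBip (suc b) U)
              (freeH₂ : FreeOf H₂ (suc b) U) (freeT₀ : FreeOf T₀ (suc b) U)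
              (I : Fin n → Bool) (I⊆U : ∀ z → I z ≡ true → U z ≡ true) (I-ind : Independent I) (I-max : Max U I) where

    V : Fin n → Bool
    V z = U z ∧ not (I z)

    V⊆U : ∀ z → V z ≡ true → U z ≡ true
    V⊆U z = ∧-fst

    I≤m : Weights.countU E U I ≤ m
    I≤m = Dense.independent≤m U m bd I I⊆U I-ind

    dense₁₅ : (7 * b + 15) * m < 7 * count U
    dense₁₅ = subst (λ x → x * m < 7 * count U) (lemma b) dense
      where lemma : ∀ b → 7 * suc b + 8 ≡ 7 * b + 15
            lemma = solve-∀

    freeSpindle : FreeOf Spindle (suc b) U
    freeSpindle K len inU cl = P.refute Spindle-Φ Spindle Spindle-certificate Spindle-check
        (no-anyI (nbhd U K) ∷ P.no-W₃ ∷ s₁ ∷ s₂ ∷ [])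
      where
      module P = Plain 7 15 bd dense₁₅ lb K (suc-injective len) inU cl
      s₁ = P.refute Spindle₁-Φ Spindle₁ Spindle₁-certificate Spindle₁-check
             (no-anyI (nbhd U K) ∷ P.no-W₃ ∷ P.no-W₅ ∷ freeH₂ K len inU cl ∷ [])
      s₂ = P.refute Spindle₂-Φ Spindle₂ Spindle₂-certificate Spindle₂-check
             (no-anyI (nbhd U K) ∷ P.no-W₅ ∷ s₁ ∷ [])

    module Outside-K (K : List (Fin n)) (len : length K ≡ b) (inV : Inside V K) (cl : Clique K) where
      inU : Inside U K
      inU = All.map (λ {v} → V⊆U v) inV
      M = nbhd U K
      N : Fin n → Bool
      N = nbhd V K
      open Realisation E E-symm M I
      open Counting U m bd (λ v → ∧-fst) I≤m 7 15 (dense-nbhd 7 15 b U m bd dense₁₅ K len inU)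

      out : ∀ {v} → V v ≡ true → U v ≡ true × I v ≡ false
      out {v} h = ∧-fst h , not-true (∧-snd {U v} h)

      no-OC₃ : Absent OC₃
      no-OC₃ ρ (((m₀ , o₀) , (m₁ , o₁) , (m₂ , o₂) , _) , (e₀₁ ∷ e₀₂ ∷ e₁₂ ∷ [])) =
        -- The triangle and K form an (a + 2)-clique outside I, where a = b + 1.
        MaxIndependent.no-clique-outside U m (suc b) (s≤s z≤n) bd dense (locBip-noBig lb) I I⊆U I-ind I-max freeSpindle
          (ρ 0 ∷ ρ 1 ∷ ρ 2 ∷ K) (cong (3 +_) len)
          ((∧-fst m₀ , o₀) ∷ (∧-fst m₁ , o₁) ∷ (∧-fst m₂ , o₂) ∷ All.map out inV)
          ((e₀₁ ∷ e₀₂ ∷ j 0 m₀) , (e₁₂ ∷ j 1 m₁) , j 2 m₂ , cl)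
        where j : ∀ i → M (ρ i) ≡ true → Joined (ρ i) K
              j i h = common-joined K (ρ i) (∧-snd {U (ρ i)} h)

      no-II : Absent II
      no-II ρ (((_ , i₀) , (_ , i₁) , _) , (e ∷ [])) = I-ind (ρ 0) (ρ 1) i₀ i₁ e

      no-W₅ = absent-W₅ lb K (cong suc len) inU cl I
      no-W₇ = absent-W₇ lb K (cong suc len) inU cl I
      no-Spindle : Absent Spindle
      no-Spindle = freeSpindle K (cong suc len) inU cl
      no-T₀ : Absent T₀
      no-T₀ = freeT₀ K (cong suc len) inU cl

      no-OC₅-0 = refute OC₅-0-Φ OC₅-0 OC₅-0-certificate OC₅-0-check (no-II ∷ no-W₅ ∷ no-OC₃ ∷ no-Spindle ∷ [])
      no-OC₅ = refute OC₅-Φ OC₅ OC₅-certificate OC₅-check (no-OC₃ ∷ no-OC₅-0 ∷ [])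
      no-OC₇-02 = refute OC₇-02-Φ OC₇-02 OC₇-02-certificate OC₇-02-check (no-II ∷ no-W₇ ∷ no-OC₃ ∷ no-OC₅ ∷ no-T₀ ∷ [])
      no-OC₇-014 = refute OC₇-014-Φ OC₇-014 OC₇-014-certificate OC₇-014-check (no-OC₃ ∷ no-OC₅ ∷ no-OC₇-02 ∷ [])
      no-OC₇-01 = refute OC₇-01-Φ OC₇-01 OC₇-01-certificate OC₇-01-check
                    (no-II ∷ no-W₇ ∷ no-OC₃ ∷ no-OC₅ ∷ no-OC₇-02 ∷ no-OC₇-014 ∷ [])
      no-OC₇-03 = refute OC₇-03-Φ OC₇-03 OC₇-03-certificate OC₇-03-check
                    (no-II ∷ no-W₇ ∷ no-OC₃ ∷ no-OC₅ ∷ no-OC₇-02 ∷ no-OC₇-014 ∷ [])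
      no-OC₇-0 = refute OC₇-0-Φ OC₇-0 OC₇-0-certificate OC₇-0-check
                    (no-II ∷ no-OC₃ ∷ no-OC₅ ∷ no-OC₇-02 ∷ no-OC₇-01 ∷ no-OC₇-03 ∷ [])
      no-OC₇ = refute OC₇-Φ OC₇ OC₇-certificate OC₇-check (no-OC₃ ∷ no-OC₅ ∷ no-OC₇-0 ∷ [])

      N⊆M : ∀ z → N z ≡ true → M z ≡ true × I z ≡ false
      N⊆M z h = ∧-pair (∧-fst (∧-fst h)) (∧-snd {V z} h) , not-true (∧-snd {U z} (∧-fst h))

      -- On a shortest odd closed walk outside I, a vertex outside I has at most two neighbours and
      -- a vertex of I at least one non-neighbour; from length 9 on this contradicts the density.
      long : ∀ k {v} (p : Walk N v v (9 + k)) → odd (9 + k) ≡ true →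
             (∀ j → j < 9 + k → ∀ z → Walk N z z j → odd j ≡ true → ⊥) → ⊥
      long k {v} p o shorter = <-irrefl refl (begin-strict
          (7 + k) * (15 * m)      <⟨ *-monoʳ-< (7 + k) (dense-nbhd 7 15 b U m bd dense₁₅ K len inU) ⟩
          (7 + k) * (7 * count M) ≡⟨ lem₁ (7 + k) (count M) ⟩
          7 * ((7 + k) * count M) ≤⟨ *-monoʳ-≤ 7 total ⟩
          -- For length ℓ the requirement is 7(2ℓ - 3) ≤ 15(ℓ - 2), that is ℓ ≥ 9; hence lengths 5
          -- and 7 need their own configurations.
          7 * ((9 + k) * m + (6 + k) * m) ≤⟨ m≤m+n _ (k * m) ⟩
          7 * ((9 + k) * m + (6 + k) * m) + k * m ≡⟨ lem₂ k m ⟩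
          (7 + k) * (15 * m) ∎)
        where
        open ≤-Reasoning
        open Weights E U
        open Dense U m bd
        vs = withWeight 1 (verts p)
        lem₁ : ∀ c x → c * (7 * x) ≡ 7 * (c * x)
        lem₁ = solve-∀
        lem₂ : ∀ k m → 7 * ((9 + k) * m + (6 + k) * m) + k * m ≡ (7 + k) * (15 * m)
        lem₂ = solve-∀
        pN : All (λ x → N x ≡ true) (verts p)
        pN = verts-in p
        miss+hits : ∀ z {M′ u w ℓ} (q : Walk M′ u w ℓ) → missL (withWeight 1 (verts q)) z + hits z q ≡ ℓ
        miss+hits z (stop _) = refl
        miss+hits z (step {u = u} {ℓ = ℓ} _ _ q) = trans (lem (ι (not (E u z))) (missL (withWeight 1 (verts q)) z) (ι (E u z)) (hits z q))
            (cong₂ _+_ (ι-not (E u z)) (miss+hits z q))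
          where lem : ∀ a b c d → 1 * a + b + (c + d) ≡ (c + a) + (b + d)
                lem = solve-∀
        few : ∀ z → N z ≡ true → 7 + k ≤ missL vs z
        few z nz = +-cancelʳ-≤ 2 _ _ (≤-trans (≤-reflexive (lem k)) (≤-trans (≤-reflexive (sym (miss+hits z p)))
                     (+-monoʳ-≤ (missL vs z) (≮⇒≥ λ h → let (j , lt , oj , q) = three-hits z p o nz h in shorter j lt z q oj))))
          where lem : ∀ k → 7 + k + 2 ≡ 9 + k
                lem = solve-∀
        all-adjacent : ∀ z → M z ≡ true → common (verts p) z ≡ true → ⊥
        all-adjacent z mz c = wheelFree lb K (cong suc len) inU cl z mz v (9 + k)
            (restrict p (both (verts p) pN (common-joined (verts p) z c)) (head-both p pN (common-joined (verts p) z c))) o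
          where
          both : ∀ xs → All (λ x → N x ≡ true) xs → Joined z xs → All (λ x → M x ∧ E z x ≡ true) xs
          both [] [] [] = []
          both (x ∷ xs) (nx ∷ ns) (j ∷ js) = ∧-pair (proj₁ (N⊆M x nx)) j ∷ both xs ns js
          head-both : ∀ {u w ℓ} (q : Walk N u w (suc ℓ)) → All (λ x → N x ≡ true) (verts q) → Joined z (verts q) → M u ∧ E z u ≡ true
          head-both (step _ _ q) (nx ∷ _) (j ∷ _) = ∧-pair (proj₁ (N⊆M _ nx)) j
        pt : ∀ z → U z ≡ true → (7 + k) * ι (M z) ≤ missL vs z + (6 + k) * ι (I z)
        pt z uz with M z in mz
        ... | false = ≤-trans (≤-reflexive (*-zeroʳ (7 + k))) z≤n
        ... | true with I z in iz
        ...   | false = ≤-trans (≤-reflexive (*-identityʳ (7 + k))) (≤-trans (few z nz) (m≤m+n _ _))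
          where nz : N z ≡ true
                nz = ∧-pair (∧-pair uz (not-false iz)) (∧-snd {U z} mz)
        ...   | true with missL-common 1 (verts p) z
        ...     | inj₁ h = ≤-trans (≤-reflexive (*-identityʳ (7 + k))) (≤-trans (+-monoˡ-≤ (6 + k) h) (≤-reflexive (cong (missL vs z +_) (sym (*-identityʳ (6 + k))))))
        ...     | inj₂ c = ⊥-elim (all-adjacent z mz c)
        total : (7 + k) * count M ≤ (9 + k) * m + (6 + k) * m
        total = begin
          (7 + k) * count M ≡⟨ cong ((7 + k) *_) (sym (sumU-ι M (λ z → ∧-fst))) ⟩
          (7 + k) * sumU (ι ∘ M) ≡⟨ sym (sumU-* (7 + k) (ι ∘ M)) ⟩
          sumU (λ z → (7 + k) * ι (M z)) ≤⟨ weigh bd vs (withWeight-U 1 (verts p) (All.map (λ {x} h → ∧-fst (proj₁ (N⊆M x h))) pN)) _ _ pt ⟩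
          weight vs * m + sumU (λ z → (6 + k) * ι (I z))
            ≡⟨ cong₂ _+_ (cong (_* m) (trans (weight-withWeight 1 (verts p)) (trans (*-identityˡ _) (length-verts p)))) (sumU-* (6 + k) (ι ∘ I)) ⟩
          (9 + k) * m + (6 + k) * sumU (ι ∘ I) ≤⟨ +-monoʳ-≤ ((9 + k) * m) (*-monoʳ-≤ (6 + k) (≤-trans (≤-reflexive (sym (countU≡sumU I))) I≤m)) ⟩
          (9 + k) * m + (6 + k) * m ∎

      env : List (Fin n) → Fin n → ℕ → Fin n
      env []       d _       = d
      env (x ∷ xs) d zero    = x
      env (x ∷ xs) d (suc i) = env xs d i

      odd-step : ∀ r ℓ → ℓ < r → ∀ v → Walk N v v ℓ → odd ℓ ≡ true → ⊥
      odd-step (suc r) 1 _ v (step m e (stop _)) _ = true≢false e (E-irrefl v)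
      odd-step (suc r) 3 _ v (step m₀ e₀ (step {u = u₁} m₁ e₁ (step {u = u₂} m₂ e₂ (stop _)))) _ =
        no-OC₃ (env (v ∷ u₁ ∷ u₂ ∷ []) v)
          ((N⊆M _ m₀ , N⊆M _ m₁ , N⊆M _ m₂ , tt) , (e₀ ∷ adj-sym e₂ ∷ e₁ ∷ []))
      odd-step (suc r) 5 _ v (step m₀ e₀ (step {u = u₁} m₁ e₁ (step {u = u₂} m₂ e₂ (step {u = u₃} m₃ e₃ (step {u = u₄} m₄ e₄ (stop _)))))) _ =
        no-OC₅ (env (v ∷ u₁ ∷ u₂ ∷ u₃ ∷ u₄ ∷ []) v)
          ((N⊆M _ m₀ , N⊆M _ m₁ , N⊆M _ m₂ , N⊆M _ m₃ , N⊆M _ m₄ , tt) , (e₀ ∷ adj-sym e₄ ∷ e₁ ∷ e₂ ∷ e₃ ∷ []))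
      odd-step (suc r) 7 _ v (step m₀ e₀ (step {u = u₁} m₁ e₁ (step {u = u₂} m₂ e₂ (step {u = u₃} m₃ e₃ (step {u = u₄} m₄ e₄
                              (step {u = u₅} m₅ e₅ (step {u = u₆} m₆ e₆ (stop _)))))))) _ =
        no-OC₇ (env (v ∷ u₁ ∷ u₂ ∷ u₃ ∷ u₄ ∷ u₅ ∷ u₆ ∷ []) v)
          ((N⊆M _ m₀ , N⊆M _ m₁ , N⊆M _ m₂ , N⊆M _ m₃ , N⊆M _ m₄ , N⊆M _ m₅ , N⊆M _ m₆ , tt) ,
           (e₀ ∷ adj-sym e₆ ∷ e₁ ∷ e₂ ∷ e₃ ∷ e₄ ∷ e₅ ∷ []))
      odd-step (suc r) (suc (suc (suc (suc (suc (suc (suc (suc (suc k))))))))) (s≤s le) v p o =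
        long k p o (λ j lt z q oj → odd-step r j (≤-trans lt le) z q oj)

      two-colourable : Σ (Fin n → Bool) (Proper N)
      two-colourable = two-colouring N (λ v ℓ → odd-step (suc ℓ) ℓ ≤-refl v)

    lbV : LocBip b V
    lbV K len inV cl = Outside-K.two-colourable K len inV cl

    bdV : Weights.Bounded E V m
    bdV v vv = ≤-trans (count-mono (λ z h → ∧-pair (V⊆U z (∧-fst h)) (∧-snd {V z} h))) (bd v (V⊆U v vv))

    -- Deleting I costs at most m vertices, the amount by which the requirement drops from b + 1 to
    -- b.
    denseV : (7 * b + 8) * m < 7 * count V
    denseV = +-cancelˡ-< (7 * m) _ _ (begin-strict
      7 * m + (7 * b + 8) * m ≡⟨ lem b m ⟩
      (7 * suc b + 8) * m <⟨ dense ⟩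
      7 * count U ≤⟨ *-monoʳ-≤ 7 split ⟩
      7 * (m + count V) ≡⟨ *-distribˡ-+ 7 m (count V) ⟩
      7 * m + 7 * count V ∎)
      where
      open ≤-Reasoning
      lem : ∀ b m → 7 * m + (7 * b + 8) * m ≡ (7 * suc b + 8) * m
      lem = solve-∀
      split : count U ≤ m + count V
      split = ≤-trans (≤-trans (sumF-mono pt) (≤-reflexive (sumF-+ (λ z → ι (U z ∧ I z)) (ι ∘ V)))) (+-monoˡ-≤ (count V) I≤m)
        where pt : ∀ z → ι (U z) ≤ ι (U z ∧ I z) + ι (V z)
              pt z with U z | I z
              ... | false | _ = z≤n
              ... | true | true = ≤-refl
              ... | true | false = ≤-refl

    module Inside-K (K : List (Fin n)) (len : suc (length K) ≡ b) (inV : Inside V K) (cl : Clique K) where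
      inU : Inside U K
      inU = All.map (λ {v} → V⊆U v) inV
      M = nbhd U K
      open Realisation E E-symm M I

      -- Here K has a - 2 vertices, which leaves 7·2 + 8 = 22.
      dense₂₂ : (7 * length K + 22) * m < 7 * count U
      dense₂₂ = subst (λ x → x * m < 7 * count U) (trans (cong (λ y → 7 * suc y + 8) (sym len)) (lemma (length K))) dense
        where lemma : ∀ b → 7 * suc (suc b) + 8 ≡ 7 * b + 22
              lemma = solve-∀
      open Counting U m bd (λ v → ∧-fst) I≤m 7 22 (dense-nbhd 7 22 (length K) U m bd dense₂₂ K refl inU)

      wf : ∀ h → nbhd V K h ≡ true → NoOddWalk (λ z → nbhd V K z ∧ E h z)
      wf = wheelFree lbV K len inV cl

      fromOut : ∀ k ρ → RealV (replicate k outI) ρ → ∀ i → i < k → nbhd V K (ρ i) ≡ true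
      fromOut k ρ rv i lt with realV-out M I k ρ rv i lt
      ... | h = ∧-pair (∧-pair (∧-fst (∧-fst h)) (∧-snd {M (ρ i)} h)) (∧-snd {U (ρ i)} (∧-fst h))

      no-OW₃ : Absent OW₃
      no-OW₃ ρ (rv , re) = Wheels.wheel₃ (nbhd V K) wf ρ (fromOut 4 ρ rv) re
      no-OW₅ : Absent OW₅
      no-OW₅ ρ (rv , re) = Wheels.wheel₅ (nbhd V K) wf ρ (fromOut 6 ρ rv) re
      no-OW₇ : Absent OW₇
      no-OW₇ ρ (rv , re) = Wheels.wheel₇ (nbhd V K) wf ρ (fromOut 8 ρ rv) re

      toOut : ∀ k ρ → Realisation.RealV E E-symm (nbhd V K) (λ _ → false) (replicate k free) ρ → RealV (replicate k outI) ρ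
      toOut zero    ρ rv = tt
      toOut (suc k) ρ ((m₀ , _) , rv) =
        (∧-pair (∧-fst (∧-fst m₀)) (∧-snd {V (ρ 0)} m₀) , not-true (∧-snd {U (ρ 0)} (∧-fst m₀))) , toOut k (ρ ∘ suc) rv

      upgrade : ∀ z k ρ → RealV (replicate k free) ρ → (∀ i → i < k → E z (ρ i) ≡ true) →
                Realisation.RealV E E-symm (nbhd U (z ∷ K)) (λ _ → false) (replicate k free) ρ
      upgrade z zero    ρ rv              h = tt
      upgrade z (suc k) ρ ((m₀ , _) , rv) h =
        (∧-pair {U (ρ 0)} (∧-fst {U (ρ 0)} m₀) (∧-pair {E z (ρ 0)} (h 0 z<s) (∧-snd {U (ρ 0)} m₀)) , tt) , upgrade z k (ρ ∘ suc) rv (λ i lt → h (suc i) (s≤s lt))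

      spokes : ∀ C h k ρ → RealE (Config.edges C) ρ → all (λ i → any (joins h i) (Config.edges C)) (upTo k) ≡ true →
               ∀ i → i < k → E (ρ h) (ρ i) ≡ true
      spokes C h k ρ re q i lt = RealE-edge (Config.edges C) ρ h i (All.lookup (all-true _ (upTo k) q) (∈-upTo⁺ lt)) re

      add-apex : ∀ z → M z ≡ true → Inside U (z ∷ K) × Clique (z ∷ K)
      add-apex z mz = (∧-fst mz ∷ inU) , (common-joined K z (∧-snd {U z} mz) , cl)

      no-H₂-cone : Absent H₂-cone
      no-H₂-cone ρ (rv , re) = freeH₂ (ρ 7 ∷ K) (cong suc len) (proj₁ ap) (proj₂ ap) ρ
          (upgrade (ρ 7) 7 ρ (proj₁ sub) (spokes H₂-cone 7 7 ρ re refl) , proj₂ sub)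
        where
        ap = add-apex (ρ 7) (realV-M M I _ ρ rv 7 ≤-refl)
        sub : Realises H₂ ρ
        sub = RealV-take M I 7 8 ρ rv (s≤s (s≤s (s≤s (s≤s (s≤s (s≤s (s≤s z≤n))))))) ,
              All.map (λ {e} q → RealE-edge (Config.edges H₂-cone) ρ (proj₁ e) (proj₂ e) q re)
                      (all-true (λ e → any (joins (proj₁ e) (proj₂ e)) (Config.edges H₂-cone)) (Config.edges H₂) refl)
      no-T₀-cone : Absent T₀-cone
      no-T₀-cone ρ (rv , re) = freeT₀ (ρ 10 ∷ K) (cong suc len) (proj₁ ap) (proj₂ ap) ρ
          (upgrade (ρ 10) 10 ρ (proj₁ sub) (spokes T₀-cone 10 10 ρ re refl) , proj₂ sub)
        where
        ap = add-apex (ρ 10) (realV-M M I _ ρ rv 10 ≤-refl)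
        sub : Realises T₀ ρ
        sub = RealV-take M I 10 11 ρ rv (n≤1+n 10) ,
              All.map (λ {e} q → RealE-edge (Config.edges T₀-cone) ρ (proj₁ e) (proj₂ e) q re)
                      (all-true (λ e → any (joins (proj₁ e) (proj₂ e)) (Config.edges T₀-cone)) (Config.edges T₀) refl)

      no-H₂ : AbsentIn (nbhd V K) H₂
      no-H₂ ρ (rv , re) = refute OH₂-Φ OH₂ OH₂-certificate OH₂-check (no-OW₃ ∷ no-OW₅ ∷ no-H₂-cone ∷ []) ρ (toOut 7 ρ rv , re)

      no-T₀ : AbsentIn (nbhd V K) T₀
      no-T₀ ρ (rv , re) = refute OT₀-Φ OT₀ OT₀-certificate OT₀-check (no-OW₃ ∷ no-OW₅ ∷ no-OW₇ ∷ no-T₀-cone ∷ []) ρ (toOut 10 ρ rv , re)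

  ProperIn : ∀ {k} → (Fin n → Bool) → (Fin n → Fin k) → Set
  ProperIn U c = ∀ u v → U u ≡ true → U v ≡ true → E u v ≡ true → c u ≢ c v

  Colourable-in : ℕ → (Fin n → Bool) → Set
  Colourable-in k U = Σ (Fin n → Fin k) (ProperIn U)

  Hypotheses : ℕ → (Fin n → Bool) → ℕ → Set
  Hypotheses a U m = Weights.Bounded E U m × (7 * a + 8) * m < 7 * count U × LocBip a U × FreeOf H₂ a U × FreeOf T₀ a U

  Peeled : ℕ → (Fin n → Bool) → ℕ → Set
  Peeled b U m = Σ (Fin n → Bool) λ V → Hypotheses b V m × (Colourable-in (b + 2) V → Colourable-in (suc b + 2) U)

  peel-off : ∀ b U m → Hypotheses (suc b) U m → (Σ (Fin n → Bool) λ I → Indep-in U I × Max U I) → Peeled b U m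
  peel-off b U m (bd , dense , lb , fH , fT) (I , (I⊆U , I-ind) , I-max) =
    V , (Step.bdV b U m bd dense lb fH fT I I⊆U I-ind I-max , Step.denseV b U m bd dense lb fH fT I I⊆U I-ind I-max ,
         Step.lbV b U m bd dense lb fH fT I I⊆U I-ind I-max , Step.Inside-K.no-H₂ b U m bd dense lb fH fT I I⊆U I-ind I-max ,
         Step.Inside-K.no-T₀ b U m bd dense lb fH fT I I⊆U I-ind I-max) , add
    where
    V : Fin n → Bool
    V z = U z ∧ not (I z)
    add : Colourable-in (b + 2) V → Colourable-in (suc b + 2) U
    add (c , pr) = c′ , pr′
      where
      c′ : Fin n → Fin (suc b + 2)
      c′ v = if I v then zero else suc (c v)
      pr′ : ProperIn U c′
      pr′ u v uu uv e q with I u in iu | I v in iv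
      ... | true  | true  = I-ind u v iu iv e
      ... | true  | false = case q of λ ()
      ... | false | true  = case q of λ ()
      ... | false | false = pr u v (∧-pair uu (not-false iu)) (∧-pair uv (not-false iv)) e (Fin.suc-injective q)

  abstract
    peel : ∀ b U m → Hypotheses (suc b) U m → Peeled b U m
    peel b U m h = peel-off b U m h (maximum-independent U)

  colour : ∀ a U m → Hypotheses a U m → Colourable-in (a + 2) U
  -- For a = 0 the empty clique has everything as its common neighbourhood, so local bipartiteness
  -- is already a 2-colouring.
  colour zero U m (bd , dense , lb , _) with lb [] refl [] tt
  ... | c , pr = toFin ∘ c , λ u v uu uv e q → pr u v (∧-pair uu refl) (∧-pair uv refl) e (toFin-inj (c u) (c v) q)
    where
    toFin : Bool → Fin 2
    toFin false = zero
    toFin true  = suc zero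
    toFin-inj : ∀ a b → toFin a ≡ toFin b → a ≡ b
    toFin-inj false false _ = refl
    toFin-inj true  true  _ = refl
  colour (suc b) U m h = colour-on (peel b U m h)
    where colour-on : Peeled b U m → Colourable-in (suc b + 2) U
          colour-on (V , h′ , add) = add (colour b V m h′)

-- Identifying two vertices of a forbidden graph creates an odd wheel or another forbidden graph,
-- so homomorphic copies are embedded copies.

record Identification : Set where
  constructor identification
  field
    fst-vertex snd-vertex : ℕ
    index-of              : ℕ
    hom                   : List ℕ
open Identification

rename : ℕ → ℕ → ℕ → ℕ
rename p q i = if i ≡ᵇ p then q else i

-- Both vertices are kept and each receives the edges of the other, so a map may use either index.
identify : ℕ → ℕ → Config → Config
identify p q A = config (Config.flags A)
  (Config.edges A ++ map (λ e → rename p q (proj₁ e) , rename p q (proj₂ e)) (Config.edges A)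
                  ++ map (λ e → rename q p (proj₁ e) , rename q p (proj₂ e)) (Config.edges A))

checkIdentification : List Config → Config → ℕ → ℕ → Identification → Bool
checkIdentification Φ A p q ι with Φ ‼ index-of ι
... | nothing = false
... | just B  = (fst-vertex ι ≡ᵇ p) ∧ ((snd-vertex ι ≡ᵇ q) ∧ checkHom B (hom ι) (identify p q A))

-- Adjacent vertices are distinct for lack of loops; every other pair needs an identification
-- leading to something forbidden.
checkInjective : List Config → Config → List Identification → ℕ → Bool
checkInjective Φ A ιs k = all (λ q → all (λ p → any (joins p q) (Config.edges A) ∨ any (checkIdentification Φ A p q) ιs) (upTo q)) (upTo k)

CoC₇-Ψ : List Config
CoC₇-Ψ = W₃ ∷ []

CoC₇-identifications : List Identification
CoC₇-identifications =
    identification 0 3 0 (0 ∷ 4 ∷ 5 ∷ 6 ∷ [])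
  ∷ identification 0 4 0 (0 ∷ 1 ∷ 2 ∷ 3 ∷ [])
  ∷ identification 1 4 0 (0 ∷ 1 ∷ 5 ∷ 6 ∷ [])
  ∷ identification 1 5 0 (1 ∷ 2 ∷ 3 ∷ 4 ∷ [])
  ∷ identification 2 5 0 (0 ∷ 1 ∷ 2 ∷ 6 ∷ [])
  ∷ identification 2 6 0 (2 ∷ 3 ∷ 4 ∷ 5 ∷ [])
  ∷ identification 3 6 0 (0 ∷ 1 ∷ 2 ∷ 3 ∷ [])
  ∷ []

CoC₇-injective : checkInjective CoC₇-Ψ CoC₇ CoC₇-identifications 7 ≡ true
CoC₇-injective = refl

H₂-Ψ : List Config
H₂-Ψ = W₃ ∷ W₅ ∷ []

H₂-identifications : List Identification
H₂-identifications =
    identification 0 3 0 (0 ∷ 4 ∷ 5 ∷ 6 ∷ [])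
  ∷ identification 0 4 0 (0 ∷ 1 ∷ 2 ∷ 3 ∷ [])
  ∷ identification 1 4 0 (0 ∷ 1 ∷ 5 ∷ 6 ∷ [])
  ∷ identification 1 5 0 (1 ∷ 2 ∷ 3 ∷ 4 ∷ [])
  ∷ identification 1 6 0 (1 ∷ 2 ∷ 3 ∷ 4 ∷ [])
  ∷ identification 2 5 1 (0 ∷ 1 ∷ 3 ∷ 4 ∷ 6 ∷ 2 ∷ [])
  ∷ identification 2 6 0 (2 ∷ 3 ∷ 4 ∷ 5 ∷ [])
  ∷ identification 3 6 0 (0 ∷ 1 ∷ 2 ∷ 3 ∷ [])
  ∷ []

H₂-injective : checkInjective H₂-Ψ H₂ H₂-identifications 7 ≡ true
H₂-injective = refl

H₂⁺-Ψ : List Config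
H₂⁺-Ψ = W₃ ∷ W₅ ∷ []

H₂⁺-identifications : List Identification
H₂⁺-identifications =
    identification 0 3 0 (0 ∷ 4 ∷ 5 ∷ 6 ∷ [])
  ∷ identification 0 4 0 (0 ∷ 1 ∷ 2 ∷ 3 ∷ [])
  ∷ identification 1 4 0 (0 ∷ 1 ∷ 5 ∷ 6 ∷ [])
  ∷ identification 1 5 0 (0 ∷ 1 ∷ 2 ∷ 7 ∷ [])
  ∷ identification 1 6 0 (1 ∷ 2 ∷ 3 ∷ 4 ∷ [])
  ∷ identification 1 7 1 (0 ∷ 1 ∷ 3 ∷ 4 ∷ 6 ∷ 5 ∷ [])
  ∷ identification 2 5 1 (0 ∷ 1 ∷ 3 ∷ 4 ∷ 6 ∷ 2 ∷ [])
  ∷ identification 2 6 0 (0 ∷ 2 ∷ 5 ∷ 7 ∷ [])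
  ∷ identification 3 6 0 (0 ∷ 1 ∷ 2 ∷ 3 ∷ [])
  ∷ identification 3 7 0 (0 ∷ 1 ∷ 2 ∷ 3 ∷ [])
  ∷ identification 4 7 0 (0 ∷ 4 ∷ 5 ∷ 6 ∷ [])
  ∷ identification 6 7 1 (0 ∷ 1 ∷ 3 ∷ 4 ∷ 6 ∷ 2 ∷ [])
  ∷ []

H₂⁺-injective : checkInjective H₂⁺-Ψ H₂⁺ H₂⁺-identifications 8 ≡ true
H₂⁺-injective = refl

-- Identifying 2 with 4, or 3 with 5, creates H₂. So a homomorphic copy of T₀ is known to be an
-- embedded one only where H₂ is absent.
T₀-Ψ : List Config
T₀-Ψ = W₃ ∷ W₅ ∷ W₇ ∷ H₂ ∷ []

T₀-identifications : List Identification
T₀-identifications =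
    identification 0 2 1 (0 ∷ 3 ∷ 4 ∷ 5 ∷ 6 ∷ 7 ∷ [])
  ∷ identification 0 3 0 (0 ∷ 1 ∷ 2 ∷ 8 ∷ [])
  ∷ identification 0 4 0 (0 ∷ 5 ∷ 6 ∷ 7 ∷ [])
  ∷ identification 0 5 1 (0 ∷ 1 ∷ 2 ∷ 3 ∷ 4 ∷ 8 ∷ [])
  ∷ identification 1 3 1 (0 ∷ 1 ∷ 4 ∷ 5 ∷ 6 ∷ 7 ∷ [])
  ∷ identification 1 4 0 (1 ∷ 2 ∷ 3 ∷ 7 ∷ [])
  ∷ identification 1 5 0 (0 ∷ 1 ∷ 6 ∷ 7 ∷ [])
  ∷ identification 1 6 1 (1 ∷ 2 ∷ 3 ∷ 4 ∷ 5 ∷ 7 ∷ [])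
  ∷ identification 1 7 0 (0 ∷ 1 ∷ 8 ∷ 9 ∷ [])
  ∷ identification 1 9 2 (0 ∷ 1 ∷ 2 ∷ 3 ∷ 4 ∷ 5 ∷ 6 ∷ 7 ∷ [])
  ∷ identification 2 4 3 (0 ∷ 6 ∷ 7 ∷ 5 ∷ 2 ∷ 8 ∷ 1 ∷ [])
  ∷ identification 2 5 0 (2 ∷ 3 ∷ 4 ∷ 7 ∷ [])
  ∷ identification 2 6 0 (0 ∷ 1 ∷ 2 ∷ 8 ∷ [])
  ∷ identification 2 9 0 (0 ∷ 1 ∷ 2 ∷ 8 ∷ [])
  ∷ identification 3 5 3 (0 ∷ 6 ∷ 7 ∷ 3 ∷ 2 ∷ 8 ∷ 1 ∷ [])
  ∷ identification 3 6 0 (3 ∷ 4 ∷ 5 ∷ 7 ∷ [])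
  ∷ identification 3 9 1 (0 ∷ 3 ∷ 4 ∷ 5 ∷ 6 ∷ 7 ∷ [])
  ∷ identification 4 6 1 (0 ∷ 1 ∷ 2 ∷ 3 ∷ 4 ∷ 8 ∷ [])
  ∷ identification 4 9 1 (0 ∷ 1 ∷ 2 ∷ 3 ∷ 4 ∷ 8 ∷ [])
  ∷ identification 5 9 0 (0 ∷ 5 ∷ 6 ∷ 7 ∷ [])
  ∷ identification 6 8 0 (0 ∷ 6 ∷ 7 ∷ 9 ∷ [])
  ∷ identification 6 9 2 (0 ∷ 1 ∷ 2 ∷ 3 ∷ 4 ∷ 5 ∷ 6 ∷ 8 ∷ [])
  ∷ identification 7 8 2 (0 ∷ 1 ∷ 2 ∷ 3 ∷ 4 ∷ 5 ∷ 6 ∷ 7 ∷ [])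
  ∷ []

T₀-injective : checkInjective T₀-Ψ T₀ T₀-identifications 10 ≡ true
T₀-injective = refl

module Embedding {n : ℕ} (E : Fin n → Fin n → Bool) (E-symm : ∀ u v → E u v ≡ E v u)
                 (E-irrefl : ∀ u → E u u ≡ false) (M : Fin n → Bool) where
  open Realisation E E-symm M (λ _ → false)

  rename-≡ : ∀ p q (ρ : Env) → ρ p ≡ ρ q → ∀ i → ρ (rename p q i) ≡ ρ i
  rename-≡ p q ρ e i with i ≡ᵇ p in h
  ... | true  = trans (sym e) (cong ρ (sym (≡ᵇ-true i p h)))
  ... | false = refl

  identify-real : ∀ p q A ρ → ρ p ≡ ρ q → Realises A ρ → Realises (identify p q A) ρ
  identify-real p q A ρ e (rv , re) = rv , All.++⁺ re (All.++⁺ (renamed p q e) (renamed q p (sym e)))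
    where
    renamed : ∀ p q → ρ p ≡ ρ q → RealE (map (λ e → rename p q (proj₁ e) , rename p q (proj₂ e)) (Config.edges A)) ρ
    renamed p q e = All.map⁺ (All.map (λ {f} h → trans (cong₂ E (rename-≡ p q ρ e (proj₁ f)) (rename-≡ p q ρ e (proj₂ f))) h) re)

  identification-sound : ∀ Φ A p q ι ρ → All Absent Φ → Realises A ρ → checkIdentification Φ A p q ι ≡ true → ρ p ≢ ρ q
  identification-sound Φ A p q ι ρ abs r h e with Φ ‼ index-of ι in eq
  ... | just B = ‼-absent Φ (index-of ι) abs eq _
        (hom-sound B (hom ι) _ ρ (∧-snd {snd-vertex ι ≡ᵇ q} (∧-snd {fst-vertex ι ≡ᵇ p} h)) (identify-real p q A ρ e r))

  injective-sound : ∀ Φ A ιs k ρ → checkInjective Φ A ιs k ≡ true → All Absent Φ → Realises A ρ →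
                    ∀ p q → p < q → q < k → ρ p ≢ ρ q
  injective-sound Φ A ιs k ρ h abs r p q p<q q<k e
    with ∨-case (All.lookup (all-true _ (upTo q) (All.lookup (all-true _ (upTo k) h) (∈-upTo⁺ q<k))) (∈-upTo⁺ p<q))
  ... | inj₁ adj = true≢false (RealE-edge (Config.edges A) ρ p q adj (proj₂ r)) (trans (cong (E (ρ p)) (sym e)) (E-irrefl (ρ p)))
  ... | inj₂ idn = go ιs (any-true _ ιs idn)
    where go : ∀ ιs → Any (λ ι → checkIdentification Φ A p q ι ≡ true) ιs → ⊥
          go (ι ∷ ιs) (here c)  = identification-sound Φ A p q ι ρ abs r c e
          go (ι ∷ ιs) (there a) = go ιs a

-- Translation between the graph statements and configurations.

module Translate (G : Graph) where
  open Cliques (E G) (E-sym G) (E-irr G)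
  open Walks (E G) (E-sym G)
  open Colouring (E G) (E-sym G) (E-irr G)

  everything : Fin (size G) → Bool
  everything _ = true

  clique-lookup : ∀ K → Clique K → ∀ i j → i ≢ j → Adj G (lookup K i) (lookup K j)
  clique-lookup (v ∷ K) (jv , c) zero    zero    ne = ⊥-elim (ne refl)
  clique-lookup (v ∷ K) (jv , c) zero    (suc j) ne = All.lookup jv (∈-lookup j)
  clique-lookup (v ∷ K) (jv , c) (suc i) zero    ne = adj-sym (All.lookup jv (∈-lookup i))
  clique-lookup (v ∷ K) (jv , c) (suc i) (suc j) ne = clique-lookup K c i j (ne ∘ cong suc)

  adj-≢ : ∀ {u v} → Adj G u v → u ≢ v
  adj-≢ {u} h refl = true≢false h (E-irr G u)

  clique-injective : ∀ K → Clique K → Injective _≡_ _≡_ (lookup K)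
  clique-injective K c {i} {j} e with i Fin.≟ j
  ... | yes q = q
  ... | no ne = ⊥-elim (adj-≢ (clique-lookup K c i j ne) e)

  locBip : ∀ {a} → LocallyBipartite a G → LocBip a everything
  locBip lb K refl inU cl with lb (lookup K) (clique-injective K cl , clique-lookup K cl)
  ... | c , pr = toBool ∘ c , λ u v mu mv e q → pr u v (nb u mu) (nb v mv) e (toBool-inj (c u) (c v) q)
    where
    toBool : Fin 2 → Bool
    toBool zero       = false
    toBool (suc zero) = true
    toBool-inj : ∀ i j → toBool i ≡ toBool j → i ≡ j
    toBool-inj zero       zero       _ = refl
    toBool-inj (suc zero) (suc zero) _ = refl
    toBool-inj zero       (suc zero) ()
    toBool-inj (suc zero) zero       ()
    nb : ∀ u → common K u ≡ true → CommonNbr G (lookup K) u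
    nb u mu i = adj-sym (All.lookup (common-joined K u mu) (∈-lookup i))

  module Contained {k : ℕ} (es : List (ℕ × ℕ)) (A : Config) (flags-free : Config.flags A ≡ replicate k free)
    (edges-match : all (λ e → any (joins (proj₁ e) (proj₂ e)) (Config.edges A)) es ≡ true)
    (Φ : List Config) (ιs : List Identification) (inj : checkInjective Φ A ιs k ≡ true) where

    contains : ∀ C → Clique C → All (AbsentIn (nbhd everything C)) Φ → ∀ ρ →
               Realisation.Realises (E G) (E-sym G) (nbhd everything C) (λ _ → false) A ρ →
               Contains G (K (length C) ⊕ fromEdges k es)
    contains C cl abs ρ r@(rv , re) = f , (λ {x} {y} → f-inj x y) , f-hom
      where
      open Realisation (E G) (E-sym G) (nbhd everything C) (λ _ → false)
      g : Fin (length C) ⊎ Fin k → Fin (size G)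
      g (inj₁ i) = lookup C i
      g (inj₂ j) = ρ (toℕ j)
      f : Fin (length C + k) → Fin (size G)
      f x = g (splitAt (length C) x)
      re′ : RealE es ρ
      re′ = All.map (λ {e} q → RealE-edge (Config.edges A) ρ (proj₁ e) (proj₂ e) q re) (all-true _ es edges-match)
      joined : ∀ i (j : Fin k) → Adj G (lookup C i) (ρ (toℕ j))
      joined i j = adj-sym (All.lookup (common-joined C _ (realV-M _ _ _ ρ rv (toℕ j)
                     (subst (toℕ j <_) (sym (trans (cong length flags-free) (length-replicate k))) (Fin.toℕ<n j)))) (∈-lookup i))
      ρ-inj : ∀ (i j : Fin k) → ρ (toℕ i) ≡ ρ (toℕ j) → i ≡ j
      ρ-inj i j e with <-cmp (toℕ i) (toℕ j)
      ... | tri≈ _ q _ = Fin.toℕ-injective q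
      ... | tri< lt _ _ = ⊥-elim (Embedding.injective-sound (E G) (E-sym G) (E-irr G) _ Φ A ιs k ρ inj abs r _ _ lt (Fin.toℕ<n j) e)
      ... | tri> _ _ gt = ⊥-elim (Embedding.injective-sound (E G) (E-sym G) (E-irr G) _ Φ A ιs k ρ inj abs r _ _ gt (Fin.toℕ<n i) (sym e))
      g-inj : ∀ s t → g s ≡ g t → s ≡ t
      g-inj (inj₁ i) (inj₁ j) e = cong inj₁ (clique-injective C cl e)
      g-inj (inj₁ i) (inj₂ j) e = ⊥-elim (adj-≢ (joined i j) e)
      g-inj (inj₂ i) (inj₁ j) e = ⊥-elim (adj-≢ (joined j i) (sym e))
      g-inj (inj₂ i) (inj₂ j) e = cong inj₂ (ρ-inj i j e)
      f-inj : ∀ x y → f x ≡ f y → x ≡ y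
      f-inj x y e = trans (sym (Fin.join-splitAt (length C) k x))
        (trans (cong (Data.Fin.join (length C) k) (g-inj (splitAt (length C) x) (splitAt (length C) y) e)) (Fin.join-splitAt (length C) k y))
      f-hom : ∀ x y → Adj (K (length C) ⊕ fromEdges k es) x y → Adj G (f x) (f y)
      f-hom x y h with splitAt (length C) x | splitAt (length C) y
      ... | inj₁ i | inj₁ j = clique-lookup C cl i j λ e → true≢false h (trans (cong (λ q → not (toℕ i ≡ᵇ toℕ q)) (sym e)) (cong not (==-refl (toℕ i))))
      ... | inj₁ i | inj₂ j = joined i j
      ... | inj₂ i | inj₁ j = adj-sym (joined j i)
      ... | inj₂ i | inj₂ j = RealE-edge es ρ (toℕ i) (toℕ j) (∧-snd {not (toℕ i ≡ᵇ toℕ j)} h) re′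

    free-of : ∀ b → ¬ Contains G (K b ⊕ fromEdges k es) →
              (∀ C → length C ≡ b → Clique C → All (AbsentIn (nbhd everything C)) Φ) → FreeOf A (suc b) everything
    free-of b none abs C refl inU cl ρ r = none (contains C cl (abs C refl cl) ρ r)

anyVec? : ∀ {k n} {P : Vec.Vec (Fin n) k → Set} → (∀ v → Dec (P v)) → Dec (Σ (Vec.Vec (Fin n) k) P)
anyVec? {zero} P? = mapDec (λ p → Vec.[] , p) (λ { (Vec.[] , p) → p }) (P? Vec.[])
anyVec? {suc k} P? = mapDec (λ { (x , v , p) → x Vec.∷ v , p }) (λ { (x Vec.∷ v , p) → x , v , p })
                            (Fin.any? λ x → anyVec? λ v → P? (x Vec.∷ v))

-- Needed to decide constructively which alternative of (2)-(5) holds.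
contains? : ∀ G H → Dec (Contains G H)
contains? G H = mapDec to from (anyVec? λ v →
    (Fin.all? λ x → Fin.all? λ y → (Vec.lookup v x Fin.≟ Vec.lookup v y) →-dec (x Fin.≟ y)) ×-dec
    (Fin.all? λ x → Fin.all? λ y → (E H x y Bool.≟ true) →-dec (E G (Vec.lookup v x) (Vec.lookup v y) Bool.≟ true)))
  where
  Emb : Vec.Vec (Fin (size G)) (size H) → Set
  Emb v = (∀ x y → Vec.lookup v x ≡ Vec.lookup v y → x ≡ y) × (∀ x y → Adj H x y → Adj G (Vec.lookup v x) (Vec.lookup v y))
  to : Σ _ Emb → Contains G H
  to (v , i , h) = Vec.lookup v , (λ {x} {y} → i x y) , h
  from : Contains G H → Σ _ Emb
  from (f , i , h) = Vec.tabulate f ,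
    (λ x y e → i (trans (sym (Vec.lookup∘tabulate f x)) (trans e (Vec.lookup∘tabulate f y)))) ,
    (λ x y a → trans (cong₂ (E G) (Vec.lookup∘tabulate f x) (Vec.lookup∘tabulate f y)) (h x y a))

-- Degree conditions as inequalities between natural numbers

toℚᵘ-/ : ∀ p d → toℚᵘ ((ℤ.+ p) ℚ./ suc d) ℚᵘ.≃ mkℚᵘ (ℤ.+ p) d
toℚᵘ-/ p d = ℚ.toℚᵘ-fromℚᵘ (mkℚᵘ (ℤ.+ p) d)

lhsᵘ : ℕ → ℕ → ℕ → ℚᵘ
lhsᵘ p d n = (mkℚᵘ (ℤ.+ 1) 0 ℚᵘ.+ ℚᵘ.- mkℚᵘ (ℤ.+ p) d) ℚᵘ.* mkℚᵘ (ℤ.+ n) 0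

toℚᵘ-lhs : ∀ p d n → toℚᵘ ((1ℚ ℚ.- (ℤ.+ p) ℚ./ suc d) ℚ.* ℕ→ℚ n) ℚᵘ.≃ lhsᵘ p d n
toℚᵘ-lhs p d n = ℚᵘ.≃-trans (ℚ.toℚᵘ-homo-* (1ℚ ℚ.- x) (ℕ→ℚ n))
  (ℚᵘ.*-cong (ℚᵘ.≃-trans (ℚ.toℚᵘ-homo-+ 1ℚ (ℚ.- x)) (ℚᵘ.+-cong ℚᵘ.≃-refl (ℚᵘ.≃-trans (ℚ.toℚᵘ-homo‿- x) (ℚᵘ.-‿cong (toℚᵘ-/ p d)))))
             (toℚᵘ-/ n 0))
  where x = (ℤ.+ p) ℚ./ suc d

cross : ∀ p d n → ((ℤ.+ 1 ℤ.* ℤ.+ suc d ℤ.+ ℤ.- (ℤ.+ p) ℤ.* ℤ.+ 1) ℤ.* ℤ.+ n) ℤ.* ℤ.+ 1 ℤ.+ ℤ.+ (p * n) ≡ ℤ.+ (suc d * n)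
cross p d n = trans (cong (λ y → ((ℤ.+ 1 ℤ.* ℤ.+ suc d ℤ.+ ℤ.- (ℤ.+ p) ℤ.* ℤ.+ 1) ℤ.* ℤ.+ n) ℤ.* ℤ.+ 1 ℤ.+ y) (ℤ.pos-* p n))
              (trans (lemma (ℤ.+ p) (ℤ.+ suc d) (ℤ.+ n)) (sym (ℤ.pos-* (suc d) n)))
  where lemma : ∀ p d n → ((ℤ.+ 1 ℤ.* d ℤ.+ ℤ.- p ℤ.* ℤ.+ 1) ℤ.* n) ℤ.* ℤ.+ 1 ℤ.+ p ℤ.* n ≡ d ℤ.* n
        lemma = ℤRing.solve-∀

cross′ : ∀ p d n e → ℤ.+ e ℤ.* ℚᵘ.↧ (lhsᵘ p d n) ℤ.+ ℤ.+ (p * n) ≡ ℤ.+ (suc d * e + p * n)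
cross′ p d n e = cong (λ y → y ℤ.+ ℤ.+ (p * n)) (trans (sym (ℤ.pos-* e (suc (d + 0) * 1))) (cong ℤ.+_ (lemma d e)))
  where lemma : ∀ d e → e * (suc (d + 0) * 1) ≡ suc d * e
        lemma = solve-∀

-- With n - e non-neighbours this says (d + 1)(n - e) < pn, put without subtraction.
from-ℚ-< : ∀ p d n e → (1ℚ ℚ.- (ℤ.+ p) ℚ./ suc d) ℚ.* ℕ→ℚ n ℚ.< ℕ→ℚ e → suc d * n < suc d * e + p * n
from-ℚ-< p d n e h with ℚᵘ.<-respʳ-≃ (toℚᵘ-/ e 0) (ℚᵘ.<-respˡ-≃ (toℚᵘ-lhs p d n) (ℚ.toℚᵘ-mono-< h))
... | *<* lt = ℤ.drop‿+<+ (subst₂ ℤ._<_ (cross p d n) (cross′ p d n e) (ℤ.+-monoˡ-< (ℤ.+ (p * n)) lt))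

ℤ-cancelʳ-≤ : ∀ k i j → i ℤ.+ k ℤ.≤ j ℤ.+ k → i ℤ.≤ j
ℤ-cancelʳ-≤ k i j h = subst₂ ℤ._≤_ (lemma i k) (lemma j k) (ℤ.+-monoˡ-≤ (ℤ.- k) h)
  where lemma : ∀ i k → i ℤ.+ k ℤ.+ ℤ.- k ≡ i
        lemma = ℤRing.solve-∀

to-ℚ-≤ : ∀ p d n e → suc d * n ≤ suc d * e + p * n → (1ℚ ℚ.- (ℤ.+ p) ℚ./ suc d) ℚ.* ℕ→ℚ n ℚ.≤ ℕ→ℚ e
to-ℚ-≤ p d n e h = ℚ.toℚᵘ-cancel-≤ (ℚᵘ.≤-respʳ-≃ (ℚᵘ.≃-sym (toℚᵘ-/ e 0)) (ℚᵘ.≤-respˡ-≃ (ℚᵘ.≃-sym (toℚᵘ-lhs p d n))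
  (*≤* (ℤ-cancelʳ-≤ (ℤ.+ (p * n)) _ _ (subst₂ ℤ._≤_ (sym (cross p d n)) (sym (cross′ p d n e)) (ℤ.+≤+ h))))))

to-ℚ-≡ : ∀ p d n e → suc d * n ≡ suc d * e + p * n → ℕ→ℚ e ≡ (1ℚ ℚ.- (ℤ.+ p) ℚ./ suc d) ℚ.* ℕ→ℚ n
to-ℚ-≡ p d n e h = ℚ.≤-antisym (ℚ.toℚᵘ-cancel-≤ (ℚᵘ.≤-respˡ-≃ (ℚᵘ.≃-sym (toℚᵘ-/ e 0)) (ℚᵘ.≤-respʳ-≃ (ℚᵘ.≃-sym (toℚᵘ-lhs p d n))
    (*≤* (ℤ-cancelʳ-≤ (ℤ.+ (p * n)) _ _ (subst₂ ℤ._≤_ (sym (cross′ p d n e)) (sym (cross p d n)) (ℤ.+≤+ (≤-reflexive (sym h)))))))))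
  (to-ℚ-≤ p d n e (≤-reflexive h))

module Degrees (G : Graph) where
  open Weights (E G) (λ _ → true)

  deg+miss : ∀ v → deg G v + miss v ≡ size G
  deg+miss v = trans (cong (_+ miss v) (countF≡sumF (E G v))) (count-not (E G v))

  miss-bound : ∀ p d v → suc d * size G < suc d * deg G v + p * size G → suc d * miss v < p * size G
  miss-bound p d v h = +-cancelˡ-< (suc d * deg G v) _ _
    (≤-<-trans (≤-reflexive (trans (sym (*-distribˡ-+ (suc d) (deg G v) (miss v))) (cong (suc d *_) (deg+miss v)))) h)

largest : ∀ {n} (f : Fin (suc n) → ℕ) → Σ (Fin (suc n)) λ i → ∀ j → f j ≤ f i
largest {zero} f = zero , λ { zero → ≤-refl }
largest {suc n} f with largest (f ∘ suc)
... | i , h with f zero ≤? f (suc i)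
...   | yes le = suc i , λ { zero → le ; (suc j) → h j }
...   | no gt  = zero , λ { zero → ≤-refl ; (suc j) → ≤-trans (h j) (<⇒≤ (≰⇒> gt)) }

-- The condition reads (1 + 1/k + a)m < n, and 1 + 1/k decreases in k.
dense-weaken : ∀ k k′ a m n → 1 ≤ k → k ≤ k′ → (suc k + k * a) * m < k * n → (suc k′ + k′ * a) * m < k′ * n
dense-weaken k k′ a m n k≥1 le h = *-cancelˡ-< k _ _ (begin-strict
  k * ((suc k′ + k′ * a) * m) ≡⟨ sym (*-assoc k (suc k′ + k′ * a) m) ⟩
  k * (suc k′ + k′ * a) * m   ≤⟨ *-monoˡ-≤ m (≤-trans (≤-reflexive (lem₁ k k′ a)) (≤-trans (+-monoˡ-≤ (k * k′ + k * k′ * a) le) (≤-reflexive (lem₂ k k′ a)))) ⟩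
  k′ * (suc k + k * a) * m    ≡⟨ *-assoc k′ (suc k + k * a) m ⟩
  k′ * ((suc k + k * a) * m)  <⟨ *-monoʳ-< k′ ⦃ ℕ.>-nonZero (≤-trans k≥1 le) ⦄ h ⟩
  k′ * (k * n)                ≡⟨ lem₃ k k′ n ⟩
  k * (k′ * n)                ∎)
  where
  open ≤-Reasoning
  lem₁ : ∀ k k′ a → k * (suc k′ + k′ * a) ≡ k + (k * k′ + k * k′ * a)
  lem₁ = solve-∀
  lem₂ : ∀ k k′ a → k′ + (k * k′ + k * k′ * a) ≡ k′ * (suc k + k * a)
  lem₂ = solve-∀
  lem₃ : ∀ k k′ n → k′ * (k * n) ≡ k * (k′ * n)
  lem₃ = solve-∀

-- Parts (1)-(5): sufficiency

-- Written out so that `fromEdges` of each list is definitionally the graph of the statement.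
C7bar-edges H2-edges H2⁺-edges T0-edges : List (ℕ × ℕ)
C7bar-edges =
  (0 , 1) ∷ (1 , 2) ∷ (2 , 3) ∷ (3 , 4) ∷ (4 , 5) ∷ (5 , 6) ∷ (6 , 0)
  ∷ (0 , 2) ∷ (1 , 3) ∷ (2 , 4) ∷ (3 , 5) ∷ (4 , 6) ∷ (5 , 0) ∷ (6 , 1) ∷ []
H2-edges =
  (0 , 1) ∷ (1 , 2) ∷ (2 , 3) ∷ (3 , 4) ∷ (4 , 5) ∷ (5 , 6) ∷ (6 , 0)
  ∷ (0 , 2) ∷ (1 , 3) ∷ (2 , 4) ∷ (3 , 5) ∷ (4 , 6) ∷ (5 , 0) ∷ []
H2⁺-edges =
  (0 , 1) ∷ (1 , 2) ∷ (2 , 3) ∷ (3 , 4) ∷ (4 , 5) ∷ (5 , 6) ∷ (6 , 0)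
  ∷ (0 , 2) ∷ (1 , 3) ∷ (2 , 4) ∷ (3 , 5) ∷ (4 , 6) ∷ (5 , 0)
  ∷ (7 , 0) ∷ (7 , 2) ∷ (7 , 5) ∷ []
T0-edges =
  (0 , 1) ∷ (1 , 2) ∷ (2 , 3) ∷ (3 , 4) ∷ (4 , 5) ∷ (5 , 6) ∷ (6 , 0)
  ∷ (7 , 0) ∷ (7 , 2) ∷ (7 , 3) ∷ (7 , 4) ∷ (7 , 5) ∷ (7 , 6)
  ∷ (8 , 0) ∷ (8 , 1) ∷ (8 , 2) ∷ (8 , 3) ∷ (8 , 4) ∷ (8 , 5)
  ∷ (9 , 0) ∷ (9 , 7) ∷ (9 , 8) ∷ []

module Sufficiency (b : ℕ) (G : Graph) (lbG : LocallyBipartite (suc b) G) (m : ℕ)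
                   (bd : Weights.Bounded (E G) (λ _ → true) m) where
  open Cliques (E G) (E-sym G) (E-irr G)
  open Colouring (E G) (E-sym G) (E-irr G)
  open Translate G

  lb : LocBip (suc b) everything
  lb = locBip lbG

  -- (k+1 + k(b+1)) m < k n, i.e. the bound of thr (b+1) k
  Dense : ℕ → Set
  Dense k = (suc k + k * suc b) * m < k * size G

  insideAll : ∀ C → Inside everything C
  insideAll []      = []
  insideAll (x ∷ C) = refl ∷ insideAll C

  module At (C : List (Fin (size G))) (len : length C ≡ b) (cl : Clique C) where
    no-W₃ = absent-W₃ lb C (cong suc len) (insideAll C) cl (λ _ → false)
    no-W₅ = absent-W₅ lb C (cong suc len) (insideAll C) cl (λ _ → false)
    no-W₇ = absent-W₇ lb C (cong suc len) (insideAll C) cl (λ _ → false)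

  Free : Config → Set
  Free A = FreeOf A (suc b) everything

  -- Here a = b + 1 and k + 1 + k(b + 1) = kb + (2k + 1). The term kb is spent on the clique, and 2k
  -- + 1 is left for the certificate.
  engine : ∀ k → Dense k → ∀ Φ A χ → check k (suc (k + k)) Φ A χ ≡ true →
           (∀ C → length C ≡ b → Clique C → All (AbsentIn (nbhd everything C)) Φ) → Free A
  engine k dense Φ A χ chk abs C len inU cl =
    Plain.refute k (suc (k + k)) bd
      (subst₂ _<_ (cong (_* m) (lem k b)) (cong (k *_) (sym (count-true (size G)))) dense)
      lb C (suc-injective len) inU cl Φ A χ chk (abs C (suc-injective len) cl)
    where lem : ∀ k b → suc k + k * suc b ≡ k * b + suc (k + k)
          lem = solve-∀

  free-C7bar : Dense 3 → Free CoC₇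
  free-C7bar d = engine 3 d CoC₇-Φ CoC₇ CoC₇-certificate CoC₇-check
    λ C l cl → no-anyI (nbhd everything C) ∷ At.no-W₃ C l cl ∷ At.no-W₅ C l cl ∷ []

  free-H2⁺ : Dense 4 → Free H₂⁺
  free-H2⁺ d = engine 4 d H₂⁺-Φ H₂⁺ H₂⁺-certificate H₂⁺-check
    λ C l cl → no-anyI (nbhd everything C) ∷ At.no-W₃ C l cl ∷ At.no-W₅ C l cl ∷ []

  free-H2 : Dense 5 → Free CoC₇ → Free H₂⁺ → Free H₂
  free-H2 d f f⁺ = engine 5 d H₂-Φ H₂ H₂-certificate H₂-check
    λ C l cl → no-anyI (nbhd everything C) ∷ At.no-W₃ C l cl ∷ At.no-W₅ C l cl
             ∷ f C (cong suc l) (insideAll C) cl ∷ f⁺ C (cong suc l) (insideAll C) cl ∷ []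

  free-T0 : Dense 6 → Free H₂ → Free T₀
  free-T0 d f = engine 6 d T₀-Φ T₀ T₀-certificate T₀-check
    λ C l cl → no-anyI (nbhd everything C) ∷ At.no-W₃ C l cl ∷ At.no-W₅ C l cl ∷ At.no-W₇ C l cl
             ∷ f C (cong suc l) (insideAll C) cl ∷ []

  ¬C7bar⇒free : ¬ Contains G (K b ⊕ C7bar) → Free CoC₇
  ¬C7bar⇒free none = Contained.free-of C7bar-edges CoC₇ refl refl CoC₇-Ψ CoC₇-identifications CoC₇-injective b none
    λ C l cl → At.no-W₃ C l cl ∷ []

  ¬H2⇒free : ¬ Contains G (K b ⊕ H2) → Free H₂
  ¬H2⇒free none = Contained.free-of H2-edges H₂ refl refl H₂-Ψ H₂-identifications H₂-injective b none
    λ C l cl → At.no-W₃ C l cl ∷ At.no-W₅ C l cl ∷ []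

  ¬H2⁺⇒free : ¬ Contains G (K b ⊕ H2⁺) → Free H₂⁺
  ¬H2⁺⇒free none = Contained.free-of H2⁺-edges H₂⁺ refl refl H₂⁺-Ψ H₂⁺-identifications H₂⁺-injective b none
    λ C l cl → At.no-W₃ C l cl ∷ At.no-W₅ C l cl ∷ []

  ¬T0⇒free : ¬ Contains G (K b ⊕ T0) → Free H₂ → Free T₀
  ¬T0⇒free none f = Contained.free-of T0-edges T₀ refl refl T₀-Ψ T₀-identifications T₀-injective b none
    λ C l cl → At.no-W₃ C l cl ∷ At.no-W₅ C l cl ∷ At.no-W₇ C l cl ∷ f C (cong suc l) (insideAll C) cl ∷ []

  finish : Dense 7 → Free H₂ → Free T₀ → Colourable G (suc b + 2)
  finish d fH fT = proj₁ result , λ u v e → proj₂ result u v refl refl e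
    where
    lem : ∀ b → 8 + 7 * suc b ≡ 7 * suc b + 8
    lem = solve-∀
    result : Colourable-in (suc b + 2) everything
    result = colour (suc b) everything m
      (bd , subst₂ _<_ (cong (_* m) (lem b)) (cong (7 *_) (sym (count-true (size G)))) d , lb , fH , fT)

  weaken : ∀ k k′ → 1 ≤ k → k ≤ k′ → Dense k → Dense k′
  weaken k k′ = dense-weaken k k′ (suc b) m (size G)

  part₁ : Dense 3 → Colourable G (suc b + 2)
  part₁ d = finish (weaken 3 7 (s≤s z≤n) (m≤m+n 3 4) d) fH (free-T0 (weaken 3 6 (s≤s z≤n) (m≤m+n 3 3) d) fH)
    where fH = free-H2 (weaken 3 5 (s≤s z≤n) (m≤m+n 3 2) d) (free-C7bar d) (free-H2⁺ (weaken 3 4 (s≤s z≤n) (m≤m+n 3 1) d))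

  part₂ : Dense 4 → Colourable G (suc b + 2) ⊎ Contains G (K b ⊕ C7bar)
  part₂ d with contains? G (K b ⊕ C7bar)
  ... | yes c   = inj₂ c
  ... | no none = inj₁ (finish (weaken 4 7 (s≤s z≤n) (m≤m+n 4 3) d) fH (free-T0 (weaken 4 6 (s≤s z≤n) (m≤m+n 4 2) d) fH))
    where fH = free-H2 (weaken 4 5 (s≤s z≤n) (m≤m+n 4 1) d) (¬C7bar⇒free none) (free-H2⁺ d)

  part₃ : Dense 5 → Colourable G (suc b + 2) ⊎ (Contains G (K b ⊕ C7bar) ⊎ Contains G (K b ⊕ H2⁺))
  part₃ d with contains? G (K b ⊕ C7bar) | contains? G (K b ⊕ H2⁺)
  ... | yes c   | _        = inj₂ (inj₁ c)
  ... | no _    | yes c    = inj₂ (inj₂ c)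
  ... | no none | no none⁺ = inj₁ (finish (weaken 5 7 (s≤s z≤n) (m≤m+n 5 2) d) fH (free-T0 (weaken 5 6 (s≤s z≤n) (m≤m+n 5 1) d) fH))
    where fH = free-H2 d (¬C7bar⇒free none) (¬H2⁺⇒free none⁺)

  part₄ : Dense 6 → Colourable G (suc b + 2) ⊎ Contains G (K b ⊕ H2)
  part₄ d with contains? G (K b ⊕ H2)
  ... | yes c   = inj₂ c
  ... | no none = inj₁ (finish (weaken 6 7 (s≤s z≤n) (m≤m+n 6 1) d) (¬H2⇒free none) (free-T0 d (¬H2⇒free none)))

  part₅ : Dense 7 → Colourable G (suc b + 2) ⊎ (Contains G (K b ⊕ H2) ⊎ Contains G (K b ⊕ T0))
  part₅ d with contains? G (K b ⊕ H2) | contains? G (K b ⊕ T0)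
  ... | yes c   | _        = inj₂ (inj₁ c)
  ... | no _    | yes c    = inj₂ (inj₂ c)
  ... | no none | no none′ = inj₁ (finish d (¬H2⇒free none) (¬T0⇒free none′ (¬H2⇒free none)))

with-degree : ∀ b k G → MinDeg> G (thr (suc b) k) → {P : Set} → ((∀ k → Colourable G k) → P) →
              (∀ m → Weights.Bounded (E G) (λ _ → true) m → (suc k + k * suc b) * m < k * size G → P) → P
with-degree b k record { size = zero } h empty dense = empty (λ _ → (λ ()) , λ ())
with-degree b k G@record { size = suc n } h empty dense with largest (Weights.miss (E G) (λ _ → true))
... | v , mx = dense _ (λ u _ → mx u) (Degrees.miss-bound G k (k + k * suc b) v (from-ℚ-< k (k + k * suc b) (suc n) (deg G v) (h v)))

-- Homomorphisms and cones

Hom : Graph → Graph → Set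
Hom G H = Σ (Fin (size G) → Fin (size H)) λ f → ∀ u v → Adj G u v → Adj H (f u) (f v)

_∘h_ : ∀ {G H J} → Hom H J → Hom G H → Hom G J
(g , hg) ∘h (f , hf) = g ∘ f , λ u v e → hg (f u) (f v) (hf u v e)

adjacent-distinct : ∀ G {u v} → Adj G u v → u ≢ v
adjacent-distinct G {u} h refl = true≢false h (E-irr G u)

-- Cliques are mapped injectively because H has no loops, so the 2-colourings pull back.
locallyBipartite-pull : ∀ {G H} a → Hom G H → LocallyBipartite a H → LocallyBipartite a G
locallyBipartite-pull {G} {H} a (f , hf) lb S (inj , cl) with lb (f ∘ S) (inj′ , cl′)
  where
  cl′ : ∀ i j → i ≢ j → Adj H (f (S i)) (f (S j))
  cl′ i j ne = hf _ _ (cl i j ne)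
  inj′ : Injective _≡_ _≡_ (f ∘ S)
  inj′ {i} {j} e with i Fin.≟ j
  ... | yes q = q
  ... | no ne = ⊥-elim (adjacent-distinct H (cl′ i j ne) e)
... | c , pr = c ∘ f , λ u v hu hv e → pr (f u) (f v) (λ i → hf _ _ (hu i)) (λ i → hf _ _ (hv i)) (hf u v e)

colourable-pull : ∀ {G H k} → Hom G H → Colourable H k → Colourable G k
colourable-pull (f , hf) (c , pr) = c ∘ f , λ u v e → pr (f u) (f v) (hf u v e)

-- Local bipartiteness and colourability both pull back along homomorphisms. A join with a complete
-- multipartite graph, blown up or not, can therefore be replaced by an iterated cone, where one
-- vertex is added at a time.
cone : Graph → Graph
cone G = record { size = suc (size G) ; E = e ; E-sym = s ; E-irr = r }
  where
  e : Fin (suc (size G)) → Fin (suc (size G)) → Bool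
  e zero    zero    = false
  e zero    (suc v) = true
  e (suc u) zero    = true
  e (suc u) (suc v) = E G u v
  s : ∀ u v → e u v ≡ e v u
  s zero    zero    = refl
  s zero    (suc v) = refl
  s (suc u) zero    = refl
  s (suc u) (suc v) = E-sym G u v
  r : ∀ u → e u u ≡ false
  r zero    = refl
  r (suc u) = E-irr G u

colourable-cone : ∀ {G k} → Colourable (cone G) (suc k) → Colourable G k
colourable-cone {G} {k} (c , pr) =
  (λ v → punchOut (pr zero (suc v) refl)) ,
  λ u v e q → pr (suc u) (suc v) e (Fin.punchOut-injective (pr zero (suc u) refl) (pr zero (suc v) refl) q)

find-zero : ∀ {a n} (S : Fin a → Fin (suc n)) → (Σ (Fin a) λ i → S i ≡ zero) ⊎ (∀ i → S i ≢ zero)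
find-zero {zero} S = inj₂ λ ()
find-zero {suc a} S with S zero Fin.≟ zero
... | yes e = inj₁ (zero , e)
... | no ne with find-zero (S ∘ suc)
...   | inj₁ (i , e) = inj₁ (suc i , e)
...   | inj₂ h = inj₂ λ { zero → ne ; (suc i) → h i }

lower : ∀ {n} (x : Fin (suc n)) → x ≢ zero → Σ (Fin n) λ y → suc y ≡ x
lower zero    ne = ⊥-elim (ne refl)
lower (suc y) ne = y , refl

two-colours : ∀ (x y z : Fin 2) → x ≢ y → x ≢ z → y ≡ z
two-colours zero       zero       _          p q = ⊥-elim (p refl)
two-colours zero       (suc zero) zero       p q = ⊥-elim (q refl)
two-colours zero       (suc zero) (suc zero) p q = refl
two-colours (suc zero) (suc zero) _          p q = ⊥-elim (p refl)
two-colours (suc zero) zero       (suc zero) p q = ⊥-elim (q refl)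
two-colours (suc zero) zero       zero       p q = refl

-- A clique through the apex reduces to G; otherwise the common neighbourhood in G of an
-- (a+1)-clique of G is independent.
locallyBipartite-cone : ∀ {G} a → LocallyBipartite a G → LocallyBipartite (suc a) (cone G)
locallyBipartite-cone {G} a lb S (inj , cl) with find-zero S
... | inj₁ (i₀ , e₀) = c′ , pr′
  where
  away : ∀ i → Σ (Fin (size G)) λ y → suc y ≡ S (punchIn i₀ i)
  away i = lower (S (punchIn i₀ i)) λ e → Fin.punchInᵢ≢i i₀ i (inj (trans e (sym e₀)))
  S′ : Fin a → Fin (size G)
  S′ i = proj₁ (away i)
  cl′ : ∀ i j → i ≢ j → Adj G (S′ i) (S′ j)
  cl′ i j ne = subst₂ (Adj (cone G)) (sym (proj₂ (away i))) (sym (proj₂ (away j)))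
                      (cl (punchIn i₀ i) (punchIn i₀ j) λ e → ne (Fin.punchIn-injective i₀ i j e))
  inj′ : Injective _≡_ _≡_ S′
  inj′ {i} {j} e with i Fin.≟ j
  ... | yes q = q
  ... | no ne = ⊥-elim (adjacent-distinct G (cl′ i j ne) e)
  lb′ = lb S′ ((λ {i} {j} → inj′ {i} {j}) , cl′)
  c′ : Fin (suc (size G)) → Fin 2
  c′ zero    = zero
  c′ (suc u) = proj₁ lb′ u
  restrict-nbr : ∀ u → CommonNbr (cone G) S (suc u) → CommonNbr G S′ u
  restrict-nbr u h i = subst (λ x → Adj (cone G) x (suc u)) (sym (proj₂ (away i))) (h (punchIn i₀ i))
  pr′ : ∀ u v → CommonNbr (cone G) S u → CommonNbr (cone G) S v → Adj (cone G) u v → c′ u ≢ c′ v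
  pr′ zero v hu hv e = ⊥-elim (adjacent-distinct (cone G) (hu i₀) e₀)
  pr′ (suc u) zero hu hv e = ⊥-elim (adjacent-distinct (cone G) (hv i₀) e₀)
  pr′ (suc u) (suc v) hu hv e = proj₂ lb′ u v (restrict-nbr u hu) (restrict-nbr v hv) e
... | inj₂ h = c′ , pr′
  where
  away : ∀ i → Σ (Fin (size G)) λ y → suc y ≡ S i
  away i = lower (S i) (h i)
  T′ : Fin (suc a) → Fin (size G)
  T′ i = proj₁ (away i)
  adj : ∀ i j → i ≢ j → Adj G (T′ i) (T′ j)
  adj i j ne = subst₂ (Adj (cone G)) (sym (proj₂ (away i))) (sym (proj₂ (away j))) (cl i j ne)
  inj′ : Injective _≡_ _≡_ (T′ ∘ suc)
  inj′ {i} {j} e with i Fin.≟ j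
  ... | yes q = q
  ... | no ne = ⊥-elim (adjacent-distinct G (adj (suc i) (suc j) (ne ∘ Fin.suc-injective)) e)
  lb′ = lb (T′ ∘ suc) ((λ {i} {j} → inj′ {i} {j}) , λ i j ne → adj (suc i) (suc j) (ne ∘ Fin.suc-injective))
  c = proj₁ lb′
  nbr : ∀ u → CommonNbr (cone G) S (suc u) → CommonNbr G T′ u
  nbr u hu i = subst (λ x → Adj (cone G) x (suc u)) (sym (proj₂ (away i))) (hu i)
  first : ∀ u → CommonNbr (cone G) S (suc u) → c (T′ zero) ≢ c u
  first u hu = proj₂ lb′ (T′ zero) u (λ i → adj (suc i) zero λ ()) (nbr u hu ∘ suc) (nbr u hu zero)
  c′ : Fin (suc (size G)) → Fin 2
  c′ zero    = zero
  c′ (suc u) = suc zero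
  pr′ : ∀ u v → CommonNbr (cone G) S u → CommonNbr (cone G) S v → Adj (cone G) u v → c′ u ≢ c′ v
  pr′ zero (suc v) hu hv e ()
  pr′ (suc u) zero hu hv e ()
  pr′ (suc u) (suc v) hu hv e _ =
    proj₂ lb′ u v (nbr u hu ∘ suc) (nbr v hv ∘ suc) e (two-colours (c (T′ zero)) (c u) (c v) (first u hu) (first v hv))

cones : ℕ → Graph → Graph
cones zero    G = G
cones (suc m) G = cone (cones m G)

locallyBipartite-cones : ∀ m {G} a → LocallyBipartite a G → LocallyBipartite (m + a) (cones m G)
locallyBipartite-cones zero    a lb = lb
locallyBipartite-cones (suc m) a lb = locallyBipartite-cone (m + a) (locallyBipartite-cones m a lb)

colourable-cones : ∀ m {G k} → Colourable (cones m G) (m + k) → Colourable G k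
colourable-cones zero    c = c
colourable-cones (suc m) c = colourable-cones m (colourable-cone c)

place : ∀ m G → Fin m ⊎ Fin (size G) → Fin (size (cones m G))
place zero    G (inj₂ v)       = v
place (suc m) G (inj₁ zero)    = zero
place (suc m) G (inj₁ (suc i)) = suc (place m G (inj₁ i))
place (suc m) G (inj₂ v)       = suc (place m G (inj₂ v))

Joint : ∀ {m} G → Fin m ⊎ Fin (size G) → Fin m ⊎ Fin (size G) → Set
Joint G (inj₁ i) (inj₁ j) = i ≢ j
Joint G (inj₁ i) (inj₂ v) = ⊤
Joint G (inj₂ u) (inj₁ j) = ⊤
Joint G (inj₂ u) (inj₂ v) = Adj G u v

place-adj : ∀ m G s t → Joint G s t → Adj (cones m G) (place m G s) (place m G t)
place-adj zero    G (inj₂ u) (inj₂ v) h = h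
place-adj (suc m) G (inj₁ zero)    (inj₁ zero)    h = ⊥-elim (h refl)
place-adj (suc m) G (inj₁ zero)    (inj₁ (suc j)) h = refl
place-adj (suc m) G (inj₁ (suc i)) (inj₁ zero)    h = refl
place-adj (suc m) G (inj₁ (suc i)) (inj₁ (suc j)) h = place-adj m G (inj₁ i) (inj₁ j) (h ∘ cong suc)
place-adj (suc m) G (inj₁ zero)    (inj₂ v)       h = refl
place-adj (suc m) G (inj₁ (suc i)) (inj₂ v)       h = place-adj m G (inj₁ i) (inj₂ v) tt
place-adj (suc m) G (inj₂ u)       (inj₁ zero)    h = refl
place-adj (suc m) G (inj₂ u)       (inj₁ (suc j)) h = place-adj m G (inj₂ u) (inj₁ j) tt
place-adj (suc m) G (inj₂ u)       (inj₂ v)       h = place-adj m G (inj₂ u) (inj₂ v) h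

unplace : ∀ m G → Fin (size (cones m G)) → Fin m ⊎ Fin (size G)
unplace zero    G v       = inj₂ v
unplace (suc m) G zero    = inj₁ zero
unplace (suc m) G (suc x) with unplace m G x
... | inj₁ i = inj₁ (suc i)
... | inj₂ v = inj₂ v

unplace-joint : ∀ m G x y → Adj (cones m G) x y → Joint G (unplace m G x) (unplace m G y)
unplace-joint zero    G x y h = h
unplace-joint (suc m) G zero (suc y) h with unplace m G y
... | inj₁ j = λ ()
... | inj₂ v = tt
unplace-joint (suc m) G (suc x) zero h with unplace m G x
... | inj₁ i = λ ()
... | inj₂ u = tt
unplace-joint (suc m) G (suc x) (suc y) h with unplace m G x | unplace m G y | unplace-joint m G x y h
... | inj₁ i | inj₁ j | q = q ∘ Fin.suc-injective
... | inj₁ i | inj₂ v | q = tt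
... | inj₂ u | inj₁ j | q = tt
... | inj₂ u | inj₂ v | q = q

adj-K⇒≢ : ∀ m {i j : Fin m} → Adj (K m) i j → i ≢ j
adj-K⇒≢ m h = adjacent-distinct (K m) h

≢⇒adj-K : ∀ m {i j : Fin m} → i ≢ j → Adj (K m) i j
≢⇒adj-K m {i} {j} ne with toℕ i ≡ᵇ toℕ j in eq
... | false = refl
... | true  = ⊥-elim (ne (Fin.toℕ-injective (≡ᵇ-true _ _ eq)))

blowUp-hom : ∀ G t → Hom (blowUp G t) G
blowUp-hom G t = quotient t , λ u v e → e

join-hom : ∀ m s G → Hom (blowUp (K m) s ⊕ G) (cones m G)
join-hom m s G = (λ x → place m G (to (splitAt (m * s) x))) , λ x y e → place-adj m G _ _ (rel x y e)
  where
  to : Fin (m * s) ⊎ Fin (size G) → Fin m ⊎ Fin (size G)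
  to (inj₁ i) = inj₁ (quotient s i)
  to (inj₂ v) = inj₂ v
  rel : ∀ x y → Adj (blowUp (K m) s ⊕ G) x y → Joint G (to (splitAt (m * s) x)) (to (splitAt (m * s) y))
  rel x y e with splitAt (m * s) x | splitAt (m * s) y
  ... | inj₁ i | inj₁ j = adj-K⇒≢ m e
  ... | inj₁ i | inj₂ v = tt
  ... | inj₂ u | inj₁ j = tt
  ... | inj₂ u | inj₂ v = e

quotient-combine : ∀ {m t} (i : Fin m) (j : Fin t) → quotient t (combine i j) ≡ i
quotient-combine {m} {t} i j = cong proj₁ (Fin.remQuot-combine {m} {t} i j)

cones-hom : ∀ m s G → Hom (cones m G) (blowUp (K m) (suc s) ⊕ G)
cones-hom m s G = (λ x → Data.Fin.join (m * suc s) (size G) (back (unplace m G x))) , λ x y e → adj _ _ (unplace-joint m G x y e)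
  where
  back : Fin m ⊎ Fin (size G) → Fin (m * suc s) ⊎ Fin (size G)
  back (inj₁ i) = inj₁ (combine i zero)
  back (inj₂ v) = inj₂ v
  adj : ∀ p q → Joint G p q → Adj (blowUp (K m) (suc s) ⊕ G) (Data.Fin.join (m * suc s) (size G) (back p)) (Data.Fin.join (m * suc s) (size G) (back q))
  adj p q h rewrite Fin.splitAt-join (m * suc s) (size G) (back p) | Fin.splitAt-join (m * suc s) (size G) (back q) with p | q
  ... | inj₁ i | inj₁ j = ≢⇒adj-K m λ e → h (trans (sym (quotient-combine {m} {suc s} i zero)) (trans e (quotient-combine {m} {suc s} j zero)))
  ... | inj₁ i | inj₂ v = refl
  ... | inj₂ u | inj₁ j = refl
  ... | inj₂ u | inj₂ v = h

blow-hom : ∀ G t → Hom G (blowUp G (suc t))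
blow-hom G t = (λ x → combine x zero) , λ x y e →
  trans (cong₂ (E G) (quotient-combine {size G} {suc t} x zero) (quotient-combine {size G} {suc t} y zero)) e

degree : ∀ G → Fin (size G) → ℕ
degree G v = count (E G v)

degree-blowUp : ∀ G t x → degree (blowUp G t) x ≡ t * degree G (quotient t x)
degree-blowUp G t x = trans (sumF-combine (size G) t (λ y → ι (E G (quotient t x) (quotient t y))))
  (trans (sumF-cong inner) (sumF-*ˡ t (λ i → ι (E G (quotient t x) i))))
  where
  inner : ∀ i → sumF (λ j → ι (E G (quotient t x) (quotient t (combine {size G} {t} i j)))) ≡ t * ι (E G (quotient t x) i)
  inner i = trans (sumF-cong (λ j → cong (λ k → ι (E G (quotient t x) k)) (quotient-combine {size G} {t} i j))) (sumF-const t _)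

joinDegree : ∀ A B → Fin (size A) ⊎ Fin (size B) → ℕ
joinDegree A B (inj₁ i) = degree A i + size B
joinDegree A B (inj₂ j) = size A + degree B j

degree-⊕ : ∀ A B x → degree (A ⊕ B) x ≡ joinDegree A B (splitAt (size A) x)
degree-⊕ A B x = trans (sumF-↑ (size A) (λ y → ι (E (A ⊕ B) x y)))
  (trans (cong₂ _+_ (sumF-cong left) (sumF-cong right)) (total (splitAt (size A) x)))
  where
  leftE : Fin (size A) ⊎ Fin (size B) → Fin (size A) → Bool
  leftE (inj₁ i) k = E A i k
  leftE (inj₂ j) k = true
  rightE : Fin (size A) ⊎ Fin (size B) → Fin (size B) → Bool
  rightE (inj₁ i) k = true
  rightE (inj₂ j) k = E B j k
  left : ∀ k → ι (E (A ⊕ B) x (k ↑ˡ size B)) ≡ ι (leftE (splitAt (size A) x) k)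
  left k rewrite Fin.splitAt-↑ˡ (size A) k (size B) with splitAt (size A) x
  ... | inj₁ i = refl
  ... | inj₂ j = refl
  right : ∀ k → ι (E (A ⊕ B) x (size A ↑ʳ k)) ≡ ι (rightE (splitAt (size A) x) k)
  right k rewrite Fin.splitAt-↑ʳ (size A) (size B) k with splitAt (size A) x
  ... | inj₁ i = refl
  ... | inj₂ j = refl
  total : ∀ s → count (leftE s) + count (rightE s) ≡ joinDegree A B s
  total (inj₁ i) = cong (degree A i +_) (count-true (size B))
  total (inj₂ j) = cong (_+ degree B j) (count-true (size A))

count-≡ᵇ : ∀ {m} (i : Fin m) → count {m} (λ j → toℕ i ≡ᵇ toℕ j) ≡ 1
count-≡ᵇ {suc m} zero    = cong suc (sumF-zero {m} (λ _ → 0) (λ _ → refl))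
count-≡ᵇ {suc m} (suc i) = count-≡ᵇ i

degree-K : ∀ m i → degree (K m) i + 1 ≡ m
degree-K m i = trans (+-comm (degree (K m) i) 1) (trans (cong (_+ degree (K m) i) (sym (count-≡ᵇ i))) (count-not (λ j → toℕ i ≡ᵇ toℕ j)))

-- Part (1): tightness

-- The neighbours of v have offsets 5, 6, 1, 2 and induce a path in this order, coloured
-- alternately.
C7bar-colour : Fin 7 → Fin 7 → Fin 2
C7bar-colour v u = side ((toℕ u + (7 ∸ toℕ v)) ℕ.% 7)
  where
  side : ℕ → Fin 2
  side 1 = zero
  side 5 = zero
  side _ = suc zero

C7bar-local : ∀ v u w → Adj C7bar v u → Adj C7bar v w → Adj C7bar u w → C7bar-colour v u ≢ C7bar-colour v w
C7bar-local = toWitness {a? = Fin.all? λ v → Fin.all? λ u → Fin.all? λ w →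
  (E C7bar v u Bool.≟ true) →-dec ((E C7bar v w Bool.≟ true) →-dec ((E C7bar u w Bool.≟ true) →-dec ¬? (C7bar-colour v u Fin.≟ C7bar-colour v w)))} tt

C7bar-locallyBipartite : LocallyBipartite 1 C7bar
C7bar-locallyBipartite S _ = C7bar-colour (S zero) , λ u v hu hv e → C7bar-local (S zero) u v (hu zero) (hv zero) e

third-colour : ∀ (a b x y : Fin 3) → a ≢ b → x ≢ a → x ≢ b → y ≢ a → y ≢ b → x ≡ y
third-colour = toWitness {a? = Fin.all? λ a → Fin.all? λ b → Fin.all? λ x → Fin.all? λ y →
  ¬? (a Fin.≟ b) →-dec (¬? (x Fin.≟ a) →-dec (¬? (x Fin.≟ b) →-dec (¬? (y Fin.≟ a) →-dec (¬? (y Fin.≟ b) →-dec (x Fin.≟ y)))))} tt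

-- Triangles sharing an edge force v₀, v₃ and v₆ to have the same colour, but v₆ and v₀ are
-- adjacent.
C7bar-not-3-colourable : ¬ Colourable C7bar 3
C7bar-not-3-colourable (c , pr) = pr v₆ v₀ refl (trans (sym eq₂) (sym eq₁))
  where
  v₀ v₁ v₂ v₃ v₄ v₅ v₆ : Fin 7
  v₀ = zero
  v₁ = suc zero
  v₂ = suc (suc zero)
  v₃ = suc (suc (suc zero))
  v₄ = suc (suc (suc (suc zero)))
  v₅ = suc (suc (suc (suc (suc zero))))
  v₆ = suc (suc (suc (suc (suc (suc zero)))))
  eq₁ : c v₀ ≡ c v₃
  eq₁ = third-colour (c v₁) (c v₂) (c v₀) (c v₃) (pr v₁ v₂ refl) (pr v₀ v₁ refl) (pr v₀ v₂ refl) (pr v₃ v₁ refl) (pr v₃ v₂ refl)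
  eq₂ : c v₃ ≡ c v₆
  eq₂ = third-colour (c v₄) (c v₅) (c v₃) (c v₆) (pr v₄ v₅ refl) (pr v₃ v₄ refl) (pr v₃ v₅ refl) (pr v₆ v₄ refl) (pr v₆ v₅ refl)

degree-C7bar : ∀ v → degree C7bar v ≡ 4
degree-C7bar = toWitness {a? = Fin.all? λ v → degree C7bar v ℕ.≟ 4} tt

module Tight (b t : ℕ) where
  G₀ G : Graph
  G₀ = K3 b ⊕ C7bar
  G = blowUp G₀ (suc t)

  locallyBipartite : LocallyBipartite (suc b) G
  locallyBipartite = subst (λ a → LocallyBipartite a G) (+-comm b 1)
    (locallyBipartite-pull {G} {cones b C7bar} (b + 1) (_∘h_ {G} {G₀} {cones b C7bar} (join-hom b 3 C7bar) (blowUp-hom G₀ (suc t)))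
      (locallyBipartite-cones b 1 C7bar-locallyBipartite))

  not-colourable : ¬ Colourable G (suc b + 2)
  not-colourable c = C7bar-not-3-colourable (colourable-cones b
    (colourable-pull {cones b C7bar} {G} (_∘h_ {cones b C7bar} {G₀} {G} (blow-hom G₀ t) (cones-hom b 2 C7bar))
      (subst (Colourable G) (sym (+-suc b 2)) c)))

  -- Every vertex misses exactly three: its own part, or itself and its two non-neighbours in C7bar.
  -- The parts have size 3 to match.
  degree₀ : ∀ x → degree G₀ x + 3 ≡ size G₀
  degree₀ x = trans (cong (_+ 3) (degree-⊕ (K3 b) C7bar x)) (go (splitAt (b * 3) x))
    where
    go : ∀ s → joinDegree (K3 b) C7bar s + 3 ≡ b * 3 + 7
    go (inj₁ i) = trans (cong (λ d → d + 7 + 3) (degree-blowUp (K b) 3 i))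
      (trans (lem (degree (K b) (quotient 3 i))) (cong (λ q → q * 3 + 7) (degree-K b (quotient 3 i))))
      where lem : ∀ d → 3 * d + 7 + 3 ≡ (d + 1) * 3 + 7
            lem = solve-∀
    go (inj₂ j) = trans (cong (λ d → b * 3 + d + 3) (degree-C7bar j)) (+-assoc (b * 3) 4 3)

  degree-eq : ∀ x → suc (3 + 3 * suc b) * size G ≡ suc (3 + 3 * suc b) * deg G x + 3 * size G
  degree-eq x = trans (cong (suc (3 + 3 * suc b) *_) size-eq)
    (lem b (suc t) (deg G x))
    where
    d₀ = degree G₀ (quotient (suc t) x)
    deg-eq : deg G x ≡ suc t * d₀
    deg-eq = trans (countF≡sumF (E G x)) (degree-blowUp G₀ (suc t) x)
    size-eq : size G ≡ deg G x + 3 * suc t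
    size-eq = trans (cong (_* suc t) (sym (degree₀ (quotient (suc t) x)))) (trans (lem₂ d₀ (suc t)) (cong (_+ 3 * suc t) (sym deg-eq)))
      where lem₂ : ∀ d t → (d + 3) * t ≡ t * d + 3 * t
            lem₂ = solve-∀
    lem : ∀ b t d → suc (3 + 3 * suc b) * (d + 3 * t) ≡ suc (3 + 3 * suc b) * d + 3 * ((b * 3 + 7) * t)
    lem = solve-∀

  minDegree : MinDeg≡ G (thr (suc b) 3)
  minDegree = (λ v → to-ℚ-≤ 3 (3 + 3 * suc b) (size G) (deg G v) (≤-reflexive (degree-eq v))) ,
              v₀ , to-ℚ-≡ 3 (3 + 3 * suc b) (size G) (deg G v₀) (degree-eq v₀)
    where
    v₀ : Fin (size G)
    v₀ = combine (b * 3 ↑ʳ zero) zero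

-- Part (6): bounded chromatic number

⌊_≟ᶠ_⌋ : ∀ {p} → Fin p → Fin p → Bool
⌊ i ≟ᶠ j ⌋ = toℕ i ≡ᵇ toℕ j

≟ᶠ-true : ∀ {p} (i j : Fin p) → ⌊ i ≟ᶠ j ⌋ ≡ true → i ≡ j
≟ᶠ-true i j h = Fin.toℕ-injective (≡ᵇ-true _ _ h)

≟ᶠ-refl : ∀ {p} (i : Fin p) → ⌊ i ≟ᶠ i ⌋ ≡ true
≟ᶠ-refl i = ==-refl (toℕ i)

someF : ∀ {n} → (Fin n → Bool) → Bool
someF {zero}  f = false
someF {suc n} f = f zero ∨ someF (f ∘ suc)

someF-intro : ∀ {n} (f : Fin n → Bool) i → f i ≡ true → someF f ≡ true
someF-intro f zero    h = cong (_∨ someF (f ∘ suc)) h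
someF-intro f (suc i) h = trans (cong (f zero ∨_) (someF-intro (f ∘ suc) i h)) (∨-t (f zero))
  where ∨-t : ∀ b → b ∨ true ≡ true
        ∨-t false = refl
        ∨-t true  = refl

someF-elim : ∀ {n} (f : Fin n → Bool) → someF f ≡ true → Σ (Fin n) λ i → f i ≡ true
someF-elim {suc n} f h with ∨-case {f zero} h
... | inj₁ q = zero , q
... | inj₂ q = let (i , r) = someF-elim (f ∘ suc) q in suc i , r

by-parts : ∀ {n p} (P : Fin n → Fin p) (φ : Fin n → ℕ) →
           sumF φ ≡ sumF (λ j → sumF (λ x → ι ⌊ P x ≟ᶠ j ⌋ * φ x))
by-parts P φ = sym (trans (sumF-swap (λ j x → ι ⌊ P x ≟ᶠ j ⌋ * φ x)) (sumF-cong λ x →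
  trans (sumF-cong (λ j → *-comm (ι ⌊ P x ≟ᶠ j ⌋) (φ x))) (trans (sumF-*ˡ (φ x) (λ j → ι ⌊ P x ≟ᶠ j ⌋))
    (trans (cong (φ x *_) (count-≡ᵇ (P x))) (*-identityʳ (φ x))))))

parts-mono : ∀ {n p} (P : Fin n → Fin p) (φ ψ : Fin n → ℕ) →
             (∀ j → sumF (λ x → ι ⌊ P x ≟ᶠ j ⌋ * φ x) ≤ sumF (λ x → ι ⌊ P x ≟ᶠ j ⌋ * ψ x)) → sumF φ ≤ sumF ψ
parts-mono P φ ψ h = ≤-trans (≤-reflexive (by-parts P φ)) (≤-trans (sumF-mono h) (≤-reflexive (sym (by-parts P ψ))))

part-cong : ∀ {n p} (P : Fin n → Fin p) j (φ ψ : Fin n → ℕ) → (∀ x → P x ≡ j → φ x ≡ ψ x) →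
            sumF (λ x → ι ⌊ P x ≟ᶠ j ⌋ * φ x) ≡ sumF (λ x → ι ⌊ P x ≟ᶠ j ⌋ * ψ x)
part-cong P j φ ψ h = sumF-cong pt
  where pt : ∀ x → ι ⌊ P x ≟ᶠ j ⌋ * φ x ≡ ι ⌊ P x ≟ᶠ j ⌋ * ψ x
        pt x with ⌊ P x ≟ᶠ j ⌋ in eq
        ... | false = refl
        ... | true  = cong (_+ 0) (h x (≟ᶠ-true (P x) j eq))

sumT : ∀ {n} → ℕ → (List (Fin n) → ℕ) → ℕ
sumT zero    f = f []
sumT (suc i) f = sumF (λ z → sumT i (λ C → f (z ∷ C)))

sumT-mono : ∀ {n} i (f g : List (Fin n) → ℕ) → (∀ C → length C ≡ i → f C ≤ g C) → sumT i f ≤ sumT i g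
sumT-mono zero    f g h = h [] refl
sumT-mono (suc i) f g h = sumF-mono (λ z → sumT-mono i _ _ (λ C e → h (z ∷ C) (cong suc e)))

sumT-+ : ∀ {n} i (f g : List (Fin n) → ℕ) → sumT i (λ C → f C + g C) ≡ sumT i f + sumT i g
sumT-+ zero    f g = refl
sumT-+ {n} (suc i) f g = trans (sumF-cong (λ z → sumT-+ i (f ∘ (z ∷_)) (g ∘ (z ∷_)))) (sumF-+ {n} _ _)

sumT-* : ∀ {n} i c (f : List (Fin n) → ℕ) → sumT i (λ C → c * f C) ≡ c * sumT i f
sumT-* zero    c f = refl
sumT-* {n} (suc i) c f = trans (sumF-cong (λ z → sumT-* i c (f ∘ (z ∷_)))) (sumF-*ˡ {n} c _)

sumT-const : ∀ {n} i c → sumT {n} i (λ _ → c) ≡ n ^ i * c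
sumT-const zero    c = sym (+-identityʳ c)
sumT-const {n} (suc i) c = trans (sumF-cong {n} (λ _ → sumT-const i c)) (trans (sumF-const n _) (sym (*-assoc n (n ^ i) c)))

bit : Bool → Fin 2
bit false = zero
bit true  = suc zero

bit-injective : ∀ b c → bit b ≡ bit c → b ≡ c
bit-injective false false h = refl
bit-injective true  true  h = refl

-- With this Q each refinement lowers the potential by at least n^(a+1)/Q: a proportion 1/q^a of the
-- a-tuples lose at least n/(4q²) each.
increments : ℕ → ℕ → ℕ
increments a q = 2 * q * (2 * q) * q ^ a

-- A palette independent of when the refinement stops: a block of 2^p sets of parts for the present
-- round, then the blocks of later rounds, each with four times as many parts.
colours : ℕ → ℕ → ℕ
colours zero    p = 0
colours (suc r) p = 2 ^ p + colours r (p * 4)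

-- The density hypothesis amounts to this: any a + 1 vertices have at least n/q common neighbours.
module Bounded-χ {n : ℕ} (E : Fin n → Fin n → Bool) (E-symm : ∀ u v → E u v ≡ E v u)
                 (E-irrefl : ∀ u → E u u ≡ false) (a q m : ℕ)
                 (bd : Weights.Bounded E (λ _ → true) m) (dense : q * (suc a * m) + n ≤ q * n)
                 (lb : Colouring.LocBip E E-symm E-irrefl a (λ _ → true)) where
  open Cliques E E-symm E-irrefl
  open Walks E E-symm
  open Dense (λ _ → true) m bd

  joined? : ∀ v K → Dec (Joined v K)
  joined? v = All.all? (λ w → E v w Bool.≟ true)

  clique? : ∀ K → Dec (Clique K)
  clique? []      = yes tt
  clique? (v ∷ K) = joined? v K ×-dec clique? K

  all-inside : ∀ K → Inside (λ _ → true) K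
  all-inside []      = []
  all-inside (x ∷ K) = refl ∷ all-inside K

  common-size : ∀ K → n ≤ length K * m + count (common K)
  common-size K = ≤-trans (≤-reflexive (sym (count-true n))) (nbhd-size K (all-inside K))

  -- The constant default lets the potential be summed over all a-tuples. For those that are not
  -- cliques it is enough that refinement does not increase the support.
  side : List (Fin n) → Fin n → Bool
  side K with length K ℕ.≟ a | clique? K
  ... | yes l | yes c = proj₁ (lb K l (all-inside K) c)
  ... | _     | _     = λ _ → false

  side-proper : ∀ K → length K ≡ a → Clique K → Proper (common K) (side K)
  side-proper K l c with length K ℕ.≟ a | clique? K
  ... | yes l′ | yes c′ = proj₂ (lb K l′ (all-inside K) c′)
  ... | no ne  | _      = ⊥-elim (ne l)
  ... | yes _  | no nc  = ⊥-elim (nc c)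

  _≡ᴮ_ : Bool → Bool → Bool
  b ≡ᴮ c = not (b xor c)

  ≡ᴮ-true : ∀ b c → b ≡ᴮ c ≡ true → b ≡ c
  ≡ᴮ-true false false h = refl
  ≡ᴮ-true true  true  h = refl

  ≡ᴮ-refl : ∀ b → b ≡ᴮ b ≡ true
  ≡ᴮ-refl false = refl
  ≡ᴮ-refl true  = refl

  Side : List (Fin n) → Bool → Fin n → Bool
  Side K τ x = common K x ∧ (side K x ≡ᴮ τ)

  module _ {p : ℕ} (P : Fin n → Fin p) where

    Hit : (Fin n → Bool) → Fin p → Bool
    Hit B j = someF (λ y → ⌊ P y ≟ᶠ j ⌋ ∧ B y)

    support : (Fin n → Bool) → ℕ
    support B = count (λ x → Hit B (P x))

    -- The potential of the refinement argument: it starts at no more than 2n^(a+1), hence the bound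
    -- 2Q on the number of refinements.
    Φ : ℕ
    Φ = sumT a (λ K → support (Side K true) + support (Side K false))

    partSize : Fin p → ℕ
    partSize j = sumF (λ x → ι ⌊ P x ≟ᶠ j ⌋ * 1)

    partDegree : Fin n → Fin p → ℕ
    partDegree u j = sumF (λ x → ι ⌊ P x ≟ᶠ j ⌋ * ι (E u x))

    -- The proportion 1/(2q) is half of the guaranteed density 1/q of common neighbourhoods, so
    -- unpopular parts can hold at most half of that guarantee.
    popular : Fin n → Fin p → Bool
    popular u j = partSize j ≤ᵇ (2 * q) * partDegree u j

    Φ≤ : Φ ≤ 2 * n ^ suc a
    Φ≤ = ≤-trans (sumT-mono a _ (λ _ → 2 * n) (λ K _ → ≤-trans (+-mono-≤ {support (Side K true)} {n} {support (Side K false)} {n} (count≤n (λ x → Hit (Side K true) (P x))) (count≤n (λ x → Hit (Side K false) (P x))))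
                   (≤-reflexive (cong (n +_) (sym (+-identityʳ n))))))
                 (≤-reflexive (trans (sumT-const a (2 * n)) (lemma n (n ^ a))))
      where lemma : ∀ n x → x * (2 * n) ≡ 2 * (n * x)
            lemma = solve-∀

    popular-count : ∀ u (h : Fin p → Bool) →
                    count (λ x → h (P x) ∧ popular u (P x)) ≤ (2 * q) * count (λ y → h (P y) ∧ E u y)
    popular-count u h = ≤-trans (parts-mono P (λ x → ι (h (P x) ∧ popular u (P x))) (λ y → 2 * q * ι (h (P y) ∧ E u y)) pt)
                                (≤-reflexive (sumF-*ˡ (2 * q) (λ y → ι (h (P y) ∧ E u y))))
      where
      pt : ∀ j → sumF (λ x → ι ⌊ P x ≟ᶠ j ⌋ * ι (h (P x) ∧ popular u (P x)))
               ≤ sumF (λ x → ι ⌊ P x ≟ᶠ j ⌋ * (2 * q * ι (h (P x) ∧ E u x)))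
      pt j = ≤-trans (≤-reflexive (part-cong P j _ (λ _ → ι (h j ∧ popular u j)) (λ x e → cong (λ i → ι (h i ∧ popular u i)) e)))
             (≤-trans (go (h j) refl (popular u j) refl)
               (≤-reflexive (sym (part-cong P j _ (λ x → 2 * q * ι (h j ∧ E u x)) (λ x e → cong (λ i → 2 * q * ι (h i ∧ E u x)) e)))))
        where
        go : ∀ b → h j ≡ b → ∀ c → popular u j ≡ c →
             sumF (λ x → ι ⌊ P x ≟ᶠ j ⌋ * ι (b ∧ c)) ≤ sumF (λ x → ι ⌊ P x ≟ᶠ j ⌋ * (2 * q * ι (b ∧ E u x)))
        go false _ c _ = ≤-trans (≤-reflexive (sumF-zero _ (λ x → *-zeroʳ (ι ⌊ P x ≟ᶠ j ⌋)))) z≤n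
        go true _ false _ = ≤-trans (≤-reflexive (sumF-zero _ (λ x → *-zeroʳ (ι ⌊ P x ≟ᶠ j ⌋)))) z≤n
        go true _ true e = ≤-trans (≤ᵇ-true (partSize j) _ e) (≤-reflexive (trans (sym (sumF-*ˡ (2 * q) (λ x → ι ⌊ P x ≟ᶠ j ⌋ * ι (E u x))))
          (sumF-cong (λ x → lemma (ι ⌊ P x ≟ᶠ j ⌋) (2 * q) (ι (E u x))))))
          where lemma : ∀ a b c → b * (a * c) ≡ a * (b * c)
                lemma = solve-∀

    unpopular-count : ∀ u → (2 * q) * count (λ x → E u x ∧ not (popular u (P x))) ≤ n
    unpopular-count u = ≤-trans (≤-reflexive (sym (sumF-*ˡ (2 * q) (λ x → ι (E u x ∧ not (popular u (P x)))))))
      (≤-trans (parts-mono P (λ x → 2 * q * ι (E u x ∧ not (popular u (P x)))) (λ _ → 1) pt) (≤-reflexive (count-true n)))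
      where
      pt : ∀ j → sumF (λ x → ι ⌊ P x ≟ᶠ j ⌋ * (2 * q * ι (E u x ∧ not (popular u (P x))))) ≤ partSize j
      pt j = ≤-trans (≤-reflexive (part-cong P j _ (λ x → 2 * q * ι (E u x ∧ not (popular u j))) (λ x e → cong (λ i → 2 * q * ι (E u x ∧ not (popular u i))) e)))
                     (go (popular u j) refl)
        where
        go : ∀ b → popular u j ≡ b → sumF (λ x → ι ⌊ P x ≟ᶠ j ⌋ * (2 * q * ι (E u x ∧ not b))) ≤ partSize j
        go true  _ = ≤-trans (≤-reflexive (sumF-zero _ (λ x → trans (cong (λ y → ι ⌊ P x ≟ᶠ j ⌋ * (2 * q * ι y)) (Bool.∧-zeroʳ (E u x)))
                       (trans (cong (ι ⌊ P x ≟ᶠ j ⌋ *_) (*-zeroʳ (2 * q))) (*-zeroʳ (ι ⌊ P x ≟ᶠ j ⌋)))))) z≤n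
        go false e = ≤-trans (≤-reflexive (trans (sumF-cong (λ x → trans (cong (λ y → ι ⌊ P x ≟ᶠ j ⌋ * (2 * q * ι y)) (Bool.∧-identityʳ (E u x)))
                       (lemma (ι ⌊ P x ≟ᶠ j ⌋) (2 * q) (ι (E u x))))) (sumF-*ˡ (2 * q) (λ x → ι ⌊ P x ≟ᶠ j ⌋ * ι (E u x)))))
                     (≤ᵇ-false _ _ e)
          where
          lemma : ∀ a b c → a * (b * c) ≡ b * (a * c)
          lemma = solve-∀
          ≤ᵇ-false : ∀ x y → (x ≤ᵇ y) ≡ false → y ≤ x
          ≤ᵇ-false x y h = ≰⇒≥ λ le → subst T h (≤⇒≤ᵇ le)

    -- Of the at least n/q common neighbours of u and K, at most n/(2q) lie in parts unpopular for
    -- u.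
    popular-common : ∀ u K → length K ≡ a → n ≤ 2 * q * count (λ x → common K x ∧ popular u (P x))
    popular-common u K l = +-cancelˡ-≤ (2 * q * (suc a * m) + n) _ _ (begin
        2 * q * (suc a * m) + n + n ≡⟨ lem₁ q (suc a * m) n ⟩
        2 * (q * (suc a * m) + n) ≤⟨ *-monoʳ-≤ 2 dense ⟩
        2 * (q * n) ≡⟨ sym (*-assoc 2 q n) ⟩
        2 * q * n ≤⟨ *-monoʳ-≤ (2 * q) cover-n ⟩
        2 * q * (suc a * m + (unpop + g)) ≡⟨ lem₂ (2 * q) (suc a * m) unpop g ⟩
        2 * q * (suc a * m) + (2 * q * unpop + 2 * q * g) ≤⟨ +-monoʳ-≤ (2 * q * (suc a * m)) (+-monoˡ-≤ (2 * q * g) (unpopular-count u)) ⟩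
        2 * q * (suc a * m) + (n + 2 * q * g) ≡⟨ sym (+-assoc (2 * q * (suc a * m)) n (2 * q * g)) ⟩
        2 * q * (suc a * m) + n + 2 * q * g ∎)
      where
      open ≤-Reasoning
      g = count (λ x → common K x ∧ popular u (P x))
      unpop = count (λ x → E u x ∧ not (popular u (P x)))
      lem₁ : ∀ q x n → 2 * q * x + n + n ≡ 2 * (q * x + n)
      lem₁ = solve-∀
      lem₂ : ∀ c x y z → c * (x + (y + z)) ≡ c * x + (c * y + c * z)
      lem₂ = solve-∀
      cover-n : n ≤ suc a * m + (unpop + g)
      cover-n = begin
        n ≤⟨ common-size (u ∷ K) ⟩
        suc (length K) * m + count (common (u ∷ K)) ≡⟨ cong (λ y → suc y * m + count (common (u ∷ K))) l ⟩
        suc a * m + count (common (u ∷ K)) ≤⟨ +-monoʳ-≤ (suc a * m) (sumF-mono pt) ⟩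
        suc a * m + sumF (λ x → ι (E u x ∧ not (popular u (P x))) + ι (common K x ∧ popular u (P x)))
          ≡⟨ cong (suc a * m +_) (sumF-+ (λ x → ι (E u x ∧ not (popular u (P x)))) (λ x → ι (common K x ∧ popular u (P x)))) ⟩
        suc a * m + (unpop + g) ∎
        where
        pt : ∀ x → ι (E u x ∧ common K x) ≤ ι (E u x ∧ not (popular u (P x))) + ι (common K x ∧ popular u (P x))
        pt x with E u x | common K x | popular u (P x)
        ... | false | _     | _     = z≤n
        ... | true  | false | _     = z≤n
        ... | true  | true  | true  = ≤-refl
        ... | true  | true  | false = ≤-refl

  -- Every chosen vertex is added to L, so C is not only in the common neighbourhood of L but also a
  -- clique.
  ext : List (Fin n) → List (Fin n) → Bool
  ext L []      = true
  ext L (z ∷ C) = common L z ∧ ext (z ∷ L) C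

  ext-joined : ∀ L C w → Any (w ≡_) L → ext L C ≡ true → Joined w C
  ext-joined L []      w i h = []
  ext-joined L (z ∷ C) w i h = lookup-common L i (∧-fst h) ∷ ext-joined (z ∷ L) C w (there i) (∧-snd {common L z} h)
    where lookup-common : ∀ L → Any (w ≡_) L → common L z ≡ true → E w z ≡ true
          lookup-common (x ∷ L) (here refl) h = ∧-fst h
          lookup-common (x ∷ L) (there i)   h = lookup-common L i (∧-snd {E x z} h)

  ext-clique : ∀ L C → ext L C ≡ true → Clique C
  ext-clique L []      h = tt
  ext-clique L (z ∷ C) h = ext-joined (z ∷ L) C z (here refl) (∧-snd {common L z} h) , ext-clique (z ∷ L) C (∧-snd {common L z} h)

  -- Greedy choice: at each step at most a + 1 vertices have to be respected, and these have at
  -- least n/q common neighbours.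
  ext-count : ∀ i L → length L + i ≤ 2 + a → n ^ i ≤ q ^ i * sumT i (λ C → ι (ext L C))
  ext-count zero    L le = ≤-refl
  ext-count (suc i) L le = begin
      n * n ^ i ≤⟨ *-monoˡ-≤ (n ^ i) extend-one ⟩
      q * count (common L) * n ^ i ≡⟨ lem₁ q (count (common L)) (n ^ i) ⟩
      q * (n ^ i * count (common L)) ≡⟨ cong (q *_) (sym (sumF-*ˡ (n ^ i) (ι ∘ common L))) ⟩
      q * sumF (λ z → n ^ i * ι (common L z)) ≤⟨ *-monoʳ-≤ q (sumF-mono pt) ⟩
      q * sumF (λ z → q ^ i * sumT i (λ C → ι (common L z ∧ ext (z ∷ L) C))) ≡⟨ cong (q *_) (sumF-*ˡ (q ^ i) (λ z → sumT i (λ C → ι (common L z ∧ ext (z ∷ L) C)))) ⟩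
      q * (q ^ i * sumF (λ z → sumT i (λ C → ι (common L z ∧ ext (z ∷ L) C)))) ≡⟨ sym (*-assoc q (q ^ i) _) ⟩
      q * q ^ i * sumF (λ z → sumT i (λ C → ι (common L z ∧ ext (z ∷ L) C))) ∎
    where
    open ≤-Reasoning
    lem₁ : ∀ q c x → q * c * x ≡ q * (x * c)
    lem₁ = solve-∀
    le′ : length L ≤ suc a
    le′ = s≤s⁻¹ (≤-trans (≤-reflexive (+-comm 1 (length L))) (≤-trans (+-monoʳ-≤ (length L) (s≤s z≤n)) le))
    extend-one : n ≤ q * count (common L)
    extend-one = +-cancelˡ-≤ (q * (suc a * m)) _ _ (≤-trans dense (≤-trans (*-monoʳ-≤ q (≤-trans (common-size L) (+-monoˡ-≤ (count (common L)) (*-monoˡ-≤ m le′))))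
                   (≤-reflexive (*-distribˡ-+ q (suc a * m) (count (common L))))))
    pt : ∀ z → n ^ i * ι (common L z) ≤ q ^ i * sumT i (λ C → ι (common L z ∧ ext (z ∷ L) C))
    pt z with common L z
    ... | false = ≤-trans (≤-reflexive (*-zeroʳ (n ^ i))) z≤n
    ... | true  = ≤-trans (≤-reflexive (*-identityʳ (n ^ i))) (ext-count i (z ∷ L) (≤-trans (≤-reflexive (sym (+-suc (length L) i))) le))

  Q : ℕ
  Q = increments a q

  module Refine {p : ℕ} (P : Fin n → Fin p) (u v : Fin n) (uv : E u v ≡ true)
                (same : ∀ j → popular P u j ≡ popular P v j) where

    code : Bool → Bool → Fin 4
    code false false = zero
    code false true  = suc zero
    code true  false = suc (suc zero)
    code true  true  = suc (suc (suc zero))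

    decode : Fin 4 → Bool × Bool
    decode zero                   = false , false
    decode (suc zero)             = false , true
    decode (suc (suc zero))       = true , false
    decode (suc (suc (suc zero))) = true , true

    decode-code : ∀ b c → decode (code b c) ≡ (b , c)
    decode-code false false = refl
    decode-code false true  = refl
    decode-code true  false = refl
    decode-code true  true  = refl

    code-injective : ∀ b c b′ c′ → code b c ≡ code b′ c′ → b ≡ b′ × c ≡ c′
    code-injective b c b′ c′ h = cong proj₁ e , cong proj₂ e
      where e : (b , c) ≡ (b′ , c′)
            e = trans (sym (decode-code b c)) (trans (cong decode h) (decode-code b′ c′))

    P′ : Fin n → Fin (p * 4)
    P′ x = combine (P x) (code (E u x) (E v x))

    P′-injective : ∀ x y → P′ x ≡ P′ y → P x ≡ P y × E u x ≡ E u y × E v x ≡ E v y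
    P′-injective x y h with Fin.combine-injective (P x) _ (P y) _ h
    ... | e , f = e , code-injective _ _ _ _ f

    hit-coarser : ∀ B x → Hit P′ B (P′ x) ≡ true → Hit P B (P x) ≡ true
    hit-coarser B x h with someF-elim _ h
    ... | y , r with P′-injective y x (≟ᶠ-true _ _ (∧-fst r))
    ...   | e , _ = someF-intro _ y (∧-pair (trans (cong (λ j → ⌊ j ≟ᶠ P x ⌋) e) (≟ᶠ-refl (P x))) (∧-snd {⌊ P′ y ≟ᶠ P′ x ⌋} r))

    agree : ∀ {w} → w ≡ u ⊎ w ≡ v → ∀ x y → P′ x ≡ P′ y → E w x ≡ E w y
    agree (inj₁ refl) x y h = proj₁ (proj₂ (P′-injective x y h))
    agree (inj₂ refl) x y h = proj₂ (proj₂ (P′-injective x y h))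

    -- A set missing N(w) loses, after the refinement, the part of N(w) in the parts it hits.
    support-drop : ∀ B w → w ≡ u ⊎ w ≡ v → (∀ x → B x ≡ true → E w x ≡ true → ⊥) →
                   support P′ B + count (λ y → Hit P B (P y) ∧ E w y) ≤ support P B
    support-drop B w wuv miss = ≤-trans (≤-reflexive (sym (sumF-+ (λ x → ι (Hit P′ B (P′ x))) (λ y → ι (Hit P B (P y) ∧ E w y))))) (sumF-mono pt)
      where
      lost : ∀ x → Hit P′ B (P′ x) ≡ true → E w x ≡ true → ⊥
      lost x h wx with someF-elim _ h
      ... | y , r = miss y (∧-snd {⌊ P′ y ≟ᶠ P′ x ⌋} r) (trans (agree wuv y x (≟ᶠ-true _ _ (∧-fst r))) wx)
      pt : ∀ x → ι (Hit P′ B (P′ x)) + ι (Hit P B (P x) ∧ E w x) ≤ ι (Hit P B (P x))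
      pt x with Hit P′ B (P′ x) in h′ | Hit P B (P x) in h | E w x in wx
      ... | false | false | _     = z≤n
      ... | false | true  | b     = ι≤1 b
      ... | true  | false | _     = ⊥-elim (true≢false (hit-coarser B x h′) h)
      ... | true  | true  | false = ≤-refl
      ... | true  | true  | true  = ⊥-elim (lost x h′ wx)

    support-mono : ∀ B → support P′ B ≤ support P B
    support-mono B = count-mono (hit-coarser B)

    weightOf : List (Fin n) → ℕ
    weightOf K = support P (Side K true) + support P (Side K false)

    weightOf′ : List (Fin n) → ℕ
    weightOf′ K = support P′ (Side K true) + support P′ (Side K false)

    -- The adjacent vertices u and v lie on different sides of the colouring for K, so each side τ
    -- contains one of them, `w τ`, and misses its neighbourhood. By `support-drop` that side loses
    -- the neighbours of `w τ` in the parts it meets, which are at least a proportion 1/(2q) of the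
    -- popular parts it meets. Popularity for u and for `w τ` agree by `same`, and together the two
    -- sides meet the parts of all common neighbours of K.
    drop-at : ∀ K → length K ≡ a → ext (u ∷ v ∷ []) K ≡ true →
              2 * q * (2 * q) * weightOf′ K + n ≤ 2 * q * (2 * q) * weightOf K
    drop-at K l h = begin
        2 * q * (2 * q) * weightOf′ K + n ≤⟨ +-monoʳ-≤ (2 * q * (2 * q) * weightOf′ K) (≤-trans (popular-common P u K l) (*-monoʳ-≤ (2 * q) both)) ⟩
        2 * q * (2 * q) * weightOf′ K + 2 * q * (2 * q * (D true + D false)) ≡⟨ lem (2 * q) (support P′ (Side K true)) (support P′ (Side K false)) (D true) (D false) ⟩
        2 * q * (2 * q) * ((support P′ (Side K true) + D true) + (support P′ (Side K false) + D false))
          ≤⟨ *-monoʳ-≤ (2 * q * (2 * q)) (+-mono-≤ (support-drop (Side K true) (w true) (w-uv true) (misses true)) (support-drop (Side K false) (w false) (w-uv false) (misses false))) ⟩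
        2 * q * (2 * q) * weightOf K ∎
      where
      open ≤-Reasoning
      lem : ∀ c s s′ d d′ → c * c * (s + s′) + c * (c * (d + d′)) ≡ c * c * ((s + d) + (s′ + d′))
      lem = solve-∀
      cl = ext-clique (u ∷ v ∷ []) K h
      ju : Joined u K
      ju = ext-joined (u ∷ v ∷ []) K u (here refl) h
      jv : Joined v K
      jv = ext-joined (u ∷ v ∷ []) K v (there (here refl)) h
      pr = side-proper K l cl
      w : Bool → Fin n
      w τ = if side K u ≡ᴮ τ then u else v
      w-uv : ∀ τ → w τ ≡ u ⊎ w τ ≡ v
      w-uv τ with side K u ≡ᴮ τ
      ... | true  = inj₁ refl
      ... | false = inj₂ refl
      w-side : ∀ τ → common K (w τ) ≡ true × side K (w τ) ≡ τ
      w-side τ with side K u ≡ᴮ τ in e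
      ... | true  = joined-common K u ju , ≡ᴮ-true (side K u) τ e
      ... | false = joined-common K v jv , other (side K u) (side K v) τ (λ q → pr u v (joined-common K u ju) (joined-common K v jv) uv q) e
        where other : ∀ a b c → (a ≡ b → ⊥) → a ≡ᴮ c ≡ false → b ≡ c
              other false false c     ne e = ⊥-elim (ne refl)
              other true  true  c     ne e = ⊥-elim (ne refl)
              other false true  true  ne e = refl
              other true  false false ne e = refl
      misses : ∀ τ x → Side K τ x ≡ true → E (w τ) x ≡ true → ⊥
      misses τ x s e = pr (w τ) x (proj₁ (w-side τ)) (∧-fst s) e
        (trans (proj₂ (w-side τ)) (sym (≡ᴮ-true (side K x) τ (∧-snd {common K x} s))))
      D : Bool → ℕ
      D τ = count (λ y → Hit P (Side K τ) (P y) ∧ E (w τ) y)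
      pop-w : ∀ τ j → popular P u j ≡ popular P (w τ) j
      pop-w τ j with w τ | w-uv τ
      ... | _ | inj₁ refl = refl
      ... | _ | inj₂ refl = same j
      pop-count : ∀ τ → count (λ x → Hit P (Side K τ) (P x) ∧ popular P u (P x)) ≤ 2 * q * D τ
      pop-count τ = ≤-trans (≤-reflexive (count-cong (λ x → cong (Hit P (Side K τ) (P x) ∧_) (pop-w τ (P x))))) (popular-count P (w τ) (Hit P (Side K τ)))
      both : count (λ x → common K x ∧ popular P u (P x)) ≤ 2 * q * (D true + D false)
      both = ≤-trans (sumF-mono pt) (≤-trans (≤-reflexive (sumF-+ (λ x → ι (Hit P (Side K true) (P x) ∧ popular P u (P x))) (λ x → ι (Hit P (Side K false) (P x) ∧ popular P u (P x)))))
               (≤-trans (+-mono-≤ (pop-count true) (pop-count false)) (≤-reflexive (sym (*-distribˡ-+ (2 * q) (D true) (D false))))))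
        where
        hit-own : ∀ x → common K x ≡ true → Hit P (Side K (side K x)) (P x) ≡ true
        hit-own x c = someF-intro _ x (∧-pair (≟ᶠ-refl (P x)) (∧-pair c (≡ᴮ-refl (side K x))))
        pt : ∀ x → ι (common K x ∧ popular P u (P x))
                 ≤ ι (Hit P (Side K true) (P x) ∧ popular P u (P x)) + ι (Hit P (Side K false) (P x) ∧ popular P u (P x))
        pt x with common K x in c
        ... | false = z≤n
        ... | true with side K x | hit-own x c
        ...   | true  | t rewrite t = m≤m+n _ _
        ...   | false | t rewrite t = m≤n+m _ _

    Φ-drop : Q * Φ P′ + n ^ suc a ≤ Q * Φ P
    Φ-drop = begin
        Q * Φ P′ + n * n ^ a ≡⟨ cong₂ _+_ (lem₁ c (q ^ a) (Φ P′)) (*-comm n (n ^ a)) ⟩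
        q ^ a * (c * Φ P′) + n ^ a * n ≤⟨ +-monoʳ-≤ (q ^ a * (c * Φ P′)) (*-monoˡ-≤ n (ext-count a (u ∷ v ∷ []) ≤-refl)) ⟩
        q ^ a * (c * Φ P′) + q ^ a * sumT a (λ C → ι (ext (u ∷ v ∷ []) C)) * n ≡⟨ lem₂ (q ^ a) (c * Φ P′) (sumT a (λ C → ι (ext (u ∷ v ∷ []) C))) n ⟩
        q ^ a * (c * Φ P′ + n * sumT a (λ C → ι (ext (u ∷ v ∷ []) C))) ≤⟨ *-monoʳ-≤ (q ^ a) inner ⟩
        q ^ a * (c * Φ P) ≡⟨ sym (lem₁ c (q ^ a) (Φ P)) ⟩
        Q * Φ P ∎
      where
      open ≤-Reasoning
      c = 2 * q * (2 * q)
      lem₁ : ∀ c x y → c * x * y ≡ x * (c * y)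
      lem₁ = solve-∀
      lem₂ : ∀ x y z n → x * y + x * z * n ≡ x * (y + n * z)
      lem₂ = solve-∀
      pt : ∀ C → length C ≡ a → c * weightOf′ C + n * ι (ext (u ∷ v ∷ []) C) ≤ c * weightOf C
      pt C l with ext (u ∷ v ∷ []) C in e
      ... | true  = ≤-trans (≤-reflexive (cong (c * weightOf′ C +_) (*-identityʳ n))) (drop-at C l e)
      ... | false = ≤-trans (≤-reflexive (trans (cong (c * weightOf′ C +_) (*-zeroʳ n)) (+-identityʳ _)))
                            (*-monoʳ-≤ c (+-mono-≤ (support-mono (Side C true)) (support-mono (Side C false))))
      inner : c * Φ P′ + n * sumT a (λ C → ι (ext (u ∷ v ∷ []) C)) ≤ c * Φ P
      inner = begin
        c * Φ P′ + n * sumT a (λ C → ι (ext (u ∷ v ∷ []) C))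
          ≡⟨ cong₂ _+_ (sym (sumT-* a c weightOf′)) (sym (sumT-* a n (λ C → ι (ext (u ∷ v ∷ []) C)))) ⟩
        sumT a (λ C → c * weightOf′ C) + sumT a (λ C → n * ι (ext (u ∷ v ∷ []) C))
          ≡⟨ sym (sumT-+ a (λ C → c * weightOf′ C) (λ C → n * ι (ext (u ∷ v ∷ []) C))) ⟩
        sumT a (λ C → c * weightOf′ C + n * ι (ext (u ∷ v ∷ []) C)) ≤⟨ sumT-mono a _ _ pt ⟩
        sumT a (λ C → c * weightOf C) ≡⟨ sumT-* a c weightOf ⟩
        c * Φ P ∎

  ProperColouring : ℕ → Set
  ProperColouring k = Σ (Fin n → Fin k) λ c → ∀ u v → E u v ≡ true → c u ≢ c v

  clash? : ∀ {p} (P : Fin n → Fin p) →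
           (Σ (Fin n) λ u → Σ (Fin n) λ v → E u v ≡ true × (∀ j → popular P u j ≡ popular P v j))
           ⊎ (∀ u v → E u v ≡ true → ¬ (∀ j → popular P u j ≡ popular P v j))
  clash? P with Fin.any? (λ u → Fin.any? λ v → (E u v Bool.≟ true) ×-dec Fin.all? (λ j → popular P u j Bool.≟ popular P v j))
  ... | yes (u , v , e , s) = inj₁ (u , v , e , s)
  ... | no none = inj₂ λ u v e s → none (u , v , e , s)

  refineᵣ : ∀ r {p} (P : Fin n → Fin p) → Q * Φ P < r * n ^ suc a → ProperColouring (colours r p)
  refineᵣ (suc r) {p} P lt with clash? P
  ... | inj₂ proper = (λ u → funToFin (λ j → bit (popular P u j)) ↑ˡ colours r (p * 4)) ,
        λ u v e h → proper u v e λ j → bit-injective _ _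
          (trans (sym (Fin.finToFun-funToFin (λ j → bit (popular P u j)) j))
            (trans (cong (λ k → finToFun k j) (Fin.↑ˡ-injective (colours r (p * 4)) _ _ h)) (Fin.finToFun-funToFin (λ j → bit (popular P v j)) j)))
  ... | inj₁ (u , v , e , s) = let (c , pr) = refineᵣ r (Refine.P′ P u v e s) lt′ in
        (λ x → 2 ^ p ↑ʳ c x) , λ x y xy h → pr x y xy (Fin.↑ʳ-injective (2 ^ p) _ _ h)
    where
    lt′ : Q * Φ (Refine.P′ P u v e s) < r * n ^ suc a
    lt′ = +-cancelˡ-< (n ^ suc a) _ _ (≤-<-trans (≤-trans (≤-reflexive (+-comm (n ^ suc a) _)) (Refine.Φ-drop P u v e s)) lt)

  bounded : 1 ≤ n → ProperColouring (colours (suc (Q * 2)) 1)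
  bounded n≥1 = refineᵣ (suc (Q * 2)) trivial (begin-strict
      Q * Φ trivial ≤⟨ *-monoʳ-≤ Q (Φ≤ trivial) ⟩
      Q * (2 * n ^ suc a) ≡⟨ sym (*-assoc Q 2 (n ^ suc a)) ⟩
      Q * 2 * n ^ suc a <⟨ m<n+m (Q * 2 * n ^ suc a) (m^n>0 n ⦃ ℕ.>-nonZero n≥1 ⦄ (suc a)) ⟩
      n ^ suc a + Q * 2 * n ^ suc a ∎)
    where
    open ≤-Reasoning
    trivial : Fin n → Fin 1
    trivial _ = zero

-- Part (7): shift graphs

listOf : ∀ {N} r → Fin (N ^ r) → List (Fin N)
listOf         zero    i = []
listOf {N} (suc r) i = proj₁ (remQuot {N} (N ^ r) i) ∷ listOf r (proj₂ (remQuot {N} (N ^ r) i))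

index : ∀ {N} (w : List (Fin N)) → Fin (N ^ length w)
index []      = zero
index (x ∷ w) = combine x (index w)

listOf-index : ∀ {N} (w : List (Fin N)) → listOf (length w) (index w) ≡ w
listOf-index []      = refl
listOf-index {N} (x ∷ w) = cong₂ _∷_ (cong proj₁ (Fin.remQuot-combine {N} {N ^ length w} x (index w)))
  (trans (cong (λ p → listOf (length w) (proj₂ p)) (Fin.remQuot-combine {N} {N ^ length w} x (index w))) (listOf-index w))

length-listOf : ∀ {N} r (i : Fin (N ^ r)) → length (listOf {N} r i) ≡ r
length-listOf zero    i = refl
length-listOf (suc r) i = cong suc (length-listOf r _)

increasing : ∀ {N} → List (Fin N) → Bool
increasing []           = true
increasing (x ∷ [])     = true
increasing (x ∷ y ∷ ys) = (toℕ x <ᵇ toℕ y) ∧ increasing (y ∷ ys)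

increasing-tail : ∀ {N} (x : Fin N) xs → increasing (x ∷ xs) ≡ true → increasing xs ≡ true
increasing-tail x []       h = refl
increasing-tail x (y ∷ ys) h = ∧-snd {toℕ x <ᵇ toℕ y} h

<ᵇ-true : ∀ m n → (m <ᵇ n) ≡ true → m < n
<ᵇ-true m n h = <ᵇ⇒< m n (subst T (sym h) tt)

true-<ᵇ : ∀ m n → m < n → (m <ᵇ n) ≡ true
true-<ᵇ m n h with m <ᵇ n in eq
... | true  = refl
... | false = ⊥-elim (subst T eq (<⇒<ᵇ h))

increasing-below : ∀ {N} (x : Fin N) xs → increasing (x ∷ xs) ≡ true → All (λ y → toℕ x < toℕ y) xs
increasing-below x []       h = []
increasing-below x (y ∷ ys) h = x<y ∷ All.map (<-trans x<y) (increasing-below y ys (∧-snd {toℕ x <ᵇ toℕ y} h))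
  where x<y = <ᵇ-true (toℕ x) (toℕ y) (∧-fst h)

prefix : ∀ {N} → List (Fin N) → List (Fin N) → Bool
prefix []       ys       = true
prefix (x ∷ xs) []       = false
prefix (x ∷ xs) (y ∷ ys) = ⌊ x ≟ᶠ y ⌋ ∧ prefix xs ys

shifts : ∀ {N} → List (Fin N) → List (Fin N) → Bool
shifts []       w = false
shifts (x ∷ xs) w = prefix xs w

prefix-snoc : ∀ {N} (xs : List (Fin N)) w → prefix xs w ≡ true → length w ≡ suc (length xs) → Σ (Fin N) λ z → w ≡ xs ++ z ∷ []
prefix-snoc []       (z ∷ []) h l = z , refl
prefix-snoc (x ∷ xs) (y ∷ w)  h l with prefix-snoc xs w (∧-snd {⌊ x ≟ᶠ y ⌋} h) (suc-injective l)
... | z , e = z , cong₂ _∷_ (sym (≟ᶠ-true x y (∧-fst h))) e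

prefix-++ : ∀ {N} (xs ys : List (Fin N)) → prefix xs (xs ++ ys) ≡ true
prefix-++ []       ys = refl
prefix-++ (x ∷ xs) ys = ∧-pair (≟ᶠ-refl x) (prefix-++ xs ys)

-- The number r counts the shared entries; the coloured tuples have r + 1.
ProperShift : ∀ {N} r k → (List (Fin N) → Fin k) → Set
ProperShift {N} r k c = ∀ x ys z → length ys ≡ r → increasing (x ∷ ys ++ z ∷ []) ≡ true → c (x ∷ ys) ≢ c (ys ++ z ∷ [])

-- An iterated exponential: shortening the tuples by one entry replaces k colours by the 2^k sets of
-- colours, and single points are settled by the pigeonhole principle.
points : ℕ → ℕ → ℕ
points zero    k = 2 + k
points (suc r) k = points r (2 ^ k)

points≥2 : ∀ r k → 2 ≤ points r k
points≥2 zero    k = s≤s (s≤s z≤n)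
points≥2 (suc r) k = points≥2 r (2 ^ k)

increasing-join : ∀ {N} (x : Fin N) xs z y → increasing (x ∷ xs ++ z ∷ []) ≡ true → increasing ((xs ++ z ∷ []) ++ y ∷ []) ≡ true →
                  increasing (x ∷ (xs ++ z ∷ []) ++ y ∷ []) ≡ true
increasing-join x []        z y h h′ = ∧-pair {toℕ x <ᵇ toℕ z} (∧-fst {toℕ x <ᵇ toℕ z} h) h′
increasing-join x (x′ ∷ xs) z y h h′ = ∧-pair {toℕ x <ᵇ toℕ x′} (∧-fst {toℕ x <ᵇ toℕ x′} h) h′

-- The colours of the one-point extensions of a tuple colour the shift graph of shorter tuples.
shift-not-colourable : ∀ r k (c : List (Fin (points r k)) → Fin k) → ¬ ProperShift r k c
shift-not-colourable zero k c pr with Fin.pigeonhole {k} {suc (suc k)} (s≤s (n≤1+n k)) (λ x → c (x ∷ []))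
... | i , j , i<j , e = pr i [] j refl (∧-pair (true-<ᵇ (toℕ i) (toℕ j) i<j) refl) e
shift-not-colourable (suc r) k c pr = shift-not-colourable r (2 ^ k) c′ pr′
  where
  N = points r (2 ^ k)
  used : List (Fin N) → Fin k → Bool
  used w col = someF (λ y → increasing (w ++ y ∷ []) ∧ ⌊ c (w ++ y ∷ []) ≟ᶠ col ⌋)
  c′ : List (Fin N) → Fin (2 ^ k)
  c′ w = funToFin (λ col → bit (used w col))
  pr′ : ProperShift r (2 ^ k) c′
  pr′ x ys z l inc e = pr x (ys ++ z ∷ []) y (trans (length-++ ys) (trans (+-comm (length ys) 1) (cong suc l)))
      (increasing-join x ys z y inc incy) (sym (≟ᶠ-true _ _ (∧-snd {increasing ((ys ++ z ∷ []) ++ y ∷ [])} (proj₂ found))))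
    where
    col = c (x ∷ ys ++ z ∷ [])
    same : used (x ∷ ys) col ≡ used (ys ++ z ∷ []) col
    same = bit-injective _ _ (trans (sym (Fin.finToFun-funToFin (λ q → bit (used (x ∷ ys) q)) col))
             (trans (cong (λ q → finToFun q col) e) (Fin.finToFun-funToFin (λ q → bit (used (ys ++ z ∷ []) q)) col)))
    found : Σ (Fin N) λ y → increasing ((ys ++ z ∷ []) ++ y ∷ []) ∧ ⌊ c ((ys ++ z ∷ []) ++ y ∷ []) ≟ᶠ col ⌋ ≡ true
    found = someF-elim _ (trans (sym same) (someF-intro _ z (∧-pair inc (≟ᶠ-refl col))))
    y = proj₁ found
    incy : increasing ((ys ++ z ∷ []) ++ y ∷ []) ≡ true
    incy = ∧-fst (proj₂ found)

-- Parity of the position of the first entry of gs which occurs in w (positions counted from 1,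
-- true meaning even)

pos : ∀ {N} → Fin N → List (Fin N) → Maybe Bool
pos g []       = nothing
pos g (x ∷ xs) = if ⌊ g ≟ᶠ x ⌋ then just false else mapMaybe not (pos g xs)

orElse : Maybe Bool → Maybe Bool → Maybe Bool
orElse (just b) _ = just b
orElse nothing  m = m

firstHit : ∀ {N} → List (Fin N) → List (Fin N) → Maybe Bool
firstHit []       w = nothing
firstHit (g ∷ gs) w = orElse (pos g w) (firstHit gs w)

isEven : Maybe Bool → Bool
isEven (just true) = true
isEven _           = false

pos-snoc-just : ∀ {N} (g : Fin N) xs z b → pos g xs ≡ just b → pos g (xs ++ z ∷ []) ≡ just b
pos-snoc-just g (x ∷ xs) z b h with ⌊ g ≟ᶠ x ⌋
... | true  = h
... | false with pos g xs in e
pos-snoc-just g (x ∷ xs) z b h | false | just b′ = trans (cong (mapMaybe not) (pos-snoc-just g xs z b′ e)) h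

pos-snoc-nothing : ∀ {N} (g : Fin N) xs z → pos g xs ≡ nothing →
                   pos g (xs ++ z ∷ []) ≡ just (odd (length xs)) ⊎ pos g (xs ++ z ∷ []) ≡ nothing
pos-snoc-nothing g [] z h with ⌊ g ≟ᶠ z ⌋
... | true  = inj₁ refl
... | false = inj₂ refl
pos-snoc-nothing g (x ∷ xs) z h with ⌊ g ≟ᶠ x ⌋
pos-snoc-nothing g (x ∷ xs) z () | true
... | false with pos g xs in e
...   | nothing with pos-snoc-nothing g xs z e
...     | inj₁ q = inj₁ (cong (mapMaybe not) q)
...     | inj₂ q = inj₂ (cong (mapMaybe not) q)

-- If the first hit of x ∷ xs is at an even position it is not x, so it is at an odd position in
-- xs ++ z; the only other candidate, z, sits at the odd position |w|.
disjoint : ∀ {N} (x : Fin N) xs z → odd (length xs) ≡ false → ∀ gs →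
           isEven (firstHit gs (x ∷ xs)) ≡ true → isEven (firstHit gs (xs ++ z ∷ [])) ≡ true → ⊥
disjoint x xs z ev (g ∷ gs) h h′ with ⌊ g ≟ᶠ x ⌋ | pos g xs in e
disjoint x xs z ev (g ∷ gs) () h′ | true | _
disjoint x xs z ev (g ∷ gs) () h′ | false | just true
disjoint x xs z ev (g ∷ gs) h h′ | false | just false rewrite pos-snoc-just g xs z false e = case h′ of λ ()
disjoint x xs z ev (g ∷ gs) h h′ | false | nothing with pos-snoc-nothing g xs z e
... | inj₁ q rewrite q | ev = case h′ of λ ()
... | inj₂ q rewrite q = disjoint x xs z ev gs h h′

is : Bool → Maybe Bool → Bool
is true  (just true)  = true
is false (just false) = true
is _     _            = false

misses : Maybe Bool → Bool
misses nothing  = true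
misses (just _) = false

half : ℕ → ℕ
half 0             = 0
half 1             = 0
half (suc (suc n)) = suc (half n)

half-odd : ∀ h → half (suc (h + h)) ≡ h
half-odd zero    = refl
half-odd (suc h) = trans (cong half (cong suc (cong suc (+-suc h h)))) (cong suc (half-odd h))

pos-absent : ∀ {N} (x : Fin N) xs → All (λ y → toℕ x < toℕ y) xs → pos x xs ≡ nothing
pos-absent x []       []       = refl
pos-absent x (y ∷ ys) (l ∷ ls) with ⌊ x ≟ᶠ y ⌋ in e
... | true  = ⊥-elim (<-irrefl (cong toℕ (≟ᶠ-true x y e)) l)
... | false = cong (mapMaybe not) (pos-absent x ys ls)

module _ {N : ℕ} where

  evens odds none : List (Fin N) → ℕ
  evens w = count (λ g → is true (pos g w))
  odds  w = count (λ g → is false (pos g w))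
  none  w = count (λ g → misses (pos g w))

  -- A new first entry shifts all others by one place, so even and odd exchange roles and one odd
  -- position is added. Monotonicity ensures that the new entry does not occur again.
  counts : ∀ w → increasing w ≡ true → evens w ≡ half (length w) × odds w ≡ half (suc (length w)) × length w + none w ≡ N
  counts [] _ = sumF-zero {N} (λ _ → 0) (λ _ → refl) , sumF-zero {N} (λ _ → 0) (λ _ → refl) , count-true N
  counts (x ∷ xs) inc with counts xs (increasing-tail x xs inc)
  ... | e , o , l = trans (sumF-cong pt₁) o , trans (trans (sumF-cong pt₂) (sumF-+ (λ g → ι ⌊ x ≟ᶠ g ⌋) (λ g → ι (is true (pos g xs))))) (cong₂ _+_ (count-≡ᵇ x) e) , total
    where
    x∉ : pos x xs ≡ nothing
    x∉ = pos-absent x xs (increasing-below x xs inc)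
    pt₁ : ∀ g → ι (is true (pos g (x ∷ xs))) ≡ ι (is false (pos g xs))
    pt₁ g with ⌊ g ≟ᶠ x ⌋ in q
    ... | true rewrite ≟ᶠ-true g x q | x∉ = refl
    ... | false with pos g xs
    ...   | just true  = refl
    ...   | just false = refl
    ...   | nothing    = refl
    pt₂ : ∀ g → ι (is false (pos g (x ∷ xs))) ≡ ι ⌊ x ≟ᶠ g ⌋ + ι (is true (pos g xs))
    pt₂ g rewrite ==-sym (toℕ x) (toℕ g) with ⌊ g ≟ᶠ x ⌋ in q
    ... | true rewrite ≟ᶠ-true g x q | x∉ = refl
    ... | false with pos g xs
    ...   | just true  = refl
    ...   | just false = refl
    ...   | nothing    = refl
    pt₃ : ∀ g → ι ⌊ x ≟ᶠ g ⌋ + ι (misses (pos g (x ∷ xs))) ≡ ι (misses (pos g xs))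
    pt₃ g rewrite ==-sym (toℕ x) (toℕ g) with ⌊ g ≟ᶠ x ⌋ in q
    ... | true rewrite ≟ᶠ-true g x q | x∉ = refl
    ... | false with pos g xs
    ...   | just true  = refl
    ...   | just false = refl
    ...   | nothing    = refl
    total : suc (length xs) + none (x ∷ xs) ≡ N
    total = trans (sym (+-suc (length xs) (none (x ∷ xs))))
      (trans (cong (length xs +_) (trans (cong (_+ none (x ∷ xs)) (sym (count-≡ᵇ x)))
        (trans (sym (sumF-+ (λ g → ι ⌊ x ≟ᶠ g ⌋) (λ g → ι (misses (pos g (x ∷ xs)))))) (sumF-cong pt₃)))) l)

  hitEven : List (Fin N) → ∀ L → Fin (N ^ L) → Bool
  hitEven w L i = isEven (firstHit (listOf L i) w)

  hitEven-step : ∀ w L → count (hitEven w (suc L)) ≡ evens w * N ^ L + none w * count (hitEven w L)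
  hitEven-step w L = trans (sumF-combine N (N ^ L) (λ i → ι (hitEven w (suc L) i)))
    (trans (sumF-cong inner) (trans (sumF-+ (λ g → ι (is true (pos g w)) * N ^ L) (λ g → ι (misses (pos g w)) * count (hitEven w L)))
      (cong₂ _+_ (scale (λ g → ι (is true (pos g w))) (N ^ L)) (scale (λ g → ι (misses (pos g w))) (count (hitEven w L))))))
    where
    scale : ∀ (f : Fin N → ℕ) c → sumF (λ g → f g * c) ≡ sumF f * c
    scale f c = trans (sumF-cong (λ g → *-comm (f g) c)) (trans (sumF-*ˡ c f) (*-comm c (sumF f)))
    inner : ∀ g → sumF (λ j → ι (hitEven w (suc L) (combine {N} {N ^ L} g j)))
                ≡ ι (is true (pos g w)) * N ^ L + ι (misses (pos g w)) * count (hitEven w L)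
    inner g = trans (sumF-cong (λ j → cong (λ p → ι (isEven (firstHit (proj₁ p ∷ listOf L (proj₂ p)) w))) (Fin.remQuot-combine {N} {N ^ L} g j))) (go (pos g w))
      where
      go : ∀ m → sumF (λ j → ι (isEven (orElse m (firstHit (listOf L j) w)))) ≡ ι (is true m) * N ^ L + ι (misses m) * count (hitEven w L)
      go (just true)  = trans (count-true (N ^ L)) (sym (trans (+-identityʳ _) (+-identityʳ _)))
      go (just false) = sumF-zero {N ^ L} (λ _ → 0) (λ _ → refl)
      go nothing      = sym (+-identityʳ _)

  -- Among the sequences that hit w at all, the first hit is equally often each of the entries of w,
  -- of which `half (length w)` have even position. The sequences missing w number `none w ^ L`; the
  -- identity is this proportion without subtraction.
  hitEven-count : ∀ w → increasing w ≡ true → ∀ L →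
                  length w * count (hitEven w L) + half (length w) * none w ^ L ≡ half (length w) * N ^ L
  hitEven-count w inc zero = trans (cong (_+ half (length w) * 1) (*-zeroʳ (length w))) refl
  hitEven-count w inc (suc L) = begin
      r * count (hitEven w (suc L)) + h * (ν * ν ^ L) ≡⟨ cong (λ y → r * y + h * (ν * ν ^ L)) (hitEven-step w L) ⟩
      r * (evens w * N ^ L + ν * τ) + h * (ν * ν ^ L) ≡⟨ cong (λ y → r * (y * N ^ L + ν * τ) + h * (ν * ν ^ L)) (proj₁ (counts w inc)) ⟩
      r * (h * N ^ L + ν * τ) + h * (ν * ν ^ L) ≡⟨ lem₁ r h (N ^ L) ν τ (ν ^ L) ⟩
      r * h * N ^ L + ν * (r * τ + h * ν ^ L) ≡⟨ cong (λ y → r * h * N ^ L + ν * y) (hitEven-count w inc L) ⟩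
      r * h * N ^ L + ν * (h * N ^ L) ≡⟨ lem₂ r h ν (N ^ L) ⟩
      h * ((r + ν) * N ^ L) ≡⟨ cong (λ y → h * (y * N ^ L)) (proj₂ (proj₂ (counts w inc))) ⟩
      h * (N * N ^ L) ∎
    where
    open ≡-Reasoning
    r = length w
    h = half (length w)
    ν = none w
    τ = count (hitEven w L)
    lem₁ : ∀ r h x ν t y → r * (h * x + ν * t) + h * (ν * y) ≡ r * h * x + ν * (r * t + h * y)
    lem₁ = solve-∀
    lem₂ : ∀ r h ν x → r * h * x + ν * (h * x) ≡ h * ((r + ν) * x)
    lem₂ = solve-∀

-- A tuple is joined, on both sides of a complete bipartite graph, to the sequences which first hit
-- it at an even position; tuples which are not increasing are joined to one whole side.

module ShiftGraph (N h L : ℕ) where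

  -- The length r is odd, as the disjointness argument requires, and h + 1 of the r positions are
  -- even.
  r w X : ℕ
  r = 3 + (h + h)
  w = N ^ r
  X = N ^ L

  tuple : Fin w → List (Fin N)
  tuple = listOf r

  Vertex : Set
  Vertex = Fin w ⊎ (Fin X ⊎ Fin X)

  decodeV : Fin (w + (X + X)) → Vertex
  decodeV x with splitAt w x
  ... | inj₁ i = inj₁ i
  ... | inj₂ y = inj₂ (splitAt X y)

  good : Fin w → Bool
  good i = increasing (tuple i)

  arc : Fin w → Fin w → Bool
  arc i j = (good i ∧ good j) ∧ shifts (tuple i) (tuple j)

  inL inR : Fin w → Fin X → Bool
  inL i g = if good i then hitEven (tuple i) L g else true
  inR i g = good i ∧ hitEven (tuple i) L g

  adjV : Vertex → Vertex → Bool
  adjV (inj₁ i)        (inj₁ j)        = arc i j ∨ arc j i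
  adjV (inj₁ i)        (inj₂ (inj₁ g)) = inL i g
  adjV (inj₁ i)        (inj₂ (inj₂ g)) = inR i g
  adjV (inj₂ (inj₁ g)) (inj₁ i)        = inL i g
  adjV (inj₂ (inj₂ g)) (inj₁ i)        = inR i g
  adjV (inj₂ (inj₁ _)) (inj₂ (inj₁ _)) = false
  adjV (inj₂ (inj₁ _)) (inj₂ (inj₂ _)) = true
  adjV (inj₂ (inj₂ _)) (inj₂ (inj₁ _)) = true
  adjV (inj₂ (inj₂ _)) (inj₂ (inj₂ _)) = false

  second : List (Fin N) → ℕ
  second (x ∷ y ∷ _) = toℕ y
  second _           = 0
  first : List (Fin N) → ℕ
  first (x ∷ _) = toℕ x
  first _       = 0

  arc-second : ∀ i j → arc i j ≡ true → first (tuple j) ≡ second (tuple i) × first (tuple i) < second (tuple i)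
  arc-second i j a = go (tuple i) (tuple j) (length-listOf r i) (∧-fst (∧-fst a)) (∧-snd {good i ∧ good j} a)
    where
    go : ∀ u v → length u ≡ r → increasing u ≡ true → shifts u v ≡ true → first v ≡ second u × first u < second u
    go (x ∷ y ∷ u) (z ∷ v) l inc s = cong toℕ (sym (≟ᶠ-true y z (∧-fst s))) , <ᵇ-true _ _ (∧-fst inc)

  no-loop : ∀ i → arc i i ≡ true → ⊥
  no-loop i a = let (e , lt) = arc-second i i a in <-irrefl e lt

  adjV-sym : ∀ u v → adjV u v ≡ adjV v u
  adjV-sym (inj₁ i)        (inj₁ j)        = Bool.∨-comm (arc i j) (arc j i)
  adjV-sym (inj₁ i)        (inj₂ (inj₁ g)) = refl
  adjV-sym (inj₁ i)        (inj₂ (inj₂ g)) = refl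
  adjV-sym (inj₂ (inj₁ g)) (inj₁ i)        = refl
  adjV-sym (inj₂ (inj₂ g)) (inj₁ i)        = refl
  adjV-sym (inj₂ (inj₁ _)) (inj₂ (inj₁ _)) = refl
  adjV-sym (inj₂ (inj₁ _)) (inj₂ (inj₂ _)) = refl
  adjV-sym (inj₂ (inj₂ _)) (inj₂ (inj₁ _)) = refl
  adjV-sym (inj₂ (inj₂ _)) (inj₂ (inj₂ _)) = refl

  adjV-irr : ∀ u → adjV u u ≡ false
  adjV-irr (inj₁ i) with arc i i in e
  ... | true  = ⊥-elim (no-loop i e)
  ... | false = refl
  adjV-irr (inj₂ (inj₁ _)) = refl
  adjV-irr (inj₂ (inj₂ _)) = refl

  G₁ : Graph
  G₁ = record { size = w + (X + X) ; E = λ x y → adjV (decodeV x) (decodeV y)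
              ; E-sym = λ x y → adjV-sym (decodeV x) (decodeV y) ; E-irr = λ x → adjV-irr (decodeV x) }

  even-length : ∀ k → odd (k + k) ≡ false
  even-length zero    = refl
  even-length (suc k) = trans (cong (not ∘ odd) (+-suc k k)) (trans (not-not (odd (k + k))) (even-length k))
    where not-not : ∀ b → not (not b) ≡ b
          not-not false = refl
          not-not true  = refl

  arc-disjoint : ∀ i j g → arc i j ≡ true → hitEven (tuple i) L g ≡ true → hitEven (tuple j) L g ≡ true → ⊥
  arc-disjoint i j g a = go (tuple i) (tuple j) (length-listOf r i) (length-listOf r j) (∧-snd {good i ∧ good j} a)
    where
    go : ∀ u v → length u ≡ r → length v ≡ r → shifts u v ≡ true →
         hitEven u L g ≡ true → hitEven v L g ≡ true → ⊥
    go (x ∷ xs) v lu lv s hu hv with prefix-snoc xs v s (trans lv (sym lu))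
    ... | z , refl = disjoint x xs z (trans (cong odd (suc-injective lu)) (trans (cong (not ∘ not) (even-length h)) refl)) (listOf L g) hu hv

  inL-hit : ∀ i g → good i ≡ true → inL i g ≡ true → hitEven (tuple i) L g ≡ true
  inL-hit i g gi q rewrite gi = q

  inR-hit : ∀ i g → inR i g ≡ true → hitEven (tuple i) L g ≡ true
  inR-hit i g q = ∧-snd {good i} q

  arc-good : ∀ i j → arc i j ≡ true → good i ≡ true × good j ≡ true
  arc-good i j a = ∧-fst (∧-fst a) , ∧-snd {good i} (∧-fst a)

  adj-clash : ∀ i j → adjV (inj₁ i) (inj₁ j) ≡ true →
              (∀ g → inL i g ≡ true → inL j g ≡ true → ⊥) × (∀ g → inR i g ≡ true → inR j g ≡ true → ⊥)
  adj-clash i j e with ∨-case {arc i j} e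
  ... | inj₁ a = (λ g p q → arc-disjoint i j g a (inL-hit i g (proj₁ (arc-good i j a)) p) (inL-hit j g (proj₂ (arc-good i j a)) q)) ,
                 (λ g p q → arc-disjoint i j g a (inR-hit i g p) (inR-hit j g q))
  ... | inj₂ a = (λ g p q → arc-disjoint j i g a (inL-hit j g (proj₁ (arc-good j i a)) q) (inL-hit i g (proj₂ (arc-good j i a)) p)) ,
                 (λ g p q → arc-disjoint j i g a (inR-hit j g q) (inR-hit i g p))

  -- Around a sequence, the tuples get one colour and the sequences the other, since adjacent tuples
  -- have no sequence on either side in common. For the same reason no tuple adjacent to i is
  -- adjacent to a sequence adjacent to i; around i, tuples can be coloured by the direction of
  -- their arc and sequences by their side.
  nbrColour : Vertex → Vertex → Fin 2
  nbrColour (inj₂ (inj₁ g)) (inj₁ i)        = zero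
  nbrColour (inj₂ (inj₁ g)) (inj₂ _)        = suc zero
  nbrColour (inj₂ (inj₂ g)) (inj₁ i)        = zero
  nbrColour (inj₂ (inj₂ g)) (inj₂ _)        = suc zero
  nbrColour (inj₁ i)        (inj₁ j)        = bit (arc i j)
  nbrColour (inj₁ i)        (inj₂ (inj₁ g)) = zero
  nbrColour (inj₁ i)        (inj₂ (inj₂ g)) = suc zero

  -- All out-neighbours of i begin with the second entry of i, and all in-neighbours have the first
  -- entry of i as their second. An arc from j to k makes the second entry of j the first of k,
  -- which contradicts monotonicity in either case.
  no-arc-between : ∀ i j k → adjV (inj₁ i) (inj₁ j) ≡ true → adjV (inj₁ i) (inj₁ k) ≡ true → arc j k ≡ true → arc i j ≡ arc i k → ⊥
  no-arc-between i j k ij ik jk e with ∨-case {arc i j} ij | ∨-case {arc i k} ik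
  ... | inj₁ p | _ = let (a , b) = arc-second i j p ; (c , d) = arc-second i k (trans (sym e) p) ; (f , g) = arc-second j k jk
                     in <-irrefl (trans a (trans (sym c) f)) g
  ... | inj₂ p | inj₁ q = let (a , b) = arc-second i j (trans e q) ; (c , d) = arc-second i k q ; (f , g) = arc-second j k jk
                          in <-irrefl (trans a (trans (sym c) f)) g
  ... | inj₂ p | inj₂ q = let (a , b) = arc-second j i p ; (c , d) = arc-second k i q ; (f , g) = arc-second j k jk
                          in <-irrefl (trans f (trans (sym a) c)) d

  local : ∀ s u v → adjV s u ≡ true → adjV s v ≡ true → adjV u v ≡ true → nbrColour s u ≢ nbrColour s v
  local (inj₂ (inj₁ g)) (inj₁ i) (inj₁ j) su sv uv _ = proj₁ (adj-clash i j uv) g su sv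
  local (inj₂ (inj₂ g)) (inj₁ i) (inj₁ j) su sv uv _ = proj₂ (adj-clash i j uv) g su sv
  local (inj₂ (inj₁ g)) (inj₁ i) (inj₂ x) su sv uv ()
  local (inj₂ (inj₂ g)) (inj₁ i) (inj₂ x) su sv uv ()
  local (inj₂ (inj₁ g)) (inj₂ x) (inj₁ i) su sv uv ()
  local (inj₂ (inj₂ g)) (inj₂ x) (inj₁ i) su sv uv ()
  local (inj₂ (inj₁ g)) (inj₂ (inj₁ x)) (inj₂ y) () sv uv _
  local (inj₂ (inj₁ g)) (inj₂ (inj₂ x)) (inj₂ (inj₁ y)) su () uv _
  local (inj₂ (inj₁ g)) (inj₂ (inj₂ x)) (inj₂ (inj₂ y)) su sv () _
  local (inj₂ (inj₂ g)) (inj₂ (inj₂ x)) (inj₂ y) () sv uv _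
  local (inj₂ (inj₂ g)) (inj₂ (inj₁ x)) (inj₂ (inj₂ y)) su () uv _
  local (inj₂ (inj₂ g)) (inj₂ (inj₁ x)) (inj₂ (inj₁ y)) su sv () _
  local (inj₁ i) (inj₁ j) (inj₁ k) su sv uv e with ∨-case {arc j k} uv
  ... | inj₁ a = no-arc-between i j k su sv a (bit-injective _ _ e)
  ... | inj₂ a = no-arc-between i k j sv su a (sym (bit-injective _ _ e))
  local (inj₁ i) (inj₁ j) (inj₂ (inj₁ g)) su sv uv _ = proj₁ (adj-clash i j su) g sv uv
  local (inj₁ i) (inj₁ j) (inj₂ (inj₂ g)) su sv uv _ = proj₂ (adj-clash i j su) g sv uv
  local (inj₁ i) (inj₂ (inj₁ g)) (inj₁ j) su sv uv _ = proj₁ (adj-clash i j sv) g su uv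
  local (inj₁ i) (inj₂ (inj₂ g)) (inj₁ j) su sv uv _ = proj₂ (adj-clash i j sv) g su uv
  local (inj₁ i) (inj₂ (inj₁ g)) (inj₂ (inj₁ g′)) su sv () _
  local (inj₁ i) (inj₂ (inj₁ g)) (inj₂ (inj₂ g′)) su sv uv ()
  local (inj₁ i) (inj₂ (inj₂ g)) (inj₂ (inj₁ g′)) su sv uv ()
  local (inj₁ i) (inj₂ (inj₂ g)) (inj₂ (inj₂ g′)) su sv () _

  locallyBipartite₁ : LocallyBipartite 1 G₁
  locallyBipartite₁ S _ = (λ x → nbrColour (decodeV (S zero)) (decodeV x)) ,
    λ u v hu hv e → local (decodeV (S zero)) (decodeV u) (decodeV v) (hu zero) (hv zero) e

  module Degree where
    degV : Vertex → ℕ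
    degV s = count (λ i → adjV s (inj₁ i)) + (count (λ g → adjV s (inj₂ (inj₁ g))) + count (λ g → adjV s (inj₂ (inj₂ g))))

    degree-G₁ : ∀ x → degree G₁ x ≡ degV (decodeV x)
    degree-G₁ x = trans (sumF-↑ w (λ y → ι (E G₁ x y))) (cong₂ _+_ (sumF-cong p₁) (trans (sumF-↑ X (λ y → ι (E G₁ x (w ↑ʳ y)))) (cong₂ _+_ (sumF-cong p₂) (sumF-cong p₃))))
      where
      p₁ : ∀ i → ι (E G₁ x (i ↑ˡ (X + X))) ≡ ι (adjV (decodeV x) (inj₁ i))
      p₁ i rewrite Fin.splitAt-↑ˡ w i (X + X) = refl
      p₂ : ∀ g → ι (E G₁ x (w ↑ʳ (g ↑ˡ X))) ≡ ι (adjV (decodeV x) (inj₂ (inj₁ g)))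
      p₂ g rewrite Fin.splitAt-↑ʳ w (X + X) (g ↑ˡ X) | Fin.splitAt-↑ˡ X g X = refl
      p₃ : ∀ g → ι (E G₁ x (w ↑ʳ (X ↑ʳ g))) ≡ ι (adjV (decodeV x) (inj₂ (inj₂ g)))
      p₃ g rewrite Fin.splitAt-↑ʳ w (X + X) (X ↑ʳ g) | Fin.splitAt-↑ʳ X X g = refl

    -- The degree is about X(r-1)/r; stated without subtraction.
    degree-bound : ∀ {ν} → (∀ i → good i ≡ true → none (tuple i) ≡ ν) → ∀ s →
                   2 * suc h * X ≤ r * degV s + 2 * suc h * ν ^ L
    degree-bound {ν} none≡ν (inj₂ (inj₁ g)) = ≤-trans (enough (count (λ i → inL i g))) (m≤m+n _ _)
      where
      enough : ∀ c → 2 * suc h * X ≤ r * (c + (count {X} (λ _ → false) + count {X} (λ _ → true)))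
      enough c = ≤-trans (*-monoˡ-≤ X (≤-trans (≤-reflexive (lem h)) (n≤1+n _)))
        (*-monoʳ-≤ r (≤-trans (≤-reflexive (sym (count-true X))) (≤-trans (m≤n+m _ (count {X} (λ _ → false))) (m≤n+m _ c))))
        where lem : ∀ h → 2 * suc h ≡ 2 + (h + h)
              lem = solve-∀
    degree-bound {ν} none≡ν (inj₂ (inj₂ g)) = ≤-trans (enough (count (λ i → inR i g))) (m≤m+n _ _)
      where
      enough : ∀ c → 2 * suc h * X ≤ r * (c + (count {X} (λ _ → true) + count {X} (λ _ → false)))
      enough c = ≤-trans (*-monoˡ-≤ X (≤-trans (≤-reflexive (lem h)) (n≤1+n _)))
        (*-monoʳ-≤ r (≤-trans (≤-reflexive (sym (count-true X))) (≤-trans (m≤m+n _ (count {X} (λ _ → false))) (m≤n+m _ c))))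
        where lem : ∀ h → 2 * suc h ≡ 2 + (h + h)
              lem = solve-∀
    degree-bound {ν} none≡ν (inj₁ i) = ≤-trans (byGood (good i) refl) (+-monoˡ-≤ (2 * suc h * ν ^ L) (*-monoʳ-≤ r (m≤n+m _ (count (λ j → adjV (inj₁ i) (inj₁ j))))))
      where
      τ = count (hitEven (tuple i) L)
      byGood : ∀ b → good i ≡ b → 2 * suc h * X ≤ r * (count (inL i) + count (inR i)) + 2 * suc h * ν ^ L
      byGood true e = ≤-reflexive (sym (begin
          r * (count (inL i) + count (inR i)) + 2 * suc h * ν ^ L ≡⟨ cong₂ (λ y z → r * (y + z) + 2 * suc h * ν ^ L) (count-cong (λ g → cong (λ b → if b then hitEven (tuple i) L g else true) e)) (count-cong (λ g → cong (_∧ hitEven (tuple i) L g) e)) ⟩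
          r * (τ + τ) + 2 * suc h * ν ^ L ≡⟨ lem r τ (suc h) (ν ^ L) ⟩
          2 * (r * τ + suc h * ν ^ L) ≡⟨ cong (2 *_) main ⟩
          2 * (suc h * X) ≡⟨ sym (*-assoc 2 (suc h) X) ⟩
          2 * suc h * X ∎))
        where
        open ≡-Reasoning
        lem : ∀ r t h x → r * (t + t) + 2 * h * x ≡ 2 * (r * t + h * x)
        lem = solve-∀
        len = length-listOf r i
        half-r : half r ≡ suc h
        half-r = cong suc (half-odd h)
        main : r * τ + suc h * ν ^ L ≡ suc h * X
        main = trans (cong₂ (λ y z → y * τ + z * ν ^ L) (sym len) (sym (trans (cong half len) half-r)))
          (trans (cong (λ y → length (tuple i) * τ + half (length (tuple i)) * y ^ L) (sym (none≡ν i e)))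
            (trans (hitEven-count (tuple i) e L) (cong (_* X) (trans (cong half len) half-r))))
      byGood false e = ≤-trans (≤-trans (*-monoˡ-≤ X (≤-trans (≤-reflexive (lem h)) (n≤1+n _)))
          (*-monoʳ-≤ r (≤-trans (≤-reflexive (trans (sym (count-true X)) (count-cong (λ g → sym (cong (λ b → if b then hitEven (tuple i) L g else true) e))))) (m≤m+n _ (count (inR i)))))) (m≤m+n _ _)
        where lem : ∀ h → 2 * suc h ≡ 2 + (h + h)
              lem = solve-∀

  tupleIndex : (u : List (Fin N)) → length u ≡ r → Fin w
  tupleIndex u l = subst (λ k → Fin (N ^ k)) l (index u)

  tuple-index : ∀ u l → tuple (tupleIndex u l) ≡ u
  tuple-index u l = lemma l
    where lemma : ∀ {k} (l : length u ≡ k) → listOf k (subst (λ k → Fin (N ^ k)) l (index u)) ≡ u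
          lemma refl = listOf-index u

  -- At least one colour is assumed so that lists of the wrong length have a default colour.
  shift-colouring : ∀ {k} → Colourable G₁ (suc k) → Σ (List (Fin N) → Fin (suc k)) (ProperShift (2 + (h + h)) (suc k))
  shift-colouring {k} (c , pr) = c′ , pr′
    where
    c′ : List (Fin N) → Fin (suc k)
    c′ u with length u ℕ.≟ r
    ... | yes l = c (tupleIndex u l ↑ˡ (X + X))
    ... | no _  = zero
    adjacent : ∀ u v (l : length u ≡ r) (l′ : length v ≡ r) → increasing u ≡ true → increasing v ≡ true → shifts u v ≡ true →
               Adj G₁ (tupleIndex u l ↑ˡ (X + X)) (tupleIndex v l′ ↑ˡ (X + X))
    adjacent u v l l′ iu iv s = trans (cong₂ adjV (decode-left (tupleIndex u l)) (decode-left (tupleIndex v l′)))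
      (cong (_∨ arc (tupleIndex v l′) (tupleIndex u l)) (∧-pair (∧-pair (trans (cong increasing (tuple-index u l)) iu) (trans (cong increasing (tuple-index v l′)) iv))
        (trans (cong₂ shifts (tuple-index u l) (tuple-index v l′)) s)))
      where
      decode-left : ∀ i → decodeV (i ↑ˡ (X + X)) ≡ inj₁ i
      decode-left i rewrite Fin.splitAt-↑ˡ w i (X + X) = refl
    increasing-init : ∀ x ys z → increasing (x ∷ ys ++ z ∷ []) ≡ true → increasing {N} (x ∷ ys) ≡ true
    increasing-init x []       z inc = refl
    increasing-init x (y ∷ ys) z inc = ∧-pair (∧-fst inc) (increasing-init y ys z (∧-snd {toℕ x <ᵇ toℕ y} inc))
    pr′ : ProperShift (2 + (h + h)) (suc k) c′
    pr′ x ys z l inc with length (x ∷ ys) ℕ.≟ r | length (ys ++ z ∷ []) ℕ.≟ r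
    ... | no ne  | _      = λ _ → ne (cong suc l)
    ... | yes _  | no ne  = λ _ → ne (trans (length-++ ys) (trans (+-comm (length ys) 1) (cong suc l)))
    ... | yes l₁ | yes l₂ = pr _ _ (adjacent (x ∷ ys) (ys ++ z ∷ []) l₁ l₂ (increasing-init x ys z inc) (increasing-tail x (ys ++ z ∷ []) inc) (prefix-++ ys (z ∷ [])))

-- The choice of the constants for (6) and (7).

-- A positive fraction is at least 1 over its denominator. The factor a + 1 gives a common
-- denominator with `thr∞ a`.
unit-below : ∀ a ε → Pos ε → Σ ℕ λ q′ → (ℤ.+ 1) ℚ./ (suc a * suc q′) ℚ.≤ ε
unit-below a ε@(mkℚ (ℤ.+ zero) d c) (ℚ.*<* (ℤ.+<+ ()))
unit-below a ε@(mkℚ (-[1+ k ]) d c) (ℚ.*<* ())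
unit-below a ε@(mkℚ (ℤ.+ suc k) d c) h = d , ℚ.toℚᵘ-cancel-≤ (ℚᵘ.≤-respˡ-≃ (ℚᵘ.≃-sym (toℚᵘ-/ 1 (d + a * suc d)))
  (*≤* (subst₂ ℤ._≤_ (ℤ.pos-* 1 (suc d)) (ℤ.pos-* (suc k) (suc a * suc d)) (ℤ.+≤+ le))))
  where
  le : 1 * suc d ≤ suc k * (suc a * suc d)
  le = ≤-trans (≤-reflexive (*-identityˡ (suc d))) (≤-trans (m≤m+n (suc d) (a * suc d)) (m≤m+n (suc a * suc d) (k * (suc a * suc d))))

ℚ-cross : ∀ a q′ → ℤ.+ (suc a * suc q′) ≡ ℤ.+ suc a ℤ.* (ℤ.+ 1 ℤ.+ ℤ.+ q′)
ℚ-cross a q′ = ℤ.pos-* (suc a) (suc q′)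

thr∞-plus : ∀ a q′ → thr∞ a ℚ.+ (ℤ.+ 1) ℚ./ (suc a * suc q′) ≡ 1ℚ ℚ.- (ℤ.+ q′) ℚ./ (suc a * suc q′)
thr∞-plus a q′ = ℚ.toℚᵘ-injective (ℚᵘ.≃-trans lhs (ℚᵘ.≃-trans (*≡* eq) (ℚᵘ.≃-sym rhs)))
  where
  d = q′ + a * suc q′
  x = (ℤ.+ 1) ℚ./ suc a
  y = (ℤ.+ 1) ℚ./ suc d
  z = (ℤ.+ q′) ℚ./ suc d
  lhs : toℚᵘ (thr∞ a ℚ.+ y) ℚᵘ.≃ (mkℚᵘ (ℤ.+ 1) 0 ℚᵘ.+ ℚᵘ.- mkℚᵘ (ℤ.+ 1) a) ℚᵘ.+ mkℚᵘ (ℤ.+ 1) d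
  lhs = ℚᵘ.≃-trans (ℚ.toℚᵘ-homo-+ (thr∞ a) y) (ℚᵘ.+-cong (ℚᵘ.≃-trans (ℚ.toℚᵘ-homo-+ 1ℚ (ℚ.- x))
          (ℚᵘ.+-cong ℚᵘ.≃-refl (ℚᵘ.≃-trans (ℚ.toℚᵘ-homo‿- x) (ℚᵘ.-‿cong (toℚᵘ-/ 1 a))))) (toℚᵘ-/ 1 d))
  rhs : toℚᵘ (1ℚ ℚ.- z) ℚᵘ.≃ mkℚᵘ (ℤ.+ 1) 0 ℚᵘ.+ ℚᵘ.- mkℚᵘ (ℤ.+ q′) d
  rhs = ℚᵘ.≃-trans (ℚ.toℚᵘ-homo-+ 1ℚ (ℚ.- z)) (ℚᵘ.+-cong ℚᵘ.≃-refl (ℚᵘ.≃-trans (ℚ.toℚᵘ-homo‿- z) (ℚᵘ.-‿cong (toℚᵘ-/ q′ d))))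
  eq : ((ℤ.+ 1 ℤ.* ℤ.+ suc a ℤ.+ ℤ.- (ℤ.+ 1) ℤ.* ℤ.+ 1) ℤ.* ℤ.+ suc d ℤ.+ ℤ.+ 1 ℤ.* ℤ.+ (1 * suc a)) ℤ.* ℤ.+ (1 * suc d)
     ≡ (ℤ.+ 1 ℤ.* ℤ.+ suc d ℤ.+ ℤ.- (ℤ.+ q′) ℤ.* ℤ.+ 1) ℤ.* ℤ.+ (1 * suc a * suc d)
  eq = go (ℤ.+ suc a) (ℤ.+ suc d) (ℤ.+ (1 * suc a)) (ℤ.+ (1 * suc d)) (ℤ.+ (1 * suc a * suc d)) (ℤ.+ q′) (ℚ-cross a q′) (cong ℤ.+_ (*-identityˡ (suc a)))
          (trans (cong ℤ.+_ (*-identityˡ (suc d))) (ℚ-cross a q′))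
          (trans (cong (λ y → ℤ.+ (y * suc d)) (*-identityˡ (suc a))) (trans (ℤ.pos-* (suc a) (suc d)) (cong (ℤ.+ suc a ℤ.*_) (ℚ-cross a q′))))
    where
    lemma : ∀ A q → ((ℤ.+ 1 ℤ.* A ℤ.+ ℤ.- (ℤ.+ 1) ℤ.* ℤ.+ 1) ℤ.* (A ℤ.* (ℤ.+ 1 ℤ.+ q)) ℤ.+ ℤ.+ 1 ℤ.* A) ℤ.* (A ℤ.* (ℤ.+ 1 ℤ.+ q))
                  ≡ (ℤ.+ 1 ℤ.* (A ℤ.* (ℤ.+ 1 ℤ.+ q)) ℤ.+ ℤ.- q ℤ.* ℤ.+ 1) ℤ.* (A ℤ.* (A ℤ.* (ℤ.+ 1 ℤ.+ q)))
    lemma = ℤRing.solve-∀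
    go : ∀ A D P S R q → D ≡ A ℤ.* (ℤ.+ 1 ℤ.+ q) → P ≡ A → S ≡ A ℤ.* (ℤ.+ 1 ℤ.+ q) → R ≡ A ℤ.* (A ℤ.* (ℤ.+ 1 ℤ.+ q)) →
         ((ℤ.+ 1 ℤ.* A ℤ.+ ℤ.- (ℤ.+ 1) ℤ.* ℤ.+ 1) ℤ.* D ℤ.+ ℤ.+ 1 ℤ.* P) ℤ.* S ≡ (ℤ.+ 1 ℤ.* D ℤ.+ ℤ.- q ℤ.* ℤ.+ 1) ℤ.* R
    go A _ _ _ _ q refl refl refl refl = lemma A q

thr∞-minus : ∀ a q′ → thr∞ a ℚ.- (ℤ.+ 1) ℚ./ (suc a * suc q′) ≡ 1ℚ ℚ.- (ℤ.+ suc (suc q′)) ℚ./ (suc a * suc q′)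
thr∞-minus a q′ = ℚ.toℚᵘ-injective (ℚᵘ.≃-trans lhs (ℚᵘ.≃-trans (*≡* eq) (ℚᵘ.≃-sym rhs)))
  where
  d = q′ + a * suc q′
  x = (ℤ.+ 1) ℚ./ suc a
  y = (ℤ.+ 1) ℚ./ suc d
  z = (ℤ.+ suc (suc q′)) ℚ./ suc d
  lhs : toℚᵘ (thr∞ a ℚ.- y) ℚᵘ.≃ (mkℚᵘ (ℤ.+ 1) 0 ℚᵘ.+ ℚᵘ.- mkℚᵘ (ℤ.+ 1) a) ℚᵘ.+ ℚᵘ.- mkℚᵘ (ℤ.+ 1) d
  lhs = ℚᵘ.≃-trans (ℚ.toℚᵘ-homo-+ (thr∞ a) (ℚ.- y)) (ℚᵘ.+-cong (ℚᵘ.≃-trans (ℚ.toℚᵘ-homo-+ 1ℚ (ℚ.- x))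
          (ℚᵘ.+-cong ℚᵘ.≃-refl (ℚᵘ.≃-trans (ℚ.toℚᵘ-homo‿- x) (ℚᵘ.-‿cong (toℚᵘ-/ 1 a)))))
          (ℚᵘ.≃-trans (ℚ.toℚᵘ-homo‿- y) (ℚᵘ.-‿cong (toℚᵘ-/ 1 d))))
  rhs : toℚᵘ (1ℚ ℚ.- z) ℚᵘ.≃ mkℚᵘ (ℤ.+ 1) 0 ℚᵘ.+ ℚᵘ.- mkℚᵘ (ℤ.+ suc (suc q′)) d
  rhs = ℚᵘ.≃-trans (ℚ.toℚᵘ-homo-+ 1ℚ (ℚ.- z)) (ℚᵘ.+-cong ℚᵘ.≃-refl (ℚᵘ.≃-trans (ℚ.toℚᵘ-homo‿- z) (ℚᵘ.-‿cong (toℚᵘ-/ (suc (suc q′)) d))))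
  eq : ((ℤ.+ 1 ℤ.* ℤ.+ suc a ℤ.+ ℤ.- (ℤ.+ 1) ℤ.* ℤ.+ 1) ℤ.* ℤ.+ suc d ℤ.+ ℤ.- (ℤ.+ 1) ℤ.* ℤ.+ (1 * suc a)) ℤ.* ℤ.+ (1 * suc d)
     ≡ (ℤ.+ 1 ℤ.* ℤ.+ suc d ℤ.+ ℤ.- (ℤ.+ suc (suc q′)) ℤ.* ℤ.+ 1) ℤ.* ℤ.+ (1 * suc a * suc d)
  eq = go (ℤ.+ suc a) (ℤ.+ suc d) (ℤ.+ (1 * suc a)) (ℤ.+ (1 * suc d)) (ℤ.+ (1 * suc a * suc d)) (ℤ.+ q′) (ℤ.+ suc (suc q′)) (ℚ-cross a q′) (cong ℤ.+_ (*-identityˡ (suc a)))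
          (trans (cong ℤ.+_ (*-identityˡ (suc d))) (ℚ-cross a q′))
          (trans (cong (λ y → ℤ.+ (y * suc d)) (*-identityˡ (suc a))) (trans (ℤ.pos-* (suc a) (suc d)) (cong (ℤ.+ suc a ℤ.*_) (ℚ-cross a q′)))) refl
    where
    lemma : ∀ A q → ((ℤ.+ 1 ℤ.* A ℤ.+ ℤ.- (ℤ.+ 1) ℤ.* ℤ.+ 1) ℤ.* (A ℤ.* (ℤ.+ 1 ℤ.+ q)) ℤ.+ ℤ.- (ℤ.+ 1) ℤ.* A) ℤ.* (A ℤ.* (ℤ.+ 1 ℤ.+ q))
                  ≡ (ℤ.+ 1 ℤ.* (A ℤ.* (ℤ.+ 1 ℤ.+ q)) ℤ.+ ℤ.- (ℤ.+ 2 ℤ.+ q) ℤ.* ℤ.+ 1) ℤ.* (A ℤ.* (A ℤ.* (ℤ.+ 1 ℤ.+ q)))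
    lemma = ℤRing.solve-∀
    go : ∀ A D P S R q q₂ → D ≡ A ℤ.* (ℤ.+ 1 ℤ.+ q) → P ≡ A → S ≡ A ℤ.* (ℤ.+ 1 ℤ.+ q) → R ≡ A ℤ.* (A ℤ.* (ℤ.+ 1 ℤ.+ q)) → q₂ ≡ ℤ.+ 2 ℤ.+ q →
         ((ℤ.+ 1 ℤ.* A ℤ.+ ℤ.- (ℤ.+ 1) ℤ.* ℤ.+ 1) ℤ.* D ℤ.+ ℤ.- (ℤ.+ 1) ℤ.* P) ℤ.* S ≡ (ℤ.+ 1 ℤ.* D ℤ.+ ℤ.- q₂ ℤ.* ℤ.+ 1) ℤ.* R
    go A _ _ _ _ q _ refl refl refl refl refl = lemma A q

scale-≤ : ∀ n {r s} → r ℚ.≤ s → r ℚ.* ℕ→ℚ n ℚ.≤ s ℚ.* ℕ→ℚ n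
scale-≤ n h = ℚ.*-monoʳ-≤-nonNeg (ℕ→ℚ n) ⦃ ℚ.normalize-nonNeg n 1 ⦄ h

chromatic-bound : ℕ → ℕ → ℕ
chromatic-bound a q = colours (suc (increments a q * 2)) 1

part₆ : ∀ a ε → Pos ε → Σ ℕ λ C → (G : Graph) → LocallyBipartite a G → MinDeg> G (thr∞ a ℚ.+ ε) → Colourable G C
part₆ a ε pos with unit-below a ε pos
... | q′ , le = chromatic-bound a (suc q′) , bound
  where
  bound : (G : Graph) → LocallyBipartite a G → MinDeg> G (thr∞ a ℚ.+ ε) → Colourable G (chromatic-bound a (suc q′))
  bound record { size = zero } lb deg = (λ ()) , λ ()
  bound G@record { size = suc n } lb deg with largest (Weights.miss (E G) (λ _ → true))
  ... | v , mx = Bounded-χ.bounded (E G) (E-sym G) (E-irr G) a (suc q′) m (λ u _ → mx u) dense (Translate.locBip G lb) (s≤s z≤n)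
    where
    m = Weights.miss (E G) (λ _ → true) v
    D = suc a * suc q′
    low : 1ℚ ℚ.- (ℤ.+ q′) ℚ./ D ℚ.≤ thr∞ a ℚ.+ ε
    low = ℚ.≤-trans (ℚ.≤-reflexive (sym (thr∞-plus a q′))) (ℚ.+-monoʳ-≤ (thr∞ a) le)
    lt : D * m < q′ * suc n
    lt = Degrees.miss-bound G q′ (q′ + a * suc q′) v (from-ℚ-< q′ (q′ + a * suc q′) (suc n) (Defs.deg G v)
           (ℚ.≤-<-trans (scale-≤ (suc n) low) (deg v)))
    dense : suc q′ * (suc a * m) + suc n ≤ suc q′ * suc n
    dense = ≤-trans (≤-reflexive (cong (_+ suc n) (lemma q′ a m))) (≤-trans (+-monoˡ-≤ (suc n) (<⇒≤ lt)) (≤-reflexive (+-comm (q′ * suc n) (suc n))))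
      where lemma : ∀ q a m → suc q * (suc a * m) ≡ suc a * suc q * m
            lemma = solve-∀

≤-power : ∀ N r → 2 ≤ N → r ≤ N ^ r
≤-power N zero    h = z≤n
≤-power N (suc r) h = ≤-trans (+-mono-≤ (m^n>0 N ⦃ ℕ.>-nonZero (≤-trans (s≤s z≤n) h) ⦄ r) (≤-power N r h))
  (≤-trans (≤-reflexive (cong (λ y → N ^ r + y) (sym (+-identityʳ (N ^ r))))) (*-monoˡ-≤ (N ^ r) h))

-- The inequality 1 + L/ν ≤ (1 + 1/ν)^L, cleared of denominators.
bernoulli : ∀ ν L → (ν + L) * ν ^ L ≤ ν * (1 + ν) ^ L
bernoulli ν zero    = ≤-reflexive (cong (_* 1) (+-identityʳ ν))
bernoulli ν (suc L) = begin
  (ν + suc L) * (ν * ν ^ L) ≤⟨ m≤m+n _ (L * ν ^ L) ⟩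
  (ν + suc L) * (ν * ν ^ L) + L * ν ^ L ≡⟨ lem₁ ν L (ν ^ L) ⟩
  (1 + ν) * ((ν + L) * ν ^ L) ≤⟨ *-monoʳ-≤ (1 + ν) (bernoulli ν L) ⟩
  (1 + ν) * (ν * (1 + ν) ^ L) ≡⟨ lem₂ ν ((1 + ν) ^ L) ⟩
  ν * ((1 + ν) * (1 + ν) ^ L) ∎
  where
  open ≤-Reasoning
  lem₁ : ∀ ν L x → (ν + suc L) * (ν * x) + L * x ≡ (1 + ν) * ((ν + L) * x)
  lem₁ = solve-∀
  lem₂ : ∀ ν x → (1 + ν) * (ν * x) ≡ ν * ((1 + ν) * x)
  lem₂ = solve-∀

power-gap : ∀ H ν L → H * ν ≤ L → 1 ≤ L → H * ν ^ L ≤ (1 + ν) ^ L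
power-gap H zero    (suc L) h le = ≤-trans (≤-reflexive (*-zeroʳ H)) z≤n
power-gap H (suc ν) L h le = *-cancelˡ-≤ (suc ν) (begin
  suc ν * (H * suc ν ^ L) ≡⟨ lem (suc ν) H (suc ν ^ L) ⟩
  H * suc ν * suc ν ^ L ≤⟨ *-monoˡ-≤ (suc ν ^ L) (≤-trans h (m≤n+m L (suc ν))) ⟩
  (suc ν + L) * suc ν ^ L ≤⟨ bernoulli (suc ν) L ⟩
  suc ν * (1 + suc ν) ^ L ∎)
  where
  open ≤-Reasoning
  lem : ∀ v h x → v * (h * x) ≡ h * v * x
  lem = solve-∀

module LargeChromatic (b q′ k : ℕ) where
  q h r N L : ℕ
  q = suc q′
  -- This makes r = 4q + 1, just enough for the errors collected in `degree-lower`.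
  h = q + q′
  r = 3 + (h + h)
  N = points (2 + (h + h)) (suc k)
  -- The two summands r give r·N^r ≤ N^L, so the tuples are few compared with X; the last one makes
  -- the sequences that miss a given tuple rare, through `power-gap`.
  L = r + (r + suc h * N)

  open ShiftGraph N h L using (w; X; G₁; decodeV; tuple; good; locallyBipartite₁; shift-colouring)
  open ShiftGraph.Degree N h L using (degV; degree-G₁; degree-bound)

  N≥2 : 2 ≤ N
  N≥2 = points≥2 (2 + (h + h)) (suc k)

  ν : ℕ
  ν = N ∸ r

  -- The b parts of size X and the two sides of the bipartite graph form b + 2 balanced classes,
  -- whose relative degree is near 1 - 1/(b + 2); the w tuples are too few to matter.
  G : Graph
  G = blowUp (K b) X ⊕ G₁

  locally-bipartite : LocallyBipartite (suc b) G
  locally-bipartite = subst (λ a → LocallyBipartite a G) (+-comm b 1)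
    (locallyBipartite-pull {G} {cones b G₁} (b + 1) (join-hom b X G₁) (locallyBipartite-cones b 1 locallyBipartite₁))

  inclusion : Hom G₁ G
  inclusion = (b * X ↑ʳ_) , adj
    where adj : ∀ u v → Adj G₁ u v → Adj G (b * X ↑ʳ u) (b * X ↑ʳ v)
          adj u v e rewrite Fin.splitAt-↑ʳ (b * X) (size G₁) u | Fin.splitAt-↑ʳ (b * X) (size G₁) v = e

  not-colourable : ¬ Colourable G k
  not-colourable (c , pr) = let (c′ , pr′) = shift-colouring (colourable-pull {G₁} {G} inclusion more)
                            in shift-not-colourable (2 + (h + h)) (suc k) c′ pr′
    -- The spare colour covers k = 0, where `shift-colouring` would have no default.
    where more : Colourable G (suc k)
          more = suc ∘ c , λ u v e q → pr u v e (Fin.suc-injective q)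

  none≡ν : ∀ i → good i ≡ true → none (tuple i) ≡ ν
  none≡ν i e = trans (sym (m+n∸m≡n (length (tuple i)) (none (tuple i))))
    (cong₂ _∸_ (proj₂ (proj₂ (counts (tuple i) e))) (length-listOf {N} r i))

  rw≤X : r * w ≤ X
  rw≤X = ≤-trans (*-monoˡ-≤ w (≤-power N r N≥2)) (≤-trans (≤-reflexive (sym (^-distribˡ-+-* N r r)))
           (^-monoʳ-≤ N ⦃ ℕ.>-nonZero (≤-trans (s≤s z≤n) N≥2) ⦄ (+-monoʳ-≤ r (m≤m+n r (suc h * N)))))

  Hν≤X : suc h * ν ^ L ≤ X
  Hν≤X = ≤-trans (power-gap (suc h) ν L (≤-trans (*-monoʳ-≤ (suc h) (m∸n≤m N r)) (≤-trans (m≤n+m (suc h * N) r) (m≤n+m (r + suc h * N) r))) (s≤s z≤n))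
           (^-monoˡ-≤ L 1+ν≤N)
    where
    1+ν≤N : 1 + ν ≤ N
    1+ν≤N = lemma N N≥2
      where lemma : ∀ M → 2 ≤ M → 1 + (M ∸ r) ≤ M
            lemma (suc M) _ = s≤s (≤-trans (≤-reflexive refl) (m∸n≤m M (2 + (h + h))))

  -- After multiplication by r the errors are qX for the w tuples, qX for the factor (r - 1)/r and
  -- 2qX for sequences missing a tuple; 4q ≤ r absorbs them.
  degree-lower : ∀ s → q * w + q * X ≤ q * degV s + X
  degree-lower s = *-cancelˡ-≤ r (begin
    r * (q * w + q * X) ≡⟨ lem₁ r q w X ⟩
    q * (r * w) + r * q * X ≤⟨ +-monoˡ-≤ (r * q * X) (*-monoʳ-≤ q rw≤X) ⟩
    q * X + r * q * X ≡⟨ lem₂ q′ X ⟩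
    q * (2 * suc h * X) + 2 * q * X ≤⟨ +-monoˡ-≤ (2 * q * X) (*-monoʳ-≤ q (degree-bound none≡ν s)) ⟩
    q * (r * degV s + 2 * suc h * ν ^ L) + 2 * q * X ≡⟨ lem₃ q r (degV s) (suc h) (ν ^ L) X ⟩
    r * (q * degV s) + (2 * q * (suc h * ν ^ L) + 2 * q * X) ≤⟨ +-monoʳ-≤ (r * (q * degV s)) (+-monoˡ-≤ (2 * q * X) (*-monoʳ-≤ (2 * q) Hν≤X)) ⟩
    r * (q * degV s) + (2 * q * X + 2 * q * X) ≤⟨ +-monoʳ-≤ (r * (q * degV s)) (≤-trans (m≤m+n _ X) (≤-reflexive (lem₄ q′ X))) ⟩
    r * (q * degV s) + r * X ≡⟨ sym (*-distribˡ-+ r (q * degV s) X) ⟩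
    r * (q * degV s + X) ∎)
    where
    open ≤-Reasoning
    lem₁ : ∀ r q w x → r * (q * w + q * x) ≡ q * (r * w) + r * q * x
    lem₁ = solve-∀
    lem₂ : ∀ p x → suc p * x + (3 + ((suc p + p) + (suc p + p))) * suc p * x ≡ suc p * (2 * suc (suc p + p) * x) + 2 * suc p * x
    lem₂ = solve-∀
    lem₃ : ∀ q r d h y x → q * (r * d + 2 * h * y) + 2 * q * x ≡ r * (q * d) + (2 * q * (h * y) + 2 * q * x)
    lem₃ = solve-∀
    lem₄ : ∀ p x → 2 * suc p * x + 2 * suc p * x + x ≡ (3 + ((suc p + p) + (suc p + p))) * x
    lem₄ = solve-∀

  few-missing : ∀ x → q * size G ≤ q * degree G x + suc q * X
  few-missing x = ≤-trans (go (splitAt (b * X) x)) (≤-reflexive (cong (λ d → q * d + suc q * X) (sym (degree-⊕ (blowUp (K b) X) G₁ x))))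
    where
    go : ∀ s → q * size G ≤ q * joinDegree (blowUp (K b) X) G₁ s + suc q * X
    go (inj₁ i) = ≤-trans (≤-reflexive (trans (cong (λ y → q * (y * X + size G₁)) (sym (degree-K b (quotient X i)))) (lem q (degree (K b) (quotient X i)) X (size G₁))))
                  (≤-trans (+-monoʳ-≤ (q * (X * degree (K b) (quotient X i) + size G₁)) (m≤n+m (q * X) X)) (≤-reflexive (cong (λ d → q * (d + size G₁) + suc q * X) (sym (degree-blowUp (K b) X i)))))
      where lem : ∀ q d x g → q * ((d + 1) * x + g) ≡ q * (x * d + g) + q * x
            lem = solve-∀
    go (inj₂ y) = ≤-trans (≤-reflexive (lem₁ q (b * X) w X)) (≤-trans (+-monoʳ-≤ (q * (b * X) + q * X) (degree-lower (decodeV y)))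
                  (≤-reflexive (trans (lem₂ q (b * X) X (degV (decodeV y))) (cong (λ d → q * (b * X + d) + suc q * X) (sym (degree-G₁ y))))))
      where
      lem₁ : ∀ q B w x → q * (B + (w + (x + x))) ≡ q * B + q * x + (q * w + q * x)
      lem₁ = solve-∀
      lem₂ : ∀ q B x d → q * B + q * x + (q * d + x) ≡ q * (B + d) + suc q * x
      lem₂ = solve-∀

  degree-condition : ∀ x → suc (suc b) * q * size G ≤ suc (suc b) * q * degree G x + suc q * size G
  degree-condition x = begin
    suc (suc b) * q * size G ≡⟨ *-assoc (suc (suc b)) q (size G) ⟩
    suc (suc b) * (q * size G) ≤⟨ *-monoʳ-≤ (suc (suc b)) (few-missing x) ⟩
    suc (suc b) * (q * degree G x + suc q * X) ≡⟨ lem b q (degree G x) X ⟩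
    suc (suc b) * q * degree G x + suc q * (b * X + (X + X)) ≤⟨ +-monoʳ-≤ (suc (suc b) * q * degree G x) (*-monoʳ-≤ (suc q) (+-monoʳ-≤ (b * X) (m≤n+m (X + X) w))) ⟩
    suc (suc b) * q * degree G x + suc q * size G ∎
    where
    open ≤-Reasoning
    lem : ∀ b q d x → suc (suc b) * (q * d + suc q * x) ≡ suc (suc b) * q * d + suc q * (b * x + (x + x))
    lem = solve-∀

part₇ : ∀ b ε → Pos ε → ∀ k → Σ Graph λ G → LocallyBipartite (suc b) G × MinDeg≥ G (thr∞ (suc b) ℚ.- ε) × ¬ Colourable G k
part₇ b ε pos k with unit-below (suc b) ε pos
... | q′ , le = G , locally-bipartite , min-degree , not-colourable
  where
  open LargeChromatic b q′ k
  d = q′ + suc b * suc q′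
  min-degree : MinDeg≥ G (thr∞ (suc b) ℚ.- ε)
  min-degree v = ℚ.≤-trans (scale-≤ (size G) (ℚ.≤-trans (ℚ.+-monoʳ-≤ (thr∞ (suc b)) (ℚ.neg-antimono-≤ le)) (ℚ.≤-reflexive (thr∞-minus (suc b) q′))))
    (to-ℚ-≤ (suc (suc q′)) d (size G) (Defs.deg G v)
      (subst (λ y → suc d * size G ≤ suc d * y + suc (suc q′) * size G) (sym (countF≡sumF (E G v))) (degree-condition v)))

theorem5p6 : (a : ℕ) → 1 ≤ a →
      -- (1)
      ((G : Graph) → LocallyBipartite a G → MinDeg> G (thr a 3) → Colourable G (a + 2))
    × ((t : ℕ) → 1 ≤ t →
        LocallyBipartite a (blowUp (K3 (a ∸ 1) ⊕ C7bar) t)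
      × MinDeg≡ (blowUp (K3 (a ∸ 1) ⊕ C7bar) t) (thr a 3)
      × ¬ Colourable (blowUp (K3 (a ∸ 1) ⊕ C7bar) t) (a + 2))
      -- (2)
    × ((G : Graph) → LocallyBipartite a G → MinDeg> G (thr a 4) →
        Colourable G (a + 2) ⊎ Contains G (K (a ∸ 1) ⊕ C7bar))
      -- (3)
    × ((G : Graph) → LocallyBipartite a G → MinDeg> G (thr a 5) →
        Colourable G (a + 2) ⊎ (Contains G (K (a ∸ 1) ⊕ C7bar) ⊎ Contains G (K (a ∸ 1) ⊕ H2⁺)))
      -- (4)
    × ((G : Graph) → LocallyBipartite a G → MinDeg> G (thr a 6) →
        Colourable G (a + 2) ⊎ Contains G (K (a ∸ 1) ⊕ H2))
      -- (5)
    × ((G : Graph) → LocallyBipartite a G → MinDeg> G (thr a 7) →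
        Colourable G (a + 2) ⊎ (Contains G (K (a ∸ 1) ⊕ H2) ⊎ Contains G (K (a ∸ 1) ⊕ T0)))
      -- (6)
    × ((ε : ℚ) → Pos ε → Σ ℕ λ C →
        (G : Graph) → LocallyBipartite a G → MinDeg> G (thr∞ a +ℚ ε) → Colourable G C)
      -- (7)
    × ((ε : ℚ) → Pos ε → (k : ℕ) → Σ Graph λ G →
        LocallyBipartite a G × MinDeg≥ G (thr∞ a -ℚ ε) × ¬ Colourable G k)
theorem5p6 (suc b) _ =
    (λ G lb δ → with-degree b 3 G δ (λ c → c _) (Sufficiency.part₁ b G lb))
  , (λ { (suc t) _ → Tight.locallyBipartite b t , Tight.minDegree b t , Tight.not-colourable b t })
  , (λ G lb δ → with-degree b 4 G δ (λ c → inj₁ (c _)) (Sufficiency.part₂ b G lb))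
  , (λ G lb δ → with-degree b 5 G δ (λ c → inj₁ (c _)) (Sufficiency.part₃ b G lb))
  , (λ G lb δ → with-degree b 6 G δ (λ c → inj₁ (c _)) (Sufficiency.part₄ b G lb))
  , (λ G lb δ → with-degree b 7 G δ (λ c → inj₁ (c _)) (Sufficiency.part₅ b G lb))
  , part₆ (suc b)
  , part₇ b
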